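{- There exists $\delta>0$ such that for all sufficiently large $n$ in terms of $\delta$, there is an edge-coloring of a subgraph $F\subset K_{n,n}$ with at most $n/2$ colors and the following properties: (1) every color class is a union of vertex-disjoint copies of $C_6$; (2) every copy of $C_4$ in $F$ intersects some color class in an odd number of edges; (3) the graph $L=K_{n,n}\setminus E(F)$ has maximum degree at most $n^{1-\delta}$; (4) writing $V(K_{n,n})=X\cup Y$ for the bipartition, for each $(x,y)\in X\times Y$, the number of edges $x'y'\in E(L)$ with $x'\in X\setminus\{x\}$, $y'\in Y\setminus\{y\}$ such that $xy'$ and $yx'$ receive the same color is at most $4n^{1-\delta}$.
   Context: $K_{n,n}$ is the complete bipartite graph with parts $X$, $Y$ of size $n$; $C_k$ is the cycle of length $k$. When $n$ is odd, $n/2$ means $\lceil n/2\rceil$. -}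

module Defs where

open import Data.Nat using (ℕ; zero; suc; _+_; _*_; _^_; _≤_; _%_)
open import Data.Fin using (Fin; zero; suc; _≟_)
open import Data.Bool using (Bool; true; false; _∧_; not; if_then_else_)
open import Data.Product using (Σ; ∃; _×_; _,_)
open import Data.Sum using (_⊎_)
open import Relation.Binary.PropositionalEquality using (_≡_; _≢_)
open import Relation.Nullary.Decidable using (⌊_⌋)
open import Function.Definitions using (Injective)

-- Vertices of K_{n,n}: X = Fin n, Y = Fin n.  A spanning subgraph F ⊆ K_{n,n}
-- is given by its (bipartite) adjacency: F x y = true iff xy ∈ E(F).
BipGraph : ℕ → Set
BipGraph n = Fin n → Fin n → Bool

count : ∀ {m} → (Fin m → Bool) → ℕ
count {zero} f = 0
count {suc m} f = (if f zero then 1 else 0) + count (λ i → f (suc i))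

sumF : ∀ {m} → (Fin m → ℕ) → ℕ
sumF {zero} f = 0
sumF {suc m} f = f zero + sumF (λ i → f (suc i))

ind : Bool → ℕ
ind b = if b then 1 else 0

Odd : ℕ → Set
Odd m = m % 2 ≡ 1

next3 : Fin 3 → Fin 3
next3 zero = suc zero
next3 (suc zero) = suc (suc zero)
next3 (suc (suc zero)) = zero

-- A copy of C_6 in K_{n,n}: x₀ y₀ x₁ y₁ x₂ y₂ x₀ with distinct xᵢ ∈ X, distinct yᵢ ∈ Y.
record Hex (n : ℕ) : Set where
  field
    xs : Fin 3 → Fin n
    ys : Fin 3 → Fin n
    xs-inj : Injective _≡_ _≡_ xs
    ys-inj : Injective _≡_ _≡_ ys
open Hex public

HexEdge : ∀ {n} → Hex n → Fin n → Fin n → Set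
HexEdge h x y = ∃ λ j → ((xs h j ≡ x) × (ys h j ≡ y)) ⊎ ((xs h (next3 j) ≡ x) × (ys h j ≡ y))

Disjoint : ∀ {n} → Hex n → Hex n → Set
Disjoint h h' = ∀ j k → (xs h j ≢ xs h' k) × (ys h j ≢ ys h' k)

ClassIsC6Union : ∀ {n k} → BipGraph n → (Fin n → Fin n → Fin k) → Fin k → Set
ClassIsC6Union {n} F col c =
  Σ ℕ λ m → Σ (Fin m → Hex n) λ cyc →
    (∀ i i' → i ≢ i' → Disjoint (cyc i) (cyc i')) ×
    (∀ x y → ((F x y ≡ true) × (col x y ≡ c) → ∃ λ i → HexEdge (cyc i) x y)
           × ((∃ λ i → HexEdge (cyc i) x y) → (F x y ≡ true) × (col x y ≡ c)))

C4Odd : ∀ {n k} → BipGraph n → (Fin n → Fin n → Fin k) → Set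
C4Odd {n} {k} F col =
  ∀ x₁ x₂ y₁ y₂ → x₁ ≢ x₂ → y₁ ≢ y₂ →
  F x₁ y₁ ≡ true → F x₁ y₂ ≡ true → F x₂ y₁ ≡ true → F x₂ y₂ ≡ true →
  ∃ λ (c : Fin k) → Odd (ind ⌊ col x₁ y₁ ≟ c ⌋ + ind ⌊ col x₁ y₂ ≟ c ⌋
                         + ind ⌊ col x₂ y₁ ≟ c ⌋ + ind ⌊ col x₂ y₂ ≟ c ⌋)

degLX : ∀ {n} → BipGraph n → Fin n → ℕ
degLX F x = count (λ y → not (F x y))

degLY : ∀ {n} → BipGraph n → Fin n → ℕ
degLY F y = count (λ x → not (F x y))

-- with δ = p / q :  d ≤ n^(1-δ)  ⇔  d^q * n^p ≤ n^q   (for n ≥ 1)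
LePow : ℕ → ℕ → ℕ → ℕ → Set
LePow d n p q = d ^ q * n ^ p ≤ n ^ q

-- d ≤ 4 n^(1-δ)  ⇔  d^q * n^p ≤ 4^q * n^q
LePow4 : ℕ → ℕ → ℕ → ℕ → Set
LePow4 d n p q = d ^ q * n ^ p ≤ 4 ^ q * n ^ q

badCount : ∀ {n k} → BipGraph n → (Fin n → Fin n → Fin k) → Fin n → Fin n → ℕ
badCount F col x y =
  sumF (λ x' → count (λ y' →
    not ⌊ x' ≟ x ⌋ ∧ not ⌊ y' ≟ y ⌋ ∧ not (F x' y') ∧ F x y' ∧ F x' y ∧ ⌊ col x y' ≟ col x' y ⌋))

{-# OPTIONS --safe #-}

-- Let A be an abelian group with maps lam p (p < 3). The block (s , κ) places the vertices x_p = s + lam p κ and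
-- y_q = s − lam q κ; joined for p ≠ q they form a hexagon, coloured κ. If lam p + lam q, lam p − lam q and
-- 2 lam p + lam q + lam r are invertible, then for fixed positions the blocks decompose all pairs (x , y), two
-- vertices determine their block, and no C₄ with opposite edges of equal colours arises.
--
-- Starting from a single uncovered pair, one passes from V to 3 × B × V: pairs with distinct first digits are
-- covered by blocks on B × V whose positions are the digits, and pairs with a common digit d recursively, by
-- hexagons on V times blocks on B whose colours do not mention d. The former use the sum of the B-coordinates,
-- the latter a multiple of their difference that depends on d, so that a 4-cycle alternating between the two
-- kinds would give a solution of  S τ_d k − S' τ_d' k = (lam d − lam d') ω , and there is none.
-- After t steps a fraction 3⁻ᵗ of the edges is uncovered.
--
-- For arbitrary n take V × ℤ/m with |V|² ≤ n and m ≡ 1 modulo a constant P, and keep the hexagons whose vertices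
-- and colour lie in initial segments of sizes n and n/2. Only hexagons with one of the last P values among their
-- ℤ/m-coordinates are lost, and these coordinates vary bijectively along the pairs (x' , y') counted in (4).

module Submission where

open import Defs

open import Algebra.Bundles using (CommutativeMonoid)
import Algebra.Solver.CommutativeMonoid as CommutativeMonoidSolver
open import Data.Bool using (Bool; true; false; not; _∧_)
open import Data.Bool.Properties using (not-injective)
open import Data.Empty using (⊥; ⊥-elim)
open import Data.Fin as Fin using (Fin; zero; suc; toℕ; fromℕ<; inject≤; combine; splitAt; _≟_)
open import Data.Fin.Patterns
open import Data.Fin.Properties as Fin using (all?; any?; toℕ<n; toℕ-fromℕ<; toℕ-injective; toℕ-inject≤; toℕ-combine; *↔×; +↔⊎; 0↔⊥; 1↔⊤; ¬∀⟶∃¬)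
open import Data.Nat as ℕ using (ℕ; zero; suc; _≤_; _<_; _≤?_; _<?_; z≤n; s≤s; ⌈_/2⌉; ⌊_/2⌋; NonZero)
import Data.Nat.Properties as ℕ
open import Data.Product using (Σ; ∃; _×_; _,_; proj₁; proj₂; map₁)
open import Data.Product.Function.NonDependent.Propositional using (_×-↔_)
open import Data.Product.Properties using (≡-dec)
open import Data.Sum using (_⊎_; inj₁; inj₂; [_,_]′)
open import Data.Sum.Function.Propositional using (_⊎-↔_)
open import Data.Sum.Properties using (inj₁-injective; inj₂-injective)
open import Data.Unit using (⊤; tt)
open import Function using (_∘_; _↔_; Inverse)
open import Function.Properties.Inverse using (↔-refl; ↔-sym; ↔-trans)
open import Relation.Binary.PropositionalEquality
open import Relation.Nullary using (Dec; ¬_; contradiction; yes; no)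
open import Relation.Nullary.Decidable using (⌊_⌋; ¬?; _→-dec_; _⊎-dec_; _×-dec_; from-yes; map′)
open import Relation.Unary using (Decidable)

-- The colour budget shapes the recursion. With only half as many colours as vertices on a side, the
-- three digits have to reuse the same low colours. This creates 4-cycles in which low edges of one
-- colour, in the copies of digits d and d', are joined by two top edges of one colour κ. If top
-- edges used differences, the equation for the B-coordinates of such a cycle would always be
-- solvable in κ. With sums, both top equations contain the same `S p q κ`, so that κ cancels and
-- only a constant built from `ω` remains; the factors 7 of `B` exclude the resulting equation. The
-- factor 9 of `B` serves the digit. Scalars of F₃ cannot be used as `lam`, since three distinct
-- ones include 1 and -1, whose sum is 0; but a digit and an element of F₉ together make up F₂₇. The
-- value δ = 1/36 arises from 3 |B| ≤ 3⁹: one step multiplies |V| by at most 3⁹ and the uncovered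
-- fraction by 1/3. As n is below the next |V|², it is at most the 18th power of 3 · 3ᵗ, and half of
-- the saving 1/18 pays for the factor `A t`, which is linear in t.

-- Abelian groups, linear structures and their blocks

record AbGroup (A : Set) : Set where
  infixl 6 _⊕_
  infix 8 ⊖_
  field
    _⊕_ : A → A → A
    ε : A
    ⊖_ : A → A
    ⊕-assoc : ∀ a b c → (a ⊕ b) ⊕ c ≡ a ⊕ (b ⊕ c)
    ⊕-comm : ∀ a b → a ⊕ b ≡ b ⊕ a
    ⊕-identityˡ : ∀ a → ε ⊕ a ≡ a
    ⊕-inverseˡ : ∀ a → ⊖ a ⊕ a ≡ ε

module GroupProperties {A : Set} (GA : AbGroup A) where
  open AbGroup GA

  commutativeMonoid : CommutativeMonoid _ _
  commutativeMonoid = record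
    { Carrier = A ; _≈_ = _≡_ ; _∙_ = _⊕_ ; ε = ε
    ; isCommutativeMonoid = record
      { isMonoid = record
        { isSemigroup = record
          { isMagma = record { isEquivalence = isEquivalence ; ∙-cong = cong₂ _⊕_ }
          ; assoc = ⊕-assoc }
        ; identity = ⊕-identityˡ , λ a → trans (⊕-comm a ε) (⊕-identityˡ a) }
      ; comm = ⊕-comm } }

  module CM = CommutativeMonoidSolver commutativeMonoid
  open CM using (solve; _⊜_) renaming (_⊕_ to _⊞_)

  ⊕-cancelˡ : ∀ a {b c} → a ⊕ b ≡ a ⊕ c → b ≡ c
  ⊕-cancelˡ a {b} {c} e = trans (sym (strip b)) (trans (cong (⊖ a ⊕_) e) (strip c))
    where
    strip : ∀ x → ⊖ a ⊕ (a ⊕ x) ≡ x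
    strip x = trans (sym (⊕-assoc (⊖ a) a x)) (trans (cong (_⊕ x) (⊕-inverseˡ a)) (⊕-identityˡ x))

  ⊕-cancelʳ : ∀ a {b c} → b ⊕ a ≡ c ⊕ a → b ≡ c
  ⊕-cancelʳ a {b} {c} e = ⊕-cancelˡ a (trans (⊕-comm a b) (trans e (⊕-comm c a)))

  ⊖-⊕ : ∀ a b → (a ⊕ ⊖ b) ⊕ b ≡ a
  ⊖-⊕ a b = trans (⊕-assoc a (⊖ b) b)
    (trans (cong (a ⊕_) (⊕-inverseˡ b)) (trans (⊕-comm a ε) (⊕-identityˡ a)))

  ⊖-inj : ∀ {a b} → ⊖ a ≡ ⊖ b → a ≡ b
  ⊖-inj {a} {b} e = ⊕-cancelˡ (⊖ a) (trans (⊕-inverseˡ a) (sym (trans (cong (_⊕ b) e) (⊕-inverseˡ b))))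

  ⊖-involutive : ∀ a → ⊖ ⊖ a ≡ a
  ⊖-involutive a = ⊕-cancelˡ (⊖ a) (trans (⊕-comm (⊖ a) (⊖ ⊖ a)) (trans (⊕-inverseˡ (⊖ a)) (sym (⊕-inverseˡ a))))

-- Invertibility is recorded as solvability and injectivity, a form that passes to products and to
-- recoloured blocks. `D-inj` is injectivity of `lam p − lam q` written without subtraction. `T-inj`
-- includes the case `q ≡ r`, where it says that twice `S p q` is injective.
record Lin (A : Set) : Set where
  field
    group : AbGroup A
  open AbGroup group public
  field
    lam : Fin 3 → A → A

  S : Fin 3 → Fin 3 → A → A
  S p q κ = lam p κ ⊕ lam q κ

  field
    sol : Fin 3 → Fin 3 → A → A
    S-sol : ∀ {p q} → p ≢ q → ∀ a → S p q (sol p q a) ≡ a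
    S-inj : ∀ {p q} → p ≢ q → ∀ {κ κ'} → S p q κ ≡ S p q κ' → κ ≡ κ'
    D-inj : ∀ {p q} → p ≢ q → ∀ {κ κ'} → lam p κ ⊕ lam q κ' ≡ lam p κ' ⊕ lam q κ → κ ≡ κ'
    T-inj : ∀ {p q r} → p ≢ q → p ≢ r → ∀ {κ κ'} → S p q κ ⊕ S p r κ ≡ S p q κ' ⊕ S p r κ' → κ ≡ κ'

module Blocks {A : Set} (LA : Lin A) where
  open Lin LA public
  open GroupProperties group public
  open CM using (solve; _⊜_) renaming (_⊕_ to _⊞_)

  S-comm : ∀ p q κ → S p q κ ≡ S q p κ
  S-comm p q κ = ⊕-comm (lam p κ) (lam q κ)

  X : Fin 3 → A → A → A
  X p s κ = s ⊕ lam p κ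

  Y : Fin 3 → A → A → A
  Y q s κ = s ⊕ ⊖ lam q κ

  Y-sum : ∀ q s κ → Y q s κ ⊕ lam q κ ≡ s
  Y-sum q s κ = ⊖-⊕ s (lam q κ)

  -- The base point cancels, so for fixed positions the colour of an edge depends only on the
  -- difference of its ends.
  X-Y : ∀ p q s κ → X p s κ ≡ Y q s κ ⊕ S p q κ
  X-Y p q s κ = trans (cong (_⊕ lam p κ) (sym (Y-sum q s κ)))
    (solve 3 (λ y a b → (y ⊞ b) ⊞ a ⊜ y ⊞ (a ⊞ b)) refl (Y q s κ) (lam p κ) (lam q κ))

  edge-sum : ∀ p q s κ {a b} → X p s κ ≡ a → Y q s κ ≡ b → a ≡ b ⊕ S p q κ
  edge-sum p q s κ refl refl = X-Y p q s κ

  X-base : ∀ p κ {s s'} → X p s κ ≡ X p s' κ → s ≡ s'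
  X-base p κ = ⊕-cancelʳ (lam p κ)

  Y-base : ∀ q κ {s s'} → Y q s κ ≡ Y q s' κ → s ≡ s'
  Y-base q κ = ⊕-cancelʳ (⊖ lam q κ)

  XX-determines : ∀ {p q s s' κ κ'} → p ≢ q → X p s κ ≡ X p s' κ' → X q s κ ≡ X q s' κ' → s ≡ s' × κ ≡ κ'
  XX-determines {p} {q} {s} {s'} {κ} {κ'} p≢q e f with D-inj p≢q (⊕-cancelˡ (s ⊕ s') (begin
      (s ⊕ s') ⊕ (lam p κ ⊕ lam q κ')
        ≡⟨ solve 4 (λ s t a b → (s ⊞ t) ⊞ (a ⊞ b) ⊜ (s ⊞ a) ⊞ (t ⊞ b)) refl s s' _ _ ⟩
      X p s κ ⊕ X q s' κ'
        ≡⟨ cong₂ _⊕_ e (sym f) ⟩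
      X p s' κ' ⊕ X q s κ
        ≡⟨ solve 4 (λ s t a b → (t ⊞ a) ⊞ (s ⊞ b) ⊜ (s ⊞ t) ⊞ (a ⊞ b)) refl s s' _ _ ⟩
      (s ⊕ s') ⊕ (lam p κ' ⊕ lam q κ) ∎))
    where open ≡-Reasoning
  ... | refl = X-base p κ e , refl

  YY-determines : ∀ {p q s s' κ κ'} → p ≢ q → Y p s κ ≡ Y p s' κ' → Y q s κ ≡ Y q s' κ' → s ≡ s' × κ ≡ κ'
  YY-determines {p} {q} {s} {s'} {κ} {κ'} p≢q e f with D-inj p≢q (⊕-cancelˡ (Y p s κ ⊕ Y q s κ) (begin
      (Y p s κ ⊕ Y q s κ) ⊕ (lam p κ ⊕ lam q κ')
        ≡⟨ solve 4 (λ x y a b → (x ⊞ y) ⊞ (a ⊞ b) ⊜ (x ⊞ a) ⊞ (y ⊞ b)) refl (Y p s κ) (Y q s κ) _ _ ⟩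
      (Y p s κ ⊕ lam p κ) ⊕ (Y q s κ ⊕ lam q κ')
        ≡⟨ cong₂ _⊕_ (Y-sum p s κ) (trans (cong (_⊕ lam q κ') f) (Y-sum q s' κ')) ⟩
      s ⊕ s'
        ≡⟨ cong₂ _⊕_ (sym (Y-sum q s κ)) (trans (sym (Y-sum p s' κ')) (cong (_⊕ lam p κ') (sym e))) ⟩
      (Y q s κ ⊕ lam q κ) ⊕ (Y p s κ ⊕ lam p κ')
        ≡⟨ solve 4 (λ x y a b → (y ⊞ b) ⊞ (x ⊞ a) ⊜ (x ⊞ y) ⊞ (a ⊞ b)) refl (Y p s κ) (Y q s κ) _ _ ⟩
      (Y p s κ ⊕ Y q s κ) ⊕ (lam p κ' ⊕ lam q κ) ∎))
    where open ≡-Reasoning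
  ... | refl = Y-base p κ e , refl

  XY-determines : ∀ {p q s s' κ κ'} → p ≢ q → X p s κ ≡ X p s' κ' → Y q s κ ≡ Y q s' κ' → s ≡ s' × κ ≡ κ'
  XY-determines {p} {q} {s} {s'} {κ} {κ'} p≢q e f
    with S-inj p≢q (⊕-cancelˡ (Y q s κ) (trans (sym (X-Y p q s κ)) (trans e (edge-sum p q s' κ' refl (sym f)))))
  ... | refl = X-base p κ e , refl

  block-through : ∀ {p q} → p ≢ q → ∀ a b → Σ A λ s → Σ A λ κ → X p s κ ≡ a × Y q s κ ≡ b
  block-through {p} {q} p≢q a b = s , κ , eqX , eqY
    where
    κ = sol p q (a ⊕ ⊖ b)
    s = b ⊕ lam q κ
    eqY : Y q s κ ≡ b
    eqY = ⊕-cancelʳ (lam q κ) (Y-sum q s κ)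
    eqX : X p s κ ≡ a
    eqX = trans (edge-sum p q s κ refl eqY)
      (trans (cong (b ⊕_) (S-sol p≢q (a ⊕ ⊖ b))) (trans (⊕-comm b _) (⊖-⊕ a b)))

  -- The edges of either colour join the same four ends, so both pairs of equations have the same
  -- sum, which is the argument of `T-inj`.
  crossing : ∀ {p q r a₁ a₂ b₁ b₂ κ κ'} → p ≢ q → p ≢ r →
    a₁ ≡ b₁ ⊕ S p q κ → a₂ ≡ b₂ ⊕ S p r κ → a₁ ≡ b₂ ⊕ S p r κ' → a₂ ≡ b₁ ⊕ S p q κ' → κ ≡ κ'
  crossing {p} {q} {r} {a₁} {a₂} {b₁} {b₂} {κ} {κ'} p≢q p≢r e₁ e₂ e₃ e₄ =
    T-inj p≢q p≢r (⊕-cancelˡ (b₁ ⊕ b₂) (begin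
      (b₁ ⊕ b₂) ⊕ (S p q κ ⊕ S p r κ)
        ≡⟨ solve 4 (λ x y a b → (x ⊞ y) ⊞ (a ⊞ b) ⊜ (x ⊞ a) ⊞ (y ⊞ b)) refl b₁ b₂ _ _ ⟩
      (b₁ ⊕ S p q κ) ⊕ (b₂ ⊕ S p r κ)
        ≡⟨ cong₂ _⊕_ (trans (sym e₁) e₃) (trans (sym e₂) e₄) ⟩
      (b₂ ⊕ S p r κ') ⊕ (b₁ ⊕ S p q κ')
        ≡⟨ solve 4 (λ x y a b → (y ⊞ b) ⊞ (x ⊞ a) ⊜ (x ⊞ y) ⊞ (a ⊞ b)) refl b₁ b₂ _ _ ⟩
      (b₁ ⊕ b₂) ⊕ (S p q κ' ⊕ S p r κ') ∎))
    where open ≡-Reasoning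

  crossing-X : ∀ {p q r s₁ s₂ s₃ s₄ κ κ'} → p ≢ q → p ≢ r →
    X p s₁ κ ≡ X p s₃ κ' → Y q s₁ κ ≡ Y q s₄ κ' → X p s₂ κ ≡ X p s₄ κ' → Y r s₂ κ ≡ Y r s₃ κ' → s₁ ≡ s₂
  crossing-X {p} {q} {r} {s₁} {s₂} {s₃} {s₄} {κ} {κ'} p≢q p≢r e₁ e₂ e₃ e₄
    with crossing p≢q p≢r (X-Y p q s₁ κ) (X-Y p r s₂ κ)
           (edge-sum p r s₃ κ' (sym e₁) (sym e₄)) (edge-sum p q s₄ κ' (sym e₃) (sym e₂))
  ... | refl = trans (Y-base q κ e₂) (sym (X-base p κ e₃))

  crossing-Y : ∀ {p q r s₁ s₂ s₃ s₄ κ κ'} → p ≢ q → r ≢ q →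
    X p s₁ κ ≡ X p s₃ κ' → Y q s₁ κ ≡ Y q s₄ κ' → X r s₂ κ ≡ X r s₄ κ' → Y q s₂ κ ≡ Y q s₃ κ' → s₁ ≡ s₂
  crossing-Y {p} {q} {r} {s₁} {s₂} {s₃} {s₄} {κ} {κ'} p≢q r≢q e₁ e₂ e₃ e₄
    with T-inj {q} {p} {r} (p≢q ∘ sym) (r≢q ∘ sym) (⊕-cancelˡ (Y q s₁ κ ⊕ Y q s₂ κ) (begin
      (Y q s₁ κ ⊕ Y q s₂ κ) ⊕ (S q p κ ⊕ S q r κ)
        ≡⟨ cong₂ (λ u v → (Y q s₁ κ ⊕ Y q s₂ κ) ⊕ (u ⊕ v)) (S-comm q p κ) (S-comm q r κ) ⟩
      (Y q s₁ κ ⊕ Y q s₂ κ) ⊕ (S p q κ ⊕ S r q κ)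
        ≡⟨ solve 4 (λ x y a b → (x ⊞ y) ⊞ (a ⊞ b) ⊜ (x ⊞ a) ⊞ (y ⊞ b)) refl (Y q s₁ κ) (Y q s₂ κ) _ _ ⟩
      (Y q s₁ κ ⊕ S p q κ) ⊕ (Y q s₂ κ ⊕ S r q κ)
        ≡⟨ cong₂ _⊕_ (trans (sym (X-Y p q s₁ κ)) (edge-sum p q s₃ κ' (sym e₁) (sym e₄)))
                     (trans (sym (X-Y r q s₂ κ)) (edge-sum r q s₄ κ' (sym e₃) (sym e₂))) ⟩
      (Y q s₂ κ ⊕ S p q κ') ⊕ (Y q s₁ κ ⊕ S r q κ')
        ≡⟨ solve 4 (λ x y a b → (y ⊞ a) ⊞ (x ⊞ b) ⊜ (x ⊞ y) ⊞ (a ⊞ b)) refl (Y q s₁ κ) (Y q s₂ κ) _ _ ⟩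
      (Y q s₁ κ ⊕ Y q s₂ κ) ⊕ (S p q κ' ⊕ S r q κ')
        ≡⟨ cong₂ (λ u v → (Y q s₁ κ ⊕ Y q s₂ κ) ⊕ (u ⊕ v)) (S-comm p q κ') (S-comm r q κ') ⟩
      (Y q s₁ κ ⊕ Y q s₂ κ) ⊕ (S q p κ' ⊕ S q r κ') ∎))
    where open ≡-Reasoning
  ... | refl = trans (X-base p κ e₁) (sym (Y-base q κ e₄))

  -- Adding the two edges of colour κ gives w - z = (S q p κ + S q r κ) + v - u. For fixed u and v
  -- the difference w - z therefore determines κ; this is what makes the pairs in (4) countable.
  opposite-edges : ∀ {p q r u v w z w' z' κ κ'} → q ≢ p → q ≢ r →
    u ≡ z ⊕ S p q κ → w ≡ v ⊕ S q r κ → u ≡ z' ⊕ S p q κ' → w' ≡ v ⊕ S q r κ' →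
    w ⊕ ⊖ z ≡ w' ⊕ ⊖ z' → κ ≡ κ'
  opposite-edges {p} {q} {r} {u} {v} {w} {z} {w'} {z'} {κ} {κ'} q≢p q≢r eu ew eu' ew' eg =
    T-inj q≢p q≢r (⊕-cancelˡ (v ⊕ z ⊕ z') (begin
      (v ⊕ z ⊕ z') ⊕ (S q p κ ⊕ S q r κ)
        ≡⟨ cong (λ t → (v ⊕ z ⊕ z') ⊕ (t ⊕ S q r κ)) (S-comm q p κ) ⟩
      (v ⊕ z ⊕ z') ⊕ (S p q κ ⊕ S q r κ)
        ≡⟨ solve 5 (λ v z z' a b → ((v ⊞ z) ⊞ z') ⊞ (a ⊞ b) ⊜ (z ⊞ a) ⊞ ((v ⊞ b) ⊞ z')) refl v z z' _ _ ⟩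
      (z ⊕ S p q κ) ⊕ ((v ⊕ S q r κ) ⊕ z')
        ≡⟨ cong₂ (λ a b → a ⊕ (b ⊕ z')) (trans (sym eu) eu') (sym ew) ⟩
      (z' ⊕ S p q κ') ⊕ (w ⊕ z')
        ≡⟨ cong ((z' ⊕ S p q κ') ⊕_) wz ⟩
      (z' ⊕ S p q κ') ⊕ (w' ⊕ z)
        ≡⟨ cong (λ b → (z' ⊕ S p q κ') ⊕ (b ⊕ z)) ew' ⟩
      (z' ⊕ S p q κ') ⊕ ((v ⊕ S q r κ') ⊕ z)
        ≡⟨ solve 5 (λ v z z' a b → (z' ⊞ a) ⊞ ((v ⊞ b) ⊞ z) ⊜ ((v ⊞ z) ⊞ z') ⊞ (a ⊞ b)) refl v z z' _ _ ⟩
      (v ⊕ z ⊕ z') ⊕ (S p q κ' ⊕ S q r κ')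
        ≡⟨ cong (λ t → (v ⊕ z ⊕ z') ⊕ (t ⊕ S q r κ')) (S-comm p q κ') ⟩
      (v ⊕ z ⊕ z') ⊕ (S q p κ' ⊕ S q r κ') ∎))
    where
    open ≡-Reasoning
    wz : w ⊕ z' ≡ w' ⊕ z
    wz = begin
      w ⊕ z' ≡⟨ cong (_⊕ z') (sym (⊖-⊕ w z)) ⟩
      (w ⊕ ⊖ z ⊕ z) ⊕ z' ≡⟨ cong (λ t → (t ⊕ z) ⊕ z') eg ⟩
      (w' ⊕ ⊖ z' ⊕ z) ⊕ z' ≡⟨ solve 3 (λ g z z' → (g ⊞ z) ⊞ z' ⊜ (g ⊞ z') ⊞ z) refl (w' ⊕ ⊖ z') z z' ⟩
      (w' ⊕ ⊖ z' ⊕ z') ⊕ z ≡⟨ cong (_⊕ z) (⊖-⊕ w' z') ⟩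
      w' ⊕ z ∎

Additive : ∀ {A} → AbGroup A → (A → A) → Set
Additive GA f = ∀ a b → f (a ⊕ b) ≡ f a ⊕ f b
  where open AbGroup GA

module FromKernels {A : Set} (GA : AbGroup A) where
  open AbGroup GA
  open GroupProperties GA
  open CM using (solve; _⊜_) renaming (_⊕_ to _⊞_)

  split-difference : ∀ {f} → Additive GA f → ∀ a b → f (a ⊕ ⊖ b) ⊕ f b ≡ f a
  split-difference {f} f-⊕ a b = trans (sym (f-⊕ (a ⊕ ⊖ b) b)) (cong f (⊖-⊕ a b))

  difference-zero : ∀ {a b} → a ⊕ ⊖ b ≡ ε → a ≡ b
  difference-zero {a} {b} e = trans (sym (⊖-⊕ a b)) (trans (cong (_⊕ b) e) (⊕-identityˡ b))

  +-additive : ∀ {f g} → Additive GA f → Additive GA g → Additive GA (λ a → f a ⊕ g a)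
  +-additive f-⊕ g-⊕ a b = trans (cong₂ _⊕_ (f-⊕ a b) (g-⊕ a b))
    (solve 4 (λ a b c d → (a ⊞ b) ⊞ (c ⊞ d) ⊜ (a ⊞ c) ⊞ (b ⊞ d)) refl _ _ _ _)

  injective : ∀ {f} → Additive GA f → (∀ a → f a ≡ ε → a ≡ ε) → ∀ {a b} → f a ≡ f b → a ≡ b
  injective {f} f-⊕ ker {a} {b} e = difference-zero
    (ker _ (⊕-cancelʳ (f b) (trans (split-difference f-⊕ a b) (trans e (sym (⊕-identityˡ (f b)))))))

  equalizer-injective : ∀ {f g} → Additive GA f → Additive GA g → (∀ a → f a ≡ g a → a ≡ ε) →
    ∀ {a b} → f a ⊕ g b ≡ f b ⊕ g a → a ≡ b
  equalizer-injective {f} {g} f-⊕ g-⊕ ker {a} {b} e = difference-zero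
    (ker _ (⊕-cancelʳ (f b ⊕ g b) (begin
      f (a ⊕ ⊖ b) ⊕ (f b ⊕ g b)   ≡⟨ sym (⊕-assoc _ _ _) ⟩
      f (a ⊕ ⊖ b) ⊕ f b ⊕ g b     ≡⟨ cong (_⊕ g b) (split-difference f-⊕ a b) ⟩
      f a ⊕ g b                   ≡⟨ e ⟩
      f b ⊕ g a                   ≡⟨ cong (f b ⊕_) (sym (split-difference g-⊕ a b)) ⟩
      f b ⊕ (g (a ⊕ ⊖ b) ⊕ g b)   ≡⟨ solve 3 (λ x y z → x ⊞ (y ⊞ z) ⊜ y ⊞ (x ⊞ z)) refl _ _ _ ⟩
      g (a ⊕ ⊖ b) ⊕ (f b ⊕ g b) ∎)))
    where open ≡-Reasoning

  lin : (lam : Fin 3 → A → A) → (∀ p → Additive GA (lam p)) →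
    (sol : Fin 3 → Fin 3 → A → A) →
    (∀ p q → p ≢ q → ∀ a → lam p (sol p q a) ⊕ lam q (sol p q a) ≡ a) →
    (∀ p q → p ≢ q → ∀ a → lam p a ⊕ lam q a ≡ ε → a ≡ ε) →
    (∀ p q → p ≢ q → ∀ a → lam p a ≡ lam q a → a ≡ ε) →
    (∀ p q r → p ≢ q → p ≢ r → ∀ a → (lam p a ⊕ lam q a) ⊕ (lam p a ⊕ lam r a) ≡ ε → a ≡ ε) →
    Lin A
  lin lam lam-⊕ sol S-sol S-ker D-ker T-ker = record
    { group = GA
    ; lam = lam
    ; sol = sol
    ; S-sol = λ {p} {q} → S-sol p q
    ; S-inj = λ {p} {q} p≢q → injective (S-⊕ p q) (S-ker p q p≢q)
    ; D-inj = λ {p} {q} p≢q → equalizer-injective (lam-⊕ p) (lam-⊕ q) (D-ker p q p≢q)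
    ; T-inj = λ {p} {q} {r} p≢q p≢r → injective (+-additive (S-⊕ p q) (S-⊕ p r)) (T-ker p q r p≢q p≢r)
    }
    where
    S-⊕ : ∀ p q → Additive GA (λ a → lam p a ⊕ lam q a)
    S-⊕ p q = +-additive (lam-⊕ p) (lam-⊕ q)

infixr 7 _×ᴳ_ _×ᴸ_
_×ᴳ_ : ∀ {A B} → AbGroup A → AbGroup B → AbGroup (A × B)
GA ×ᴳ GB = record
  { _⊕_ = λ (a , b) (a' , b') → a A.⊕ a' , b B.⊕ b'
  ; ε = A.ε , B.ε
  ; ⊖_ = λ (a , b) → A.⊖ a , B.⊖ b
  ; ⊕-assoc = λ (a , b) (a' , b') (a'' , b'') → cong₂ _,_ (A.⊕-assoc a a' a'') (B.⊕-assoc b b' b'')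
  ; ⊕-comm = λ (a , b) (a' , b') → cong₂ _,_ (A.⊕-comm a a') (B.⊕-comm b b')
  ; ⊕-identityˡ = λ (a , b) → cong₂ _,_ (A.⊕-identityˡ a) (B.⊕-identityˡ b)
  ; ⊕-inverseˡ = λ (a , b) → cong₂ _,_ (A.⊕-inverseˡ a) (B.⊕-inverseˡ b)
  }
  where
  module A = AbGroup GA
  module B = AbGroup GB

_×ᴸ_ : ∀ {A B} → Lin A → Lin B → Lin (A × B)
LA ×ᴸ LB = record
  { group = A.group ×ᴳ B.group
  ; lam = λ p (a , b) → A.lam p a , B.lam p b
  ; sol = λ p q (a , b) → A.sol p q a , B.sol p q b
  ; S-sol = λ p≢q (a , b) → cong₂ _,_ (A.S-sol p≢q a) (B.S-sol p≢q b)
  ; S-inj = λ p≢q e → cong₂ _,_ (A.S-inj p≢q (cong proj₁ e)) (B.S-inj p≢q (cong proj₂ e))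
  ; D-inj = λ p≢q e → cong₂ _,_ (A.D-inj p≢q (cong proj₁ e)) (B.D-inj p≢q (cong proj₂ e))
  ; T-inj = λ p≢q p≢r e → cong₂ _,_ (A.T-inj p≢q p≢r (cong proj₁ e)) (B.T-inj p≢q p≢r (cong proj₂ e))
  }
  where
  module A = Lin LA
  module B = Lin LB

twist : ∀ {A} → Lin A → (τ τ⁻¹ : A → A) → (∀ a → τ (τ⁻¹ a) ≡ a) → (∀ {a b} → τ a ≡ τ b → a ≡ b) → Lin A
twist LA τ τ⁻¹ τ-τ⁻¹ τ-inj = record
  { group = group
  ; lam = λ p κ → lam p (τ κ)
  ; sol = λ p q a → τ⁻¹ (sol p q a)
  ; S-sol = λ {p} {q} p≢q a → trans (cong (S p q) (τ-τ⁻¹ _)) (S-sol p≢q a)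
  ; S-inj = λ p≢q e → τ-inj (S-inj p≢q e)
  ; D-inj = λ p≢q e → τ-inj (D-inj p≢q e)
  ; T-inj = λ p≢q p≢r e → τ-inj (T-inj p≢q p≢r e)
  }
  where open Lin LA

-- Systems of coloured hexagons

-- Both sides of the bipartite graph are indexed by V; Leave is the set of uncovered edges.
record System (V H C : Set) : Set₁ where
  field
    xv yv : H → Fin 3 → V
    col : H → C

  Edge : H → V → V → Set
  Edge h x y = Σ (Fin 3) λ p → Σ (Fin 3) λ q → p ≢ q × xv h p ≡ x × yv h q ≡ y

  field
    Leave : V → V → Set
    find : ∀ x y → Σ H (λ h → Edge h x y) ⊎ Leave x y
    Edge⇒¬Leave : ∀ {h x y} → Edge h x y → ¬ Leave x y
    xv-inj : ∀ h {p q} → xv h p ≡ xv h q → p ≡ q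
    yv-inj : ∀ h {p q} → yv h p ≡ yv h q → p ≡ q
    X-disjoint : ∀ {h h' p p'} → col h ≡ col h' → xv h p ≡ xv h' p' → h ≡ h'
    Y-disjoint : ∀ {h h' q q'} → col h ≡ col h' → yv h q ≡ yv h' q' → h ≡ h'
    XX-unique : ∀ {h h' p q p' q'} → p ≢ q → xv h p ≡ xv h' p' → xv h q ≡ xv h' q' → h ≡ h'
    YY-unique : ∀ {h h' p q p' q'} → p ≢ q → yv h p ≡ yv h' p' → yv h q ≡ yv h' q' → h ≡ h'
    edge-unique : ∀ {h h' x y} → Edge h x y → Edge h' x y → h ≡ h'
    -- In a 4-cycle meeting every colour evenly the edges pair up by colour. Only the pairing of
    -- opposite edges is an axiom; adjacent edges of one colour share a hexagon and are treated in
    -- `Cherries`.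
    no-alternation : ∀ {h₁ h₂ h₃ h₄ x₁ x₂ y₁ y₂} → col h₁ ≡ col h₂ → col h₃ ≡ col h₄ →
      Edge h₁ x₁ y₁ → Edge h₂ x₂ y₂ → Edge h₃ x₁ y₂ → Edge h₄ x₂ y₁ → x₁ ≡ x₂ ⊎ y₁ ≡ y₂

-- Once one end of an uncovered edge is fixed, the value of `rest` gives the other end, so the
-- uncovered degrees are at most the number of values of `rest`.
LeaveDifferences : ∀ {V H C L : Set} → System V H C → Lin V → (V → L) → Set
LeaveDifferences {V} Sys LV rest = ∀ {w z w' z' : V} → Leave w z → Leave w' z' →
  rest (w ⊕ ⊖ z) ≡ rest (w' ⊕ ⊖ z') → w ⊕ ⊖ z ≡ w' ⊕ ⊖ z'
  where
  open System Sys
  open Lin LV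

-- The edges w–z are those counted in (4) for the pair (u , v).
Encodes : ∀ {V H C K : Set} → System V H C → (H → V → V → K) → Set
Encodes {V} {H} Sys code = ∀ {u v w z w' z' : V} {h₁ h₂ h₁' h₂' : H} →
  Edge h₁ u z → Edge h₂ w v → col h₁ ≡ col h₂ → Leave w z →
  Edge h₁' u z' → Edge h₂' w' v → col h₁' ≡ col h₂' → Leave w' z' →
  code h₁ w z ≡ code h₁' w' z' → w ≡ w' × z ≡ z'
  where open System Sys

infixl 5 _⊗_
-- The hexagon through the V-coordinates supplies the positions, and for given positions the
-- A-coordinates lie in exactly one block. Whether a pair is uncovered is thus decided in `Sys`.
_⊗_ : ∀ {V H C A} → System V H C → Lin A → System (A × V) (H × A × A) (A × C)
_⊗_ {V} {H} {C} {A} Sys LA = record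
  { xv = xv
  ; yv = yv
  ; col = col
  ; Leave = λ (a , u) (b , v) → S.Leave u v
  ; find = find
  ; Edge⇒¬Leave = λ (p , q , p≢q , ex , ey) → S.Edge⇒¬Leave (p , q , p≢q , cong proj₂ ex , cong proj₂ ey)
  ; xv-inj = λ (h , _) e → S.xv-inj h (cong proj₂ e)
  ; yv-inj = λ (h , _) e → S.yv-inj h (cong proj₂ e)
  ; X-disjoint = X-disjoint
  ; Y-disjoint = Y-disjoint
  ; XX-unique = XX-unique
  ; YY-unique = YY-unique
  ; edge-unique = edge-unique
  ; no-alternation = no-alternation
  }
  where
  module S = System Sys
  open Blocks LA

  xv yv : H × A × A → Fin 3 → A × V
  xv (h , s , κ) p = X p s κ , S.xv h p
  yv (h , s , κ) q = Y q s κ , S.yv h q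

  col : H × A × A → A × C
  col (h , s , κ) = κ , S.col h

  Edge : H × A × A → A × V → A × V → Set
  Edge h x y = Σ (Fin 3) λ p → Σ (Fin 3) λ q → p ≢ q × xv h p ≡ x × yv h q ≡ y

  find : ∀ x y → Σ _ (λ h → Edge h x y) ⊎ S.Leave (proj₂ x) (proj₂ y)
  find (a , u) (b , v) with S.find u v
  ... | inj₂ l = inj₂ l
  ... | inj₁ (h , p , q , p≢q , ex , ey) with block-through p≢q a b
  ... | s , κ , ea , eb = inj₁ ((h , s , κ) , p , q , p≢q , cong₂ _,_ ea ex , cong₂ _,_ eb ey)

  X-disjoint : ∀ {h h' p p'} → col h ≡ col h' → xv h p ≡ xv h' p' → h ≡ h'
  X-disjoint {h , _} {_} {p} {p'} c e
    with S.X-disjoint (cong proj₂ c) (cong proj₂ e) | cong proj₁ c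
  ... | refl | refl with S.xv-inj h {p} {p'} (cong proj₂ e)
  ... | refl with X-base p _ (cong proj₁ e)
  ... | refl = refl

  Y-disjoint : ∀ {h h' p p'} → col h ≡ col h' → yv h p ≡ yv h' p' → h ≡ h'
  Y-disjoint {h , _} {_} {p} {p'} c e
    with S.Y-disjoint (cong proj₂ c) (cong proj₂ e) | cong proj₁ c
  ... | refl | refl with S.yv-inj h {p} {p'} (cong proj₂ e)
  ... | refl with Y-base p _ (cong proj₁ e)
  ... | refl = refl

  XX-unique : ∀ {h h' p q p' q'} → p ≢ q → xv h p ≡ xv h' p' → xv h q ≡ xv h' q' → h ≡ h'
  XX-unique {h , _} {_} {p} {q} {p'} {q'} p≢q e f with S.XX-unique p≢q (cong proj₂ e) (cong proj₂ f)
  ... | refl with S.xv-inj h {p} {p'} (cong proj₂ e) | S.xv-inj h {q} {q'} (cong proj₂ f)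
  ... | refl | refl with XX-determines p≢q (cong proj₁ e) (cong proj₁ f)
  ... | refl , refl = refl

  YY-unique : ∀ {h h' p q p' q'} → p ≢ q → yv h p ≡ yv h' p' → yv h q ≡ yv h' q' → h ≡ h'
  YY-unique {h , _} {_} {p} {q} {p'} {q'} p≢q e f with S.YY-unique p≢q (cong proj₂ e) (cong proj₂ f)
  ... | refl with S.yv-inj h {p} {p'} (cong proj₂ e) | S.yv-inj h {q} {q'} (cong proj₂ f)
  ... | refl | refl with YY-determines p≢q (cong proj₁ e) (cong proj₁ f)
  ... | refl , refl = refl

  edge-unique : ∀ {h h' x y} → Edge h x y → Edge h' x y → h ≡ h'
  edge-unique {h , _} (p , q , p≢q , refl , refl) (p' , q' , p'≢q' , ex' , ey')
    with S.edge-unique (p , q , p≢q , refl , refl) (p' , q' , p'≢q' , cong proj₂ ex' , cong proj₂ ey')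
  ... | refl with S.xv-inj h {p'} {p} (cong proj₂ ex') | S.yv-inj h {q'} {q} (cong proj₂ ey')
  ... | refl | refl with XY-determines p≢q (sym (cong proj₁ ex')) (sym (cong proj₁ ey'))
  ... | refl , refl = refl

  no-alternation : ∀ {h₁ h₂ h₃ h₄ x₁ x₂ y₁ y₂} → col h₁ ≡ col h₂ → col h₃ ≡ col h₄ →
    Edge h₁ x₁ y₁ → Edge h₂ x₂ y₂ → Edge h₃ x₁ y₂ → Edge h₄ x₂ y₁ → x₁ ≡ x₂ ⊎ y₁ ≡ y₂
  no-alternation {h₁ , s₁ , κ} {h₂ , s₂ , _} {h₃ , s₃ , κ'} {h₄ , s₄ , _} c c'
    (p₁ , q₁ , p₁≢q₁ , refl , refl) (p₂ , q₂ , p₂≢q₂ , refl , refl)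
    (p₃ , q₃ , p₃≢q₃ , ex₃ , ey₃) (p₄ , q₄ , p₄≢q₄ , ex₄ , ey₄)
    with cong proj₁ c | cong proj₁ c'
       | S.no-alternation (cong proj₂ c) (cong proj₂ c')
           (p₁ , q₁ , p₁≢q₁ , refl , refl) (p₂ , q₂ , p₂≢q₂ , refl , refl)
           (p₃ , q₃ , p₃≢q₃ , cong proj₂ ex₃ , cong proj₂ ey₃)
           (p₄ , q₄ , p₄≢q₄ , cong proj₂ ex₄ , cong proj₂ ey₄)
  -- With equal V-coordinates of the x-ends, all four edges lie over one hexagon of `Sys` and share
  -- their x-position, so the question is reduced to `crossing-X` in A.
  ... | refl | refl | inj₁ u₁≡u₂
    with S.X-disjoint (cong proj₂ c) u₁≡u₂
       | S.X-disjoint (cong proj₂ c') (trans (cong proj₂ ex₃) (trans u₁≡u₂ (sym (cong proj₂ ex₄))))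
  ... | refl | refl
    with S.edge-unique (p₁ , q₁ , p₁≢q₁ , refl , refl)
                       (p₄ , q₄ , p₄≢q₄ , trans (cong proj₂ ex₄) (sym u₁≡u₂) , cong proj₂ ey₄)
  ... | refl
    with S.xv-inj h₁ u₁≡u₂ | S.xv-inj h₁ (cong proj₂ ex₃) | S.yv-inj h₁ (cong proj₂ ey₃)
       | S.xv-inj h₁ (cong proj₂ ex₄) | S.yv-inj h₁ (cong proj₂ ey₄)
  ... | refl | refl | refl | refl | refl
    with crossing-X p₁≢q₁ p₂≢q₂ (sym (cong proj₁ ex₃)) (sym (cong proj₁ ey₄))
                    (sym (cong proj₁ ex₄)) (sym (cong proj₁ ey₃))
  ... | refl = inj₁ refl
  no-alternation {h₁ , s₁ , κ} {h₂ , s₂ , _} {h₃ , s₃ , κ'} {h₄ , s₄ , _} c c'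
    (p₁ , q₁ , p₁≢q₁ , refl , refl) (p₂ , q₂ , p₂≢q₂ , refl , refl)
    (p₃ , q₃ , p₃≢q₃ , ex₃ , ey₃) (p₄ , q₄ , p₄≢q₄ , ex₄ , ey₄)
    | refl | refl | inj₂ v₁≡v₂
    with S.Y-disjoint (cong proj₂ c) v₁≡v₂
       | S.Y-disjoint (cong proj₂ c') (trans (cong proj₂ ey₃) (trans (sym v₁≡v₂) (sym (cong proj₂ ey₄))))
  ... | refl | refl
    with S.edge-unique (p₁ , q₁ , p₁≢q₁ , refl , refl)
                       (p₃ , q₃ , p₃≢q₃ , cong proj₂ ex₃ , trans (cong proj₂ ey₃) (sym v₁≡v₂))
  ... | refl
    with S.yv-inj h₁ v₁≡v₂ | S.xv-inj h₁ (cong proj₂ ex₃) | S.yv-inj h₁ (cong proj₂ ey₃)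
       | S.xv-inj h₁ (cong proj₂ ex₄) | S.yv-inj h₁ (cong proj₂ ey₄)
  ... | refl | refl | refl | refl | refl
    with crossing-Y p₁≢q₁ p₂≢q₂ (sym (cong proj₁ ex₃)) (sym (cong proj₁ ey₄))
                    (sym (cong proj₁ ex₄)) (sym (cong proj₁ ey₃))
  ... | refl = inj₂ refl

-- 4-cycles with adjacent edges of equal colour

-- Two disjoint pairs would need four positions, so a hexagon contains no 4-cycle. The same count
-- restricts the digits of a 4-cycle of top edges in `Extend`.
same-side : ∀ (p₁ p₂ q₁ q₂ : Fin 3) → p₁ ≢ q₁ → p₁ ≢ q₂ → p₂ ≢ q₁ → p₂ ≢ q₂ → p₁ ≡ p₂ ⊎ q₁ ≡ q₂
same-side = from-yes (all? {n = 3} λ p₁ → all? {n = 3} λ p₂ → all? {n = 3} λ q₁ → all? {n = 3} λ q₂ →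
  ¬? (p₁ ≟ q₁) →-dec (¬? (p₁ ≟ q₂) →-dec (¬? (p₂ ≟ q₁) →-dec (¬? (p₂ ≟ q₂) →-dec
    (p₁ ≟ p₂ ⊎-dec q₁ ≟ q₂)))))

module Cherries {V H C : Set} (Sys : System V H C) where
  open System Sys

  -- Two hexagons sharing two y-vertices are one by `YY-unique`, and a hexagon contains no 4-cycle.
  Y-cherry : ∀ {h h' x₁ x₂ y₁ y₂} → Edge h x₁ y₁ → Edge h x₁ y₂ → Edge h' x₂ y₁ → Edge h' x₂ y₂ → x₁ ≡ x₂ ⊎ y₁ ≡ y₂
  Y-cherry {h} {h'} (p₁ , q₁ , p₁≢q₁ , refl , refl) (p₂ , q₂ , p₂≢q₂ , ex₂ , refl)
    (p₃ , q₃ , p₃≢q₃ , refl , ey₃) (p₄ , q₄ , p₄≢q₄ , ex₄ , ey₄) with q₁ ≟ q₂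
  ... | yes refl = inj₂ refl
  ... | no q₁≢q₂ with YY-unique {h} {h'} {q₁} {q₂} {q₃} {q₄} q₁≢q₂ (sym ey₃) (sym ey₄)
  ... | refl with xv-inj h {p₂} {p₁} ex₂ | yv-inj h {q₃} {q₁} ey₃ | xv-inj h {p₄} {p₃} ex₄ | yv-inj h {q₄} {q₂} ey₄
  ... | refl | refl | refl | refl with same-side p₁ p₃ q₁ q₂ p₁≢q₁ p₂≢q₂ p₃≢q₃ p₄≢q₄
  ... | inj₁ refl = inj₁ refl
  ... | inj₂ q₁≡q₂ = contradiction q₁≡q₂ q₁≢q₂

  X-cherry : ∀ {h h' x₁ x₂ y₁ y₂} → Edge h x₁ y₁ → Edge h x₂ y₁ → Edge h' x₁ y₂ → Edge h' x₂ y₂ → x₁ ≡ x₂ ⊎ y₁ ≡ y₂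
  X-cherry {h} {h'} (p₁ , q₁ , p₁≢q₁ , refl , refl) (p₂ , q₂ , p₂≢q₂ , refl , ey₂)
    (p₃ , q₃ , p₃≢q₃ , ex₃ , refl) (p₄ , q₄ , p₄≢q₄ , ex₄ , ey₄) with p₁ ≟ p₂
  ... | yes refl = inj₁ refl
  ... | no p₁≢p₂ with XX-unique {h} {h'} {p₁} {p₂} {p₃} {p₄} p₁≢p₂ (sym ex₃) (sym ex₄)
  ... | refl with yv-inj h {q₂} {q₁} ey₂ | xv-inj h {p₃} {p₁} ex₃ | yv-inj h {q₄} {q₃} ey₄ | xv-inj h {p₄} {p₂} ex₄
  ... | refl | refl | refl | refl with same-side p₁ p₂ q₁ q₃ p₁≢q₁ p₃≢q₃ p₂≢q₂ p₄≢q₄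
  ... | inj₁ p₁≡p₂ = contradiction p₁≡p₂ p₁≢p₂
  ... | inj₂ refl = inj₂ refl

-- Conditions on the structures used for truncation and for the recursion

-- The seven data of a hexagon that can fall outside the initial segments: its three x-vertices, its
-- three y-vertices and its colour.
Probe : Set
Probe = Fin 3 ⊎ Fin 3 ⊎ ⊤

module _ {A : Set} (LA : Lin A) where
  open Blocks LA

  probe : Probe → A → A → A
  probe (inj₁ j) s κ = X j s κ
  probe (inj₂ (inj₁ j)) s κ = Y j s κ
  probe (inj₂ (inj₂ _)) s κ = κ

  -- In traced the edges xy' and x'y lie in the blocks (s₁ , k) and (s₂ , k), with x and y fixed, and x'y' in (s₃ , κ).
  record Spread : Set where
    field
      diagonal : ∀ p {κ κ'} → S p p κ ≡ S p p κ' → κ ≡ κ'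
      traced : ∀ π {p₁ q₁ p₂ q₂ p₃ q₃} → p₁ ≢ q₁ → p₂ ≢ q₂ → p₃ ≢ q₃ → ∀ {k k' s₁ s₁' s₂ s₂' s₃ s₃' κ κ'} →
        X p₁ s₁ k ≡ X p₁ s₁' k' → Y q₂ s₂ k ≡ Y q₂ s₂' k' →
        X p₃ s₃ κ ≡ X p₂ s₂ k → X p₃ s₃' κ' ≡ X p₂ s₂' k' →
        Y q₃ s₃ κ ≡ Y q₁ s₁ k → Y q₃ s₃' κ' ≡ Y q₁ s₁' k' →
        probe π s₃ κ ≡ probe π s₃' κ' → k ≡ k'

Separating : {B : Set} → Lin B → (Fin 3 → B → B) → B → Set
Separating LB τ ω = ∀ {d d' p q p' q'} → d ≢ d' → p ≢ q → p' ≢ q' → ∀ κ →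
  S p q (τ d κ) ⊕ lam d' ω ≢ S p' q' (τ d' κ) ⊕ lam d ω
  where open Lin LB

-- Explicit linear structures

module Scalars where
  import Data.Nat.Divisibility as ℕ
  open import Data.Integer as ℤ using (ℤ; +_; 0ℤ; 1ℤ; _+_; _*_; _-_; -_; _^_)
  import Data.Integer.Properties as ℤ
  open import Data.Integer.DivMod using (_%ℕ_; _/ℕ_; n%ℕd<d; a≡a%ℕn+[a/ℕn]*n)
  open import Data.Integer.Divisibility.Signed
  open import Data.Integer.Tactic.RingSolver using (solve-∀)

  module Residues (k : ℕ) where
    m : ℕ
    m = suc k

    infix 4 _≈_
    record _≈_ (a b : ℤ) : Set where
      constructor congruent
      field divides-difference : + m ∣ a - b
    open _≈_

    by : ∀ {a b z} → + m ∣ z → a - b ≡ z → a ≈ b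
    by d e = congruent (subst (+ m ∣_) (sym e) d)

    ≈-refl : ∀ {a} → a ≈ a
    ≈-refl {a} = congruent (divides 0ℤ (ℤ.+-inverseʳ a))

    ≈-reflexive : ∀ {a b} → a ≡ b → a ≈ b
    ≈-reflexive refl = ≈-refl

    ≈-sym : ∀ {a b} → a ≈ b → b ≈ a
    ≈-sym {a} {b} (congruent d) = by (∣m⇒∣-m d) (lemma a b)
      where
      lemma : ∀ a b → b - a ≡ - (a - b)
      lemma = solve-∀

    ≈-trans : ∀ {a b c} → a ≈ b → b ≈ c → a ≈ c
    ≈-trans {a} {b} {c} (congruent d) (congruent e) = by (∣m∣n⇒∣m+n d e) (lemma a b c)
      where
      lemma : ∀ a b c → a - c ≡ (a - b) + (b - c)
      lemma = solve-∀

    +-cong : ∀ {a b c d} → a ≈ b → c ≈ d → a + c ≈ b + d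
    +-cong {a} {b} {c} {d} (congruent u) (congruent v) = by (∣m∣n⇒∣m+n u v) (lemma a b c d)
      where
      lemma : ∀ a b c d → (a + c) - (b + d) ≡ (a - b) + (c - d)
      lemma = solve-∀

    -‿cong : ∀ {a b} → a ≈ b → - a ≈ - b
    -‿cong {a} {b} (congruent u) = by (∣m⇒∣-m u) (lemma a b)
      where
      lemma : ∀ a b → - a - - b ≡ - (a - b)
      lemma = solve-∀

    *-congˡ : ∀ c {a b} → a ≈ b → c * a ≈ c * b
    *-congˡ c {a} {b} (congruent u) = by (∣n⇒∣m*n c u) (lemma a b c)
      where
      lemma : ∀ a b c → c * a - c * b ≡ c * (a - b)
      lemma = solve-∀

    *-congʳ : ∀ c {a b} → a ≈ b → a * c ≈ b * c
    *-congʳ c {a} {b} (congruent u) = by (∣m⇒∣m*n c u) (lemma a b c)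
      where
      lemma : ∀ a b c → a * c - b * c ≡ (a - b) * c
      lemma = solve-∀

    -- Elimination modulo m: the difference of the two sides is exhibited as an integer combination
    -- of differences already known to vanish, which is an identity for the ring solver.
    combine₂ : ∀ {a b a₁ b₁ a₂ b₂} c₁ c₂ → a₁ ≈ b₁ → a₂ ≈ b₂ →
      a - b ≡ c₁ * (a₁ - b₁) + c₂ * (a₂ - b₂) → a ≈ b
    combine₂ c₁ c₂ (congruent d₁) (congruent d₂) = by (∣m∣n⇒∣m+n (∣n⇒∣m*n c₁ d₁) (∣n⇒∣m*n c₂ d₂))

    val : Fin m → ℤ
    val x = + toℕ x

    reduce : ℤ → Fin m
    reduce z = fromℕ< (n%ℕd<d z m)

    val-reduce : ∀ z → val (reduce z) ≈ z
    val-reduce z = congruent (divides (- (z /ℕ m)) (begin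
      val (reduce z) - z                   ≡⟨ cong (λ t → + t - z) (toℕ-fromℕ< (n%ℕd<d z m)) ⟩
      + (z %ℕ m) - z                       ≡⟨ cong (λ t → + (z %ℕ m) - t) (a≡a%ℕn+[a/ℕn]*n z m) ⟩
      + (z %ℕ m) - (+ (z %ℕ m) + (z /ℕ m) * + m) ≡⟨ lemma (+ (z %ℕ m)) (z /ℕ m) (+ m) ⟩
      - (z /ℕ m) * + m ∎))
      where
      open ≡-Reasoning
      lemma : ∀ r q n → r - (r + q * n) ≡ - q * n
      lemma = solve-∀

    private
      val-inj-≤ : ∀ {x y : Fin m} → toℕ y ℕ.≤ toℕ x → val x ≈ val y → x ≡ y
      val-inj-≤ {x} {y} y≤x (congruent d) = toℕ-injective (ℕ.≤-antisym (ℕ.m∸n≡0⇒m≤n zero-difference) y≤x)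
        where
        d' : m ℕ.∣ toℕ x ℕ.∸ toℕ y
        d' = subst (m ℕ.∣_) (cong ℤ.∣_∣ (trans (ℤ.[+m]-[+n]≡m⊖n (toℕ x) (toℕ y)) (ℤ.⊖-≥ y≤x))) (∣⇒∣ᵤ d)
        zero-difference : toℕ x ℕ.∸ toℕ y ≡ 0
        zero-difference with toℕ x ℕ.∸ toℕ y in eq
        ... | zero = refl
        ... | suc t = contradiction (ℕ.∣⇒≤ (subst (m ℕ.∣_) eq d'))
          (ℕ.<⇒≱ (ℕ.≤-<-trans (ℕ.≤-trans (ℕ.≤-reflexive (sym eq)) (ℕ.m∸n≤m (toℕ x) (toℕ y))) (toℕ<n x)))

    val-inj : ∀ {x y : Fin m} → val x ≈ val y → x ≡ y
    val-inj {x} {y} e with ℕ.≤-total (toℕ y) (toℕ x)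
    ... | inj₁ y≤x = val-inj-≤ y≤x e
    ... | inj₂ x≤y = sym (val-inj-≤ x≤y (≈-sym e))

    private
      infixl 6 _⊕_
      infix 8 ⊖_
      _⊕_ : Fin m → Fin m → Fin m
      x ⊕ y = reduce (val x + val y)

      ⊖_ : Fin m → Fin m
      ⊖ x = reduce (- val x)

    val-⊕ : ∀ x y → val (x ⊕ y) ≈ val x + val y
    val-⊕ x y = val-reduce _

    val-⊖ : ∀ x → val (⊖ x) ≈ - val x
    val-⊖ x = val-reduce _

    group : AbGroup (Fin m)
    group = record
      { _⊕_ = _⊕_
      ; ε = reduce 0ℤ
      ; ⊖_ = ⊖_
      ; ⊕-assoc = λ x y z → val-inj
          (≈-trans (≈-trans (val-⊕ (x ⊕ y) z) (+-cong (val-⊕ x y) (≈-refl {val z})))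
            (≈-trans (≈-reflexive (ℤ.+-assoc (val x) (val y) (val z)))
              (≈-sym (≈-trans (val-⊕ x (y ⊕ z)) (+-cong (≈-refl {val x}) (val-⊕ y z))))))
      ; ⊕-comm = λ x y → cong reduce (ℤ.+-comm (val x) (val y))
      ; ⊕-identityˡ = λ x → val-inj (≈-trans (val-⊕ (reduce 0ℤ) x)
          (≈-trans (+-cong (val-reduce 0ℤ) (≈-refl {val x})) (≈-reflexive (ℤ.+-identityˡ (val x)))))
      ; ⊕-inverseˡ = λ x → val-inj (≈-trans (val-⊕ (⊖ x) x)
          (≈-trans (+-cong (val-⊖ x) (≈-refl {val x})) (≈-trans (≈-reflexive (ℤ.+-inverseˡ (val x))) (≈-sym (val-reduce 0ℤ)))))
      }

    scale : ℤ → Fin m → Fin m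
    scale c x = reduce (c * val x)

    val-scale : ∀ c x → val (scale c x) ≈ c * val x
    val-scale c x = val-reduce _

    scale-⊕ : ∀ c → Additive group (scale c)
    scale-⊕ c x y = val-inj (≈-trans (val-scale c (x ⊕ y)) (≈-trans (*-congˡ c (val-⊕ x y))
      (≈-trans (≈-reflexive (ℤ.*-distribˡ-+ c (val x) (val y)))
        (≈-sym (≈-trans (val-⊕ (scale c x) (scale c y)) (+-cong (val-scale c x) (val-scale c y)))))))

    Unit : ℤ → Set
    Unit u = Σ ℤ λ v → u * v ≈ 1ℤ

    unit-cancel : ∀ {u a b} → Unit u → u * a ≈ u * b → a ≈ b
    unit-cancel {u} {a} {b} (v , uv≈1) e = combine₂ (- (a - b)) v uv≈1 e (lemma u v a b)
      where
      lemma : ∀ u v a b → a - b ≡ - (a - b) * (u * v - 1ℤ) + v * (u * a - u * b)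
      lemma = solve-∀

    unit-kernel : ∀ u → Unit u → ∀ {x} → u * val x ≈ 0ℤ → x ≡ reduce 0ℤ
    unit-kernel u U {x} e = val-inj (≈-trans (unit-cancel {u} U (≈-trans e (≈-reflexive (sym (ℤ.*-zeroʳ u))))) (≈-sym (val-reduce 0ℤ)))

    module _ (c : Fin 3 → ℤ) where
      val-S : ∀ p q x → val (scale (c p) x ⊕ scale (c q) x) ≈ (c p + c q) * val x
      val-S p q x = ≈-trans (val-⊕ (scale (c p) x) (scale (c q) x)) (≈-trans (+-cong (val-scale (c p) x) (val-scale (c q) x))
        (≈-reflexive (sym (ℤ.*-distribʳ-+ (val x) (c p) (c q)))))

      scalars : (∀ p q → p ≢ q → Unit (c p + c q)) → (∀ p q → p ≢ q → Unit (c p - c q)) →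
        (∀ p q r → p ≢ q → p ≢ r → Unit ((c p + c q) + (c p + c r))) → Lin (Fin m)
      scalars S-unit D-unit T-unit = FromKernels.lin group (λ p → scale (c p)) (λ p → scale-⊕ (c p)) sol S-sol
        (λ p q p≢q x e → unit-kernel (c p + c q) (S-unit p q p≢q) (≈-trans (≈-sym (val-S p q x)) (zero-value e)))
        D-ker
        (λ p q r p≢q p≢r x e → unit-kernel ((c p + c q) + (c p + c r)) (T-unit p q r p≢q p≢r)
          (≈-trans (≈-sym (≈-trans (val-⊕ (scale (c p) x ⊕ scale (c q) x) (scale (c p) x ⊕ scale (c r) x)) (≈-trans (+-cong (val-S p q x) (val-S p r x))
            (≈-reflexive (sym (ℤ.*-distribʳ-+ (val x) (c p + c q) (c p + c r))))))) (zero-value e)))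
        where
        zero-value : ∀ {x} → x ≡ reduce 0ℤ → val x ≈ 0ℤ
        zero-value refl = val-reduce 0ℤ

        inverse : Fin 3 → Fin 3 → ℤ
        inverse p q with p ≟ q
        ... | yes _ = 0ℤ
        ... | no p≢q = proj₁ (S-unit p q p≢q)

        inverse-S : ∀ p q → p ≢ q → (c p + c q) * inverse p q ≈ 1ℤ
        inverse-S p q p≢q with p ≟ q
        ... | yes p≡q = contradiction p≡q p≢q
        ... | no p≢q' = proj₂ (S-unit p q p≢q')

        sol : Fin 3 → Fin 3 → Fin m → Fin m
        sol p q = scale (inverse p q)

        S-sol : ∀ p q → p ≢ q → ∀ x → scale (c p) (sol p q x) ⊕ scale (c q) (sol p q x) ≡ x
        S-sol p q p≢q x = val-inj (≈-trans (val-S p q (sol p q x))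
          (≈-trans (*-congˡ (c p + c q) (val-scale (inverse p q) x))
          (≈-trans (≈-reflexive (sym (ℤ.*-assoc (c p + c q) (inverse p q) (val x))))
          (≈-trans (*-congʳ (val x) (inverse-S p q p≢q)) (≈-reflexive (ℤ.*-identityˡ (val x)))))))

        D-ker : ∀ p q → p ≢ q → ∀ x → scale (c p) x ≡ scale (c q) x → x ≡ reduce 0ℤ
        D-ker p q p≢q x e = unit-kernel (c p - c q) (D-unit p q p≢q)
          (≈-trans (≈-reflexive (lemma (c p) (c q) (val x)))
            (≈-trans (+-cong (≈-trans (≈-sym (val-scale (c p) x)) (≈-trans (≈-reflexive (cong val e)) (val-scale (c q) x)))
              (≈-refl { - (c q * val x)})) (≈-reflexive (ℤ.+-inverseʳ (c q * val x)))))
          where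
          lemma : ∀ a b x → (a - b) * x ≡ a * x + - (b * x)
          lemma = solve-∀

  -- The structures on F₉, F₂₇ and F₇, and the recolourings

  module Z₃ = Residues 2
  module Z₇ = Residues 6

  F₉ F₂₇ : Set
  F₉ = Fin 3 × Fin 3
  F₂₇ = Fin 3 × F₉

  all₉? : {P : F₉ → Set} → Decidable P → Dec (∀ a → P a)
  all₉? P? = map′ (λ f (a , b) → f a b) (λ f a b → f (a , b)) (all? {n = 3} λ a → all? {n = 3} λ b → P? (a , b))

  all₂₇? : {P : F₂₇ → Set} → Decidable P → Dec (∀ a → P a)
  all₂₇? P? = map′ (λ f (a , b) → f a b) (λ f a b → f (a , b)) (all? {n = 3} λ a → all₉? λ b → P? (a , b))

  _≟₉_ : (a b : F₉) → Dec (a ≡ b)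
  _≟₉_ = ≡-dec _≟_ _≟_

  _≟₂₇_ : (a b : F₂₇) → Dec (a ≡ b)
  _≟₂₇_ = ≡-dec _≟_ _≟₉_

  group₉ : AbGroup F₉
  group₉ = Z₃.group ×ᴳ Z₃.group

  group₂₇ : AbGroup F₂₇
  group₂₇ = Z₃.group ×ᴳ group₉

  abstract
    -- F₉ = F₃[i] with i² = −1, and lam = 0, 1, i.
    lin₉ : Lin F₉
    lin₉ = FromKernels.lin group₉ lam
      (from-yes (all? {n = 3} λ p → all₉? λ a → all₉? λ b → lam p (a ⊕ b) ≟₉ (lam p a ⊕ lam p b)))
      sol
      (from-yes (all? {n = 3} λ p → all? {n = 3} λ q → ¬? (p ≟ q) →-dec
        all₉? λ a → (lam p (sol p q a) ⊕ lam q (sol p q a)) ≟₉ a))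
      (from-yes (all? {n = 3} λ p → all? {n = 3} λ q → ¬? (p ≟ q) →-dec
        all₉? λ a → (lam p a ⊕ lam q a) ≟₉ ε →-dec a ≟₉ ε))
      (from-yes (all? {n = 3} λ p → all? {n = 3} λ q → ¬? (p ≟ q) →-dec
        all₉? λ a → lam p a ≟₉ lam q a →-dec a ≟₉ ε))
      (from-yes (all? {n = 3} λ p → all? {n = 3} λ q → all? {n = 3} λ r → ¬? (p ≟ q) →-dec (¬? (p ≟ r) →-dec
        all₉? λ a → ((lam p a ⊕ lam q a) ⊕ (lam p a ⊕ lam r a)) ≟₉ ε →-dec a ≟₉ ε)))
      where
      open AbGroup group₉
      i* : F₉ → F₉
      i* (a , b) = AbGroup.⊖_ Z₃.group b , a
      lam : Fin 3 → F₉ → F₉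
      lam 0F _ = ε
      lam 1F a = a
      lam 2F a = i* a
      sol : Fin 3 → Fin 3 → F₉ → F₉
      sol 0F 1F a = a
      sol 1F 0F a = a
      -- Here i⁻¹ = -i, and (1 + i)⁻¹ = i - 1 because (1 + i)(i - 1) = -2 = 1.
      sol 0F 2F a = ⊖ i* a
      sol 2F 0F a = ⊖ i* a
      sol _ _ a = i* a ⊕ ⊖ a

    -- F₂₇ = F₃[θ] with θ³ = θ + 1, and lam = 0, 1, θ.
    lin₂₇ : Lin F₂₇
    lin₂₇ = FromKernels.lin group₂₇ lam
      (from-yes (all? {n = 3} λ p → all₂₇? λ a → all₂₇? λ b → lam p (a ⊕ b) ≟₂₇ (lam p a ⊕ lam p b)))
      sol
      (from-yes (all? {n = 3} λ p → all? {n = 3} λ q → ¬? (p ≟ q) →-dec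
        all₂₇? λ a → (lam p (sol p q a) ⊕ lam q (sol p q a)) ≟₂₇ a))
      (from-yes (all? {n = 3} λ p → all? {n = 3} λ q → ¬? (p ≟ q) →-dec
        all₂₇? λ a → (lam p a ⊕ lam q a) ≟₂₇ ε →-dec a ≟₂₇ ε))
      (from-yes (all? {n = 3} λ p → all? {n = 3} λ q → ¬? (p ≟ q) →-dec
        all₂₇? λ a → lam p a ≟₂₇ lam q a →-dec a ≟₂₇ ε))
      (from-yes (all? {n = 3} λ p → all? {n = 3} λ q → all? {n = 3} λ r → ¬? (p ≟ q) →-dec (¬? (p ≟ r) →-dec
        all₂₇? λ a → ((lam p a ⊕ lam q a) ⊕ (lam p a ⊕ lam r a)) ≟₂₇ ε →-dec a ≟₂₇ ε)))
      where
      open AbGroup group₂₇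
      θ* : F₂₇ → F₂₇
      θ* (a , b , c) = c , AbGroup._⊕_ Z₃.group a c , b
      lam : Fin 3 → F₂₇ → F₂₇
      lam 0F _ = ε
      lam 1F a = a
      lam 2F a = θ* a
      sol : Fin 3 → Fin 3 → F₂₇ → F₂₇
      sol 0F 1F a = a
      sol 1F 0F a = a
      -- From θ³ - θ = 1 one reads off θ⁻¹ = θ² - 1 and (1 + θ)⁻¹ = θ² - θ.
      sol 0F 2F a = θ* (θ* a) ⊕ ⊖ a
      sol 2F 0F a = θ* (θ* a) ⊕ ⊖ a
      sol _ _ a = θ* (θ* a) ⊕ ⊖ θ* a

    -- The digit is one coordinate of the additive group of F₂₇, so equal digits cancel. Differences
    -- of uncovered pairs thus lose a factor 3 at every step.
    F₂₇-digit : ∀ d g g' → let open AbGroup (Lin.group lin₂₇) in proj₁ ((d , g) ⊕ ⊖ (d , g')) ≡ 0F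
    F₂₇-digit = from-yes (all? {n = 3} λ d → all₉? λ g → all₉? λ g' → proj₁ ((d , g) ⊕ ⊖ (d , g')) ≟ 0F)
      where open AbGroup group₂₇

    Z₇-unit? : ∀ u → Dec (u * u ^ 5 Z₇.≈ 1ℤ)
    Z₇-unit? u = map′ Z₇.congruent Z₇._≈_.divides-difference (_ ∣? _)

    c₇ : Fin 3 → ℤ
    c₇ 0F = + 1
    c₇ 1F = + 2
    c₇ 2F = + 4

    lin₇ : Lin (Fin 7)
    lin₇ = Z₇.scalars c₇
      (λ p q p≢q → _ , from-yes (all? {n = 3} λ p → all? {n = 3} λ q → ¬? (p ≟ q) →-dec Z₇-unit? (c₇ p + c₇ q)) p q p≢q)
      (λ p q p≢q → _ , from-yes (all? {n = 3} λ p → all? {n = 3} λ q → ¬? (p ≟ q) →-dec Z₇-unit? (c₇ p - c₇ q)) p q p≢q)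
      (λ p q r p≢q p≢r → _ , from-yes (all? {n = 3} λ p → all? {n = 3} λ q → all? {n = 3} λ r → ¬? (p ≟ q) →-dec (¬? (p ≟ r) →-dec
        Z₇-unit? ((c₇ p + c₇ q) + (c₇ p + c₇ r)))) p q r p≢q p≢r)

    -- Used with c = 2 and c = 4, which are inverse to each other modulo 7 and of order 3. The index
    -- j names one of the three factors of `F₇³`, d is the digit.
    mul : ℤ → Fin 3 → Fin 3 → Fin 7 → Fin 7
    mul c j d = Z₇.scale (c ^ (toℕ j ℕ.* toℕ d))

    mul-inverse : ∀ j d a → mul (+ 2) j d (mul (+ 4) j d a) ≡ a × mul (+ 4) j d (mul (+ 2) j d a) ≡ a
    mul-inverse j d a =
        from-yes (all? {n = 3} λ j → all? {n = 3} λ d → all? {n = 7} λ a → mul (+ 2) j d (mul (+ 4) j d a) ≟ a) j d a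
      , from-yes (all? {n = 3} λ j → all? {n = 3} λ d → all? {n = 7} λ a → mul (+ 4) j d (mul (+ 2) j d a) ≟ a) j d a

    -- For lam = 1, 2, 4 every S p q is 3 times a power of 2, and j ↦ 2 ^ (j (d − d')) runs through all
    -- powers of 2 modulo 7, so in some coordinate the two multiples of κ agree.
    separating₇ : ∀ d d' p q p' q' → d ≢ d' → p ≢ q → p' ≢ q' → ∃ λ j → ∀ κ → let open Lin lin₇ in
      S p q (mul (+ 2) j d κ) ⊕ lam d' 1F ≢ S p' q' (mul (+ 2) j d' κ) ⊕ lam d 1F
    separating₇ = from-yes (all? {n = 3} λ d → all? {n = 3} λ d' → all? {n = 3} λ p → all? {n = 3} λ q →
      all? {n = 3} λ p' → all? {n = 3} λ q' → ¬? (d ≟ d') →-dec (¬? (p ≟ q) →-dec (¬? (p' ≟ q') →-dec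
        (any? {n = 3} λ j → all? {n = 7} λ κ → ¬? (S p q (mul (+ 2) j d κ) ⊕ lam d' 1F ≟ S p' q' (mul (+ 2) j d' κ) ⊕ lam d 1F)))))
      where open Lin lin₇

  F₇³ B : Set
  F₇³ = Fin 7 × Fin 7 × Fin 7
  B = F₉ × F₇³

  lin₇³ : Lin F₇³
  lin₇³ = lin₇ ×ᴸ lin₇ ×ᴸ lin₇

  linB : Lin B
  linB = lin₉ ×ᴸ lin₇³

  coordinate : Fin 3 → F₇³ → Fin 7
  coordinate 0F (a , _ , _) = a
  coordinate 1F (_ , b , _) = b
  coordinate 2F (_ , _ , c) = c

  τ τ⁻¹ : Fin 3 → B → B
  τ d (g , a , b , c) = g , mul (+ 2) 0F d a , mul (+ 2) 1F d b , mul (+ 2) 2F d c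
  τ⁻¹ d (g , a , b , c) = g , mul (+ 4) 0F d a , mul (+ 4) 1F d b , mul (+ 4) 2F d c

  ω : B
  ω = (0F , 0F) , (1F , 1F , 1F)

  τ-τ⁻¹ : ∀ d b → τ d (τ⁻¹ d b) ≡ b
  τ-τ⁻¹ d (g , a , b , c) = cong (g ,_) (cong₂ _,_ (proj₁ (mul-inverse 0F d a))
    (cong₂ _,_ (proj₁ (mul-inverse 1F d b)) (proj₁ (mul-inverse 2F d c))))

  τ⁻¹-τ : ∀ d b → τ⁻¹ d (τ d b) ≡ b
  τ⁻¹-τ d (g , a , b , c) = cong (g ,_) (cong₂ _,_ (proj₂ (mul-inverse 0F d a))
    (cong₂ _,_ (proj₂ (mul-inverse 1F d b)) (proj₂ (mul-inverse 2F d c))))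

  τ-inj : ∀ d {b b'} → τ d b ≡ τ d b' → b ≡ b'
  τ-inj d {b} {b'} e = trans (sym (τ⁻¹-τ d b)) (trans (cong (τ⁻¹ d) e) (τ⁻¹-τ d b'))

  separating : Separating linB τ ω
  separating d≢d' p≢q p'≢q' (_ , κ) e with separating₇ _ _ _ _ _ _ d≢d' p≢q p'≢q'
  ... | 0F , f = f (coordinate 0F κ) (cong (coordinate 0F ∘ proj₂) e)
  ... | 1F , f = f (coordinate 1F κ) (cong (coordinate 1F ∘ proj₂) e)
  ... | 2F , f = f (coordinate 2F κ) (cong (coordinate 2F ∘ proj₂) e)

  -- The structure on ℤ/m used for truncation

  module SpreadScalars (k : ℕ) (c : Fin 3 → ℤ) where
    open Residues k

    -- Write Sᵢ for c pᵢ + c qᵢ and T for S₁ + S₂. With x and y fixed, the edges of colour k give x'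
    -- = y + S₂ k and y' = x - S₁ k, so the hexagon of x'y' has S₃ κ = T k + const. A vertex of it
    -- is x' - (c p₃ - t) κ with t = c j or t = - c j, and S₃ times this is (S₃ S₂ - (c p₃ - t) T) k
    -- + const. The coefficients of k are the units required; `PairUnits` is the case where κ itself
    -- is observed.
    SumUnits PairUnits DifferenceUnits ShiftUnits ReflectUnits : Set
    SumUnits = ∀ p q → Unit (c p + c q)
    PairUnits = ∀ p₁ q₁ p₂ q₂ → p₁ ≢ q₁ → p₂ ≢ q₂ → Unit ((c p₁ + c q₁) + (c p₂ + c q₂))
    DifferenceUnits = ∀ p q → p ≢ q → Unit (c p - c q)
    ShiftUnits = ∀ p₁ q₁ p₂ q₂ p₃ q₃ j → p₁ ≢ q₁ → p₂ ≢ q₂ → p₃ ≢ q₃ →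
      Unit ((c p₃ + c q₃) * (c p₂ + c q₂) - (c p₃ - c j) * ((c p₁ + c q₁) + (c p₂ + c q₂)))
    ReflectUnits = ∀ p₁ q₁ p₂ q₂ p₃ q₃ j → p₁ ≢ q₁ → p₂ ≢ q₂ → p₃ ≢ q₃ →
      Unit ((c p₃ + c q₃) * (c p₂ + c q₂) - (c p₃ - - c j) * ((c p₁ + c q₁) + (c p₂ + c q₂)))

    module _ (sums : SumUnits) (pairs : PairUnits) (differences : DifferenceUnits)
      (shifts : ShiftUnits) (reflections : ReflectUnits) where

      lin : Lin (Fin m)
      lin = scalars c (λ p q _ → sums p q) differences (λ p q r p≢q p≢r → pairs p q p r p≢q p≢r)

      open Blocks lin

      val-X : ∀ p s κ → val (X p s κ) ≈ val s + c p * val κ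
      val-X p s κ = ≈-trans (val-⊕ s (scale (c p) κ)) (+-cong (≈-refl {val s}) (val-scale (c p) κ))

      val-Y : ∀ q s κ → val (Y q s κ) ≈ val s - c q * val κ
      val-Y q s κ = ≈-trans (val-⊕ s (⊖ scale (c q) κ))
        (+-cong (≈-refl {val s}) (≈-trans (val-⊖ (scale (c q) κ)) (-‿cong (val-scale (c q) κ))))

      module _ {a t₁ t₂ t₃ κ a' t₁' t₂' t₃' κ' : ℤ} where
        -- a, t₁, t₂, t₃, κ are the values of k, s₁, s₂, s₃, κ in Spread.traced, and rᵢ = c pᵢ, uᵢ = c qᵢ.
        relation : ∀ r₁ u₁ r₂ u₂ r₃ u₃ →
          t₁ + r₁ * a ≈ t₁' + r₁ * a' → t₂ - u₂ * a ≈ t₂' - u₂ * a' →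
          t₃ + r₃ * κ ≈ t₂ + r₂ * a → t₃' + r₃ * κ' ≈ t₂' + r₂ * a' →
          t₃ - u₃ * κ ≈ t₁ - u₁ * a → t₃' - u₃ * κ' ≈ t₁' - u₁ * a' →
          ((t₃ + r₃ * κ) - (r₂ + u₂) * a ≈ (t₃' + r₃ * κ') - (r₂ + u₂) * a') ×
          ((r₃ + u₃) * κ - ((r₁ + u₁) + (r₂ + u₂)) * a ≈ (r₃ + u₃) * κ' - ((r₁ + u₁) + (r₂ + u₂)) * a')
        relation r₁ u₁ r₂ u₂ r₃ u₃ e₁ e₂ e₃ e₃' e₄ e₄' = X-ends , combine₂ 1ℤ (- 1ℤ) X-ends Y-ends (lemma₃ r₁ u₁ r₂ u₂ r₃ u₃ a t₃ κ a' t₃' κ')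
          where
          X-ends₀ : (t₃ + r₃ * κ) - t₃' - r₃ * κ' ≈ (t₂ + r₂ * a) - t₂' - r₂ * a'
          X-ends₀ = combine₂ 1ℤ (- 1ℤ) e₃ e₃' (lemma r₂ r₃ a t₂ t₃ κ a' t₂' t₃' κ')
            where
            lemma : ∀ r₂ r₃ a t₂ t₃ κ a' t₂' t₃' κ' → ((t₃ + r₃ * κ) - t₃' - r₃ * κ') - ((t₂ + r₂ * a) - t₂' - r₂ * a')
              ≡ 1ℤ * ((t₃ + r₃ * κ) - (t₂ + r₂ * a)) + - 1ℤ * ((t₃' + r₃ * κ') - (t₂' + r₂ * a'))
            lemma = solve-∀
          X-ends : (t₃ + r₃ * κ) - (r₂ + u₂) * a ≈ (t₃' + r₃ * κ') - (r₂ + u₂) * a'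
          X-ends = combine₂ 1ℤ 1ℤ X-ends₀ e₂ (lemma r₂ u₂ r₃ a t₂ t₃ κ a' t₂' t₃' κ')
            where
            lemma : ∀ r₂ u₂ r₃ a t₂ t₃ κ a' t₂' t₃' κ' →
              ((t₃ + r₃ * κ) - (r₂ + u₂) * a) - ((t₃' + r₃ * κ') - (r₂ + u₂) * a')
              ≡ 1ℤ * (((t₃ + r₃ * κ) - t₃' - r₃ * κ') - ((t₂ + r₂ * a) - t₂' - r₂ * a')) + 1ℤ * ((t₂ - u₂ * a) - (t₂' - u₂ * a'))
            lemma = solve-∀
          Y-ends₀ : (t₃ - u₃ * κ) - t₃' - - (u₃ * κ') ≈ (t₁ - u₁ * a) - t₁' - - (u₁ * a')
          Y-ends₀ = combine₂ 1ℤ (- 1ℤ) e₄ e₄' (lemma u₁ u₃ a t₁ t₃ κ a' t₁' t₃' κ')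
            where
            lemma : ∀ r₂ r₃ a t₂ t₃ κ a' t₂' t₃' κ' → ((t₃ - r₃ * κ) - t₃' - - (r₃ * κ')) - ((t₂ - r₂ * a) - t₂' - - (r₂ * a'))
              ≡ 1ℤ * ((t₃ - r₃ * κ) - (t₂ - r₂ * a)) + - 1ℤ * ((t₃' - r₃ * κ') - (t₂' - r₂ * a'))
            lemma = solve-∀
          Y-ends : (t₃ - u₃ * κ) + (r₁ + u₁) * a ≈ (t₃' - u₃ * κ') + (r₁ + u₁) * a'
          Y-ends = combine₂ 1ℤ 1ℤ Y-ends₀ e₁ (lemma u₁ r₁ u₃ a t₁ t₃ κ a' t₁' t₃' κ')
            where
            lemma : ∀ u₁ r₁ u₃ a t₁ t₃ κ a' t₁' t₃' κ' →
              ((t₃ - u₃ * κ) + (r₁ + u₁) * a) - ((t₃' - u₃ * κ') + (r₁ + u₁) * a')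
              ≡ 1ℤ * (((t₃ - u₃ * κ) - t₃' - - (u₃ * κ')) - ((t₁ - u₁ * a) - t₁' - - (u₁ * a'))) + 1ℤ * ((t₁ + r₁ * a) - (t₁' + r₁ * a'))
            lemma = solve-∀
          lemma₃ : ∀ r₁ u₁ r₂ u₂ r₃ u₃ a t₃ κ a' t₃' κ' →
            ((r₃ + u₃) * κ - ((r₁ + u₁) + (r₂ + u₂)) * a) - ((r₃ + u₃) * κ' - ((r₁ + u₁) + (r₂ + u₂)) * a')
            ≡ 1ℤ * (((t₃ + r₃ * κ) - (r₂ + u₂) * a) - ((t₃' + r₃ * κ') - (r₂ + u₂) * a'))
              + - 1ℤ * (((t₃ - u₃ * κ) + (r₁ + u₁) * a) - ((t₃' - u₃ * κ') + (r₁ + u₁) * a'))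
          lemma₃ = solve-∀

        colour-probe : ∀ S₃ T → S₃ * κ - T * a ≈ S₃ * κ' - T * a' → κ ≈ κ' → T * a ≈ T * a'
        colour-probe S₃ T e f = combine₂ (- 1ℤ) S₃ e f (lemma S₃ T a κ a' κ')
          where
          lemma : ∀ S T a κ a' κ' → T * a - T * a' ≡ - 1ℤ * ((S * κ - T * a) - (S * κ' - T * a')) + S * (κ - κ')
          lemma = solve-∀

        vertex-probe : ∀ r₃ S₂ S₃ T t → (t₃ + r₃ * κ) - S₂ * a ≈ (t₃' + r₃ * κ') - S₂ * a' →
          S₃ * κ - T * a ≈ S₃ * κ' - T * a' → t₃ + t * κ ≈ t₃' + t * κ' →
          (S₃ * S₂ - (r₃ - t) * T) * a ≈ (S₃ * S₂ - (r₃ - t) * T) * a'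
        vertex-probe r₃ S₂ S₃ T t A AB e = combine₂ (r₃ - t) (- S₃) AB
          (combine₂ {a = (r₃ - t) * κ - S₂ * a} {(r₃ - t) * κ' - S₂ * a'} 1ℤ (- 1ℤ) A e (lemma r₃ S₂ t a t₃ κ a' t₃' κ'))
          (lemma' r₃ S₂ S₃ T t a κ a' κ')
          where
          lemma : ∀ r₃ S₂ t a t₃ κ a' t₃' κ' → ((r₃ - t) * κ - S₂ * a) - ((r₃ - t) * κ' - S₂ * a')
            ≡ 1ℤ * (((t₃ + r₃ * κ) - S₂ * a) - ((t₃' + r₃ * κ') - S₂ * a')) + - 1ℤ * ((t₃ + t * κ) - (t₃' + t * κ'))
          lemma = solve-∀
          lemma' : ∀ r₃ S₂ S₃ T t a κ a' κ' → (S₃ * S₂ - (r₃ - t) * T) * a - (S₃ * S₂ - (r₃ - t) * T) * a'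
            ≡ (r₃ - t) * ((S₃ * κ - T * a) - (S₃ * κ' - T * a')) + - S₃ * (((r₃ - t) * κ - S₂ * a) - ((r₃ - t) * κ' - S₂ * a'))
          lemma' = solve-∀

      spread : Spread lin
      spread = record { diagonal = diagonal ; traced = traced }
        where
        val-cong : ∀ {x y a b} → x ≡ y → val x ≈ a → val y ≈ b → a ≈ b
        val-cong refl u v = ≈-trans (≈-sym u) v

        diagonal : ∀ p {κ κ'} → S p p κ ≡ S p p κ' → κ ≡ κ'
        diagonal p {κ} {κ'} e = val-inj (unit-cancel {c p + c p} (sums p p)
          (val-cong e (val-S c p p κ) (val-S c p p κ')))

        traced : ∀ π {p₁ q₁ p₂ q₂ p₃ q₃} → p₁ ≢ q₁ → p₂ ≢ q₂ → p₃ ≢ q₃ → ∀ {k k' s₁ s₁' s₂ s₂' s₃ s₃' κ κ'} →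
          X p₁ s₁ k ≡ X p₁ s₁' k' → Y q₂ s₂ k ≡ Y q₂ s₂' k' →
          X p₃ s₃ κ ≡ X p₂ s₂ k → X p₃ s₃' κ' ≡ X p₂ s₂' k' →
          Y q₃ s₃ κ ≡ Y q₁ s₁ k → Y q₃ s₃' κ' ≡ Y q₁ s₁' k' →
          probe lin π s₃ κ ≡ probe lin π s₃' κ' → k ≡ k'
        traced π {p₁} {q₁} {p₂} {q₂} {p₃} {q₃} n₁ n₂ n₃ {k} {k'} {s₁} {s₁'} {s₂} {s₂'} {s₃} {s₃'} {κ} {κ'} e₁ e₂ e₃ e₃' e₄ e₄' e
          = go π e
          where
          rel = relation {val k} {val s₁} {val s₂} {val s₃} {val κ} {val k'} {val s₁'} {val s₂'} {val s₃'} {val κ'}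
            (c p₁) (c q₁) (c p₂) (c q₂) (c p₃) (c q₃)
            (val-cong e₁ (val-X p₁ s₁ k) (val-X p₁ s₁' k')) (val-cong e₂ (val-Y q₂ s₂ k) (val-Y q₂ s₂' k'))
            (val-cong e₃ (val-X p₃ s₃ κ) (val-X p₂ s₂ k)) (val-cong e₃' (val-X p₃ s₃' κ') (val-X p₂ s₂' k'))
            (val-cong e₄ (val-Y q₃ s₃ κ) (val-Y q₁ s₁ k)) (val-cong e₄' (val-Y q₃ s₃' κ') (val-Y q₁ s₁' k'))
          S₃ T : ℤ
          S₃ = c p₃ + c q₃
          T = (c p₁ + c q₁) + (c p₂ + c q₂)
          via : ∀ t → val s₃ + t * val κ ≈ val s₃' + t * val κ' →
            (S₃ * (c p₂ + c q₂) - (c p₃ - t) * T) * val k ≈ (S₃ * (c p₂ + c q₂) - (c p₃ - t) * T) * val k'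
          via t f = vertex-probe {val k} {val s₁} {val s₂} {val s₃} {val κ} {val k'} {val s₁'} {val s₂'} {val s₃'} {val κ'}
            (c p₃) (c p₂ + c q₂) S₃ T t (proj₁ rel) (proj₂ rel) f
          go : ∀ π → probe lin π s₃ κ ≡ probe lin π s₃' κ' → k ≡ k'
          go (inj₁ j) e = val-inj (unit-cancel {S₃ * (c p₂ + c q₂) - (c p₃ - c j) * T} {val k} {val k'} (shifts p₁ q₁ p₂ q₂ p₃ q₃ j n₁ n₂ n₃)
            (via (c j) (val-cong e (val-X j s₃ κ) (val-X j s₃' κ'))))
          go (inj₂ (inj₁ j)) e = val-inj (unit-cancel {S₃ * (c p₂ + c q₂) - (c p₃ - - c j) * T} {val k} {val k'} (reflections p₁ q₁ p₂ q₂ p₃ q₃ j n₁ n₂ n₃)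
            (via (- c j) (≈-trans (≈-reflexive (negate (val s₃) (c j) (val κ)))
              (≈-trans (val-cong e (val-Y j s₃ κ) (val-Y j s₃' κ')) (≈-reflexive (sym (negate (val s₃') (c j) (val κ'))))))))
            where
            negate : ∀ s c κ → s + - c * κ ≡ s - c * κ
            negate = solve-∀
          go (inj₂ (inj₂ _)) e = val-inj (unit-cancel {T} {val k} {val k'} (pairs p₁ q₁ p₂ q₂ n₁ n₂)
            (colour-probe {val k} {val s₁} {val s₂} {val s₃} {val κ} {val k'} {val s₁'} {val s₂'} {val s₃'} {val κ'}
              S₃ T (proj₂ rel) (≈-reflexive (cong val e))))

  -- Small integers for which none of the required expressions vanishes. For 1, 2, 3 one of the
  -- shifts does: (3 + 1)(1 + 2) - (3 - 1)((1 + 2) + (1 + 2)) = 0.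
  c₂₃₄ : Fin 3 → ℤ
  c₂₃₄ 0F = + 2
  c₂₃₄ 1F = + 3
  c₂₃₄ 2F = + 4

  abstract
    -- The least common multiple of all the numbers that have to be units.
    P : ℕ
    P = 295566721025705566877840400

    sum-∣ : ∀ p q → c₂₃₄ p + c₂₃₄ q ∣ + P
    sum-∣ = from-yes (all? {n = 3} λ p → all? {n = 3} λ q → c₂₃₄ p + c₂₃₄ q ∣? + P)

    pair-∣ : ∀ p₁ q₁ p₂ q₂ → p₁ ≢ q₁ → p₂ ≢ q₂ → (c₂₃₄ p₁ + c₂₃₄ q₁) + (c₂₃₄ p₂ + c₂₃₄ q₂) ∣ + P
    pair-∣ = from-yes (all? {n = 3} λ p₁ → all? {n = 3} λ q₁ → all? {n = 3} λ p₂ → all? {n = 3} λ q₂ →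
      ¬? (p₁ ≟ q₁) →-dec (¬? (p₂ ≟ q₂) →-dec (c₂₃₄ p₁ + c₂₃₄ q₁) + (c₂₃₄ p₂ + c₂₃₄ q₂) ∣? + P))

    difference-∣ : ∀ p q → p ≢ q → c₂₃₄ p - c₂₃₄ q ∣ + P
    difference-∣ = from-yes (all? {n = 3} λ p → all? {n = 3} λ q → ¬? (p ≟ q) →-dec c₂₃₄ p - c₂₃₄ q ∣? + P)

    shift-∣ : ∀ p₁ q₁ p₂ q₂ p₃ q₃ j → p₁ ≢ q₁ → p₂ ≢ q₂ → p₃ ≢ q₃ →
      (c₂₃₄ p₃ + c₂₃₄ q₃) * (c₂₃₄ p₂ + c₂₃₄ q₂) - (c₂₃₄ p₃ - c₂₃₄ j) * ((c₂₃₄ p₁ + c₂₃₄ q₁) + (c₂₃₄ p₂ + c₂₃₄ q₂)) ∣ + P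
    shift-∣ = from-yes (all? {n = 3} λ p₁ → all? {n = 3} λ q₁ → all? {n = 3} λ p₂ → all? {n = 3} λ q₂ →
      all? {n = 3} λ p₃ → all? {n = 3} λ q₃ → all? {n = 3} λ j →
      ¬? (p₁ ≟ q₁) →-dec (¬? (p₂ ≟ q₂) →-dec (¬? (p₃ ≟ q₃) →-dec (c₂₃₄ p₃ + c₂₃₄ q₃) * (c₂₃₄ p₂ + c₂₃₄ q₂) - (c₂₃₄ p₃ - c₂₃₄ j) * ((c₂₃₄ p₁ + c₂₃₄ q₁) + (c₂₃₄ p₂ + c₂₃₄ q₂)) ∣? + P)))

    reflect-∣ : ∀ p₁ q₁ p₂ q₂ p₃ q₃ j → p₁ ≢ q₁ → p₂ ≢ q₂ → p₃ ≢ q₃ →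
      (c₂₃₄ p₃ + c₂₃₄ q₃) * (c₂₃₄ p₂ + c₂₃₄ q₂) - (c₂₃₄ p₃ - - c₂₃₄ j) * ((c₂₃₄ p₁ + c₂₃₄ q₁) + (c₂₃₄ p₂ + c₂₃₄ q₂)) ∣ + P
    reflect-∣ = from-yes (all? {n = 3} λ p₁ → all? {n = 3} λ q₁ → all? {n = 3} λ p₂ → all? {n = 3} λ q₂ →
      all? {n = 3} λ p₃ → all? {n = 3} λ q₃ → all? {n = 3} λ j →
      ¬? (p₁ ≟ q₁) →-dec (¬? (p₂ ≟ q₂) →-dec (¬? (p₃ ≟ q₃) →-dec (c₂₃₄ p₃ + c₂₃₄ q₃) * (c₂₃₄ p₂ + c₂₃₄ q₂) - (c₂₃₄ p₃ - - c₂₃₄ j) * ((c₂₃₄ p₁ + c₂₃₄ q₁) + (c₂₃₄ p₂ + c₂₃₄ q₂)) ∣? + P)))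

  -- The factor in the bounds 3ᵗ d ≤ A t · n. The summand 3 t (1 + P) comes from the codes of
  -- uncovered pairs, 3 t times as many as the values of `rest`, together with m |V| ≤ (1 + P) n;
  -- the summand 21 P counts lost hexagons: three positions, seven probes and P late values.
  A : ℕ → ℕ
  A t = 3 ℕ.* t ℕ.* (1 ℕ.+ P) ℕ.+ (1 ℕ.+ 21 ℕ.* P)

  abstract
    -- Chosen with some room: 3 (A 130)² is below 10⁵⁹, while 3¹³⁰ exceeds 10⁶².
    t₀ : ℕ
    t₀ = 130

    2≤t₀ : 2 ≤ t₀
    2≤t₀ = from-yes (2 ≤? t₀)

    A-base : A t₀ ℕ.* A t₀ ℕ.* 3 ≤ 3 ℕ.^ t₀
    A-base = from-yes (A t₀ ℕ.* A t₀ ℕ.* 3 ≤? 3 ℕ.^ t₀)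

    6≤P : 6 ≤ P
    6≤P = from-yes (6 ≤? P)

  module Spreading (t : ℕ) where
    open Residues (t ℕ.* P)
    module SP = SpreadScalars (t ℕ.* P) c₂₃₄

    -- As m = 1 + t P, the number - t P is 1 modulo m; so if q u = P, then - t q inverts u.
    divisor-unit : ∀ {u} → u ∣ + P → Unit u
    divisor-unit {u} (divides q P≡q*u) = - (+ t * q) , by (divides (- 1ℤ) refl) (begin
      u * - (+ t * q) - 1ℤ             ≡⟨ lemma u (+ t) q ⟩
      - 1ℤ * (1ℤ + + t * (q * u))      ≡⟨ cong (λ z → - 1ℤ * (1ℤ + + t * z)) (sym P≡q*u) ⟩
      - 1ℤ * (1ℤ + + t * + P)          ≡⟨ cong (λ z → - 1ℤ * (1ℤ + z)) (sym (ℤ.pos-* t P)) ⟩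
      - 1ℤ * + m ∎)
      where
      open ≡-Reasoning
      lemma : ∀ u t q → u * - (t * q) - 1ℤ ≡ - 1ℤ * (1ℤ + t * (q * u))
      lemma = solve-∀

    sums : SP.SumUnits
    sums p q = divisor-unit (sum-∣ p q)

    pairs : SP.PairUnits
    pairs p₁ q₁ p₂ q₂ n₁ n₂ = divisor-unit (pair-∣ p₁ q₁ p₂ q₂ n₁ n₂)

    differences : SP.DifferenceUnits
    differences p q n = divisor-unit (difference-∣ p q n)

    shifts : SP.ShiftUnits
    shifts p₁ q₁ p₂ q₂ p₃ q₃ j n₁ n₂ n₃ = divisor-unit (shift-∣ p₁ q₁ p₂ q₂ p₃ q₃ j n₁ n₂ n₃)

    reflections : SP.ReflectUnits
    reflections p₁ q₁ p₂ q₂ p₃ q₃ j n₁ n₂ n₃ = divisor-unit (reflect-∣ p₁ q₁ p₂ q₂ p₃ q₃ j n₁ n₂ n₃)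

    lin : Lin (Fin m)
    lin = SP.lin sums pairs differences shifts reflections

    spread : Spread lin
    spread = SP.spread sums pairs differences shifts reflections

open Scalars

-- The recursive construction

module Extend {V H C B : Set} (Sys : System V H C) (LV : Lin V) (LB : Lin B)
  (τ τ⁻¹ : Fin 3 → B → B) (τ-τ⁻¹ : ∀ d b → τ d (τ⁻¹ d b) ≡ b) (τ-inj : ∀ d {b b'} → τ d b ≡ τ d b' → b ≡ b')
  (ω : B)
  (separating : Separating LB τ ω)
  where

  private
    module S = System Sys
    module B = Blocks LB
    LR = LB ×ᴸ LV
    module R = Blocks LR

    -- For all d the hexagons are the same up to colour; `τ d` decides which colour a block gets. A
    -- low colour shared by two digits therefore stands for different multiples of the difference in
    -- the two copies.
    low : Fin 3 → System (B × V) (H × B × B) (B × C)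
    low d = Sys ⊗ twist LB (τ d) (τ⁻¹ d) (τ-τ⁻¹ d) (τ-inj d)
    module Low d = System (low d)

  V' H' C' : Set
  V' = Fin 3 × B × V
  H' = ((B × V) × (B × V)) ⊎ (Fin 3 × H × B × B)
  C' = (B × V) ⊎ (B × C)

  private
    -- Because `flip` negates the y-coordinate, a top edge determines the sum e + f of its
    -- B-coordinates. The term `lam p ω`, added on the x-side only, is what survives when two top
    -- edges of one colour running between d and d' in opposite directions are subtracted. The
    -- V-coordinates are left alone, so differences there keep their meaning in `Codes`.
    shift : Fin 3 → B × V → B × V
    shift p (e , u) = e B.⊕ B.lam p ω , u

    flip : B × V → B × V
    flip (f , v) = B.⊖ f , v

    shift-inj : ∀ p {r r'} → shift p r ≡ shift p r' → r ≡ r'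
    shift-inj p e = cong₂ _,_ (B.⊕-cancelʳ (B.lam p ω) (cong proj₁ e)) (cong proj₂ e)

    flip-inj : ∀ {r r'} → flip r ≡ flip r' → r ≡ r'
    flip-inj e = cong₂ _,_ (B.⊖-inj (cong proj₁ e)) (cong proj₂ e)

    xv yv : H' → Fin 3 → V'
    xv (inj₁ (s , κ)) p = p , shift p (R.X p s κ)
    xv (inj₂ (d , h)) p = d , Low.xv d h p
    yv (inj₁ (s , κ)) q = q , flip (R.Y q s κ)
    yv (inj₂ (d , h)) q = d , Low.yv d h q

    col : H' → C'
    col (inj₁ (s , κ)) = inj₁ κ
    col (inj₂ (d , h)) = inj₂ (Low.col d h)

    Leave : V' → V' → Set
    Leave (d , _ , u) (d' , _ , v) = d ≡ d' × S.Leave u v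

    Edge : H' → V' → V' → Set
    Edge h x y = Σ (Fin 3) λ p → Σ (Fin 3) λ q → p ≢ q × xv h p ≡ x × yv h q ≡ y

    find : ∀ x y → Σ H' (λ h → Edge h x y) ⊎ Leave x y
    find (d , r) (d' , r') with d ≟ d'
    find (d , r) (d , r') | yes refl with Low.find d r r'
    ... | inj₁ (h , p , q , p≢q , ex , ey) = inj₁ (inj₂ (d , h) , p , q , p≢q , cong (d ,_) ex , cong (d ,_) ey)
    ... | inj₂ l = inj₂ (refl , l)
    find (d , e , u) (d' , f , v) | no d≢d'
      with R.block-through d≢d' (e B.⊕ B.⊖ B.lam d ω , u) (B.⊖ f , v)
    ... | s , κ , ex , ey = inj₁ (inj₁ (s , κ) , d , d' , d≢d'
      , cong (d ,_) (trans (cong (shift d) ex) (cong (_, u) (B.⊖-⊕ e (B.lam d ω))))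
      , cong (d' ,_) (trans (cong flip ey) (cong (_, v) (B.⊖-involutive f))))

    Edge⇒¬Leave : ∀ {h x y} → Edge h x y → ¬ Leave x y
    Edge⇒¬Leave {inj₁ _} (p , q , p≢q , refl , refl) (refl , _) = p≢q refl
    Edge⇒¬Leave {inj₂ (d , h)} (p , q , p≢q , refl , refl) (_ , l) =
      Low.Edge⇒¬Leave d {h} (p , q , p≢q , refl , refl) l

    xv-inj : ∀ h {p q} → xv h p ≡ xv h q → p ≡ q
    xv-inj (inj₁ _) e = cong proj₁ e
    xv-inj (inj₂ (d , h)) e = Low.xv-inj d h (cong proj₂ e)

    yv-inj : ∀ h {p q} → yv h p ≡ yv h q → p ≡ q
    yv-inj (inj₁ _) e = cong proj₁ e
    yv-inj (inj₂ (d , h)) e = Low.yv-inj d h (cong proj₂ e)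

    X-disjoint : ∀ {h h' p p'} → col h ≡ col h' → xv h p ≡ xv h' p' → h ≡ h'
    X-disjoint {inj₁ (s , κ)} {inj₁ _} {p} refl e with cong proj₁ e
    ... | refl = cong (λ t → inj₁ (t , κ)) (R.X-base p κ (shift-inj p (cong proj₂ e)))
    X-disjoint {inj₂ (d , h)} {inj₂ _} c e with cong proj₁ e
    ... | refl = cong (λ t → inj₂ (d , t)) (Low.X-disjoint d (inj₂-injective c) (cong proj₂ e))

    Y-disjoint : ∀ {h h' q q'} → col h ≡ col h' → yv h q ≡ yv h' q' → h ≡ h'
    Y-disjoint {inj₁ (s , κ)} {inj₁ _} {q} refl e with cong proj₁ e
    ... | refl = cong (λ t → inj₁ (t , κ)) (R.Y-base q κ (flip-inj (cong proj₂ e)))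
    Y-disjoint {inj₂ (d , h)} {inj₂ _} c e with cong proj₁ e
    ... | refl = cong (λ t → inj₂ (d , t)) (Low.Y-disjoint d (inj₂-injective c) (cong proj₂ e))

    XX-unique : ∀ {h h' p q p' q'} → p ≢ q → xv h p ≡ xv h' p' → xv h q ≡ xv h' q' → h ≡ h'
    XX-unique {inj₁ _} {inj₁ _} {p} {q} p≢q e f with cong proj₁ e | cong proj₁ f
    ... | refl | refl with R.XX-determines p≢q (shift-inj p (cong proj₂ e)) (shift-inj q (cong proj₂ f))
    ... | refl , refl = refl
    XX-unique {inj₁ _} {inj₂ _} p≢q e f = contradiction (trans (cong proj₁ e) (sym (cong proj₁ f))) p≢q
    XX-unique {inj₂ (_ , h)} {inj₁ _} {p} {q} p≢q e f with trans (sym (cong proj₁ e)) (cong proj₁ f)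
    XX-unique {inj₂ (d , h)} {inj₁ (s , κ)} {p} {q} {p'} {q'} p≢q e f | refl =
      contradiction (Low.xv-inj d h {p} {q} (cong proj₂ (trans e (sym f)))) p≢q
    XX-unique {inj₂ (d , _)} {inj₂ _} p≢q e f with cong proj₁ e
    ... | refl = cong (λ t → inj₂ (d , t)) (Low.XX-unique d p≢q (cong proj₂ e) (cong proj₂ f))

    YY-unique : ∀ {h h' p q p' q'} → p ≢ q → yv h p ≡ yv h' p' → yv h q ≡ yv h' q' → h ≡ h'
    YY-unique {inj₁ _} {inj₁ _} {p} {q} p≢q e f with cong proj₁ e | cong proj₁ f
    ... | refl | refl with R.YY-determines p≢q (flip-inj (cong proj₂ e)) (flip-inj (cong proj₂ f))
    ... | refl , refl = refl
    YY-unique {inj₁ _} {inj₂ _} p≢q e f = contradiction (trans (cong proj₁ e) (sym (cong proj₁ f))) p≢q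
    YY-unique {inj₂ (_ , h)} {inj₁ _} {p} {q} p≢q e f with trans (sym (cong proj₁ e)) (cong proj₁ f)
    YY-unique {inj₂ (d , h)} {inj₁ (s , κ)} {p} {q} {p'} {q'} p≢q e f | refl =
      contradiction (Low.yv-inj d h {p} {q} (cong proj₂ (trans e (sym f)))) p≢q
    YY-unique {inj₂ (d , _)} {inj₂ _} p≢q e f with cong proj₁ e
    ... | refl = cong (λ t → inj₂ (d , t)) (Low.YY-unique d p≢q (cong proj₂ e) (cong proj₂ f))

    edge-unique : ∀ {h h' x y} → Edge h x y → Edge h' x y → h ≡ h'
    edge-unique {inj₁ _} {inj₁ _} (p , q , p≢q , refl , refl) (p' , q' , _ , e , f) with cong proj₁ e | cong proj₁ f
    ... | refl | refl with R.XY-determines p≢q (sym (shift-inj p (cong proj₂ e))) (sym (flip-inj (cong proj₂ f)))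
    ... | refl , refl = refl
    edge-unique {inj₁ _} {inj₂ _} (p , q , p≢q , refl , refl) (_ , _ , _ , e , f) =
      contradiction (trans (sym (cong proj₁ e)) (cong proj₁ f)) p≢q
    edge-unique {inj₂ _} {inj₁ _} (p , q , p≢q , refl , refl) (_ , _ , p'≢q' , e , f) =
      contradiction (trans (cong proj₁ e) (sym (cong proj₁ f))) p'≢q'
    edge-unique {inj₂ (d , _)} {inj₂ _} (p , q , p≢q , refl , refl) (p' , q' , p'≢q' , e , f) with cong proj₁ e
    ... | refl = cong (λ t → inj₂ (d , t))
      (Low.edge-unique d (p , q , p≢q , refl , refl) (p' , q' , p'≢q' , cong proj₂ e , cong proj₂ f))

    Top-sum : ∀ {s κ e u f v} p q → shift p (R.X p s κ) ≡ (e , u) → flip (R.Y q s κ) ≡ (f , v) →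
      e B.⊕ f ≡ B.S p q (proj₁ κ) B.⊕ B.lam p ω
    Top-sum {s , _} {κ , _} p q refl refl = begin
      (B.X p s κ B.⊕ B.lam p ω) B.⊕ B.⊖ y   ≡⟨ cong (λ t → (t B.⊕ B.lam p ω) B.⊕ B.⊖ y) (B.X-Y p q s κ) ⟩
      ((y B.⊕ B.S p q κ) B.⊕ B.lam p ω) B.⊕ B.⊖ y ≡⟨ B.⊕-cancelʳ y (trans (B.⊖-⊕ _ y) (trans (B.⊕-assoc y _ _) (B.⊕-comm y _))) ⟩
      B.S p q κ B.⊕ B.lam p ω ∎
      where
      open ≡-Reasoning
      y = B.Y q s κ

    -- The B-coordinates of the two top edges force (e₁ ⊖ f₂) ⊖ (e₂ ⊖ f₁) = lam d ω ⊖ lam d' ω,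
    -- which the two low edges exclude by the separating property.
    top-low-clash : ∀ {s₁ s₂ κ d d' h₃ h₄ x₁ x₂ y₁ y₂} →
      Edge (inj₁ (s₁ , κ)) x₁ y₁ → Edge (inj₁ (s₂ , κ)) x₂ y₂ →
      Edge (inj₂ (d , h₃)) x₁ y₂ → Edge (inj₂ (d' , h₄)) x₂ y₁ → Low.col d h₃ ≡ Low.col d' h₄ → ⊥
    top-low-clash {s₁} {s₂} {κ} {d} {d'} {h₃ = h₃ , t₃ , k} {h₄ = h₄ , t₄ , _} {_ , e₁ , _} {_ , e₂ , _} {_ , f₁ , _} {_ , f₂ , _}
      (p₁ , q₁ , p₁≢q₁ , ex₁ , ey₁) (p₂ , q₂ , p₂≢q₂ , ex₂ , ey₂)
      (p₃ , q₃ , p₃≢q₃ , ex₃ , ey₃) (p₄ , q₄ , p₄≢q₄ , ex₄ , ey₄) c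
      with cong proj₁ c | trans (cong proj₁ ex₃) (sym (cong proj₁ ex₁)) | trans (cong proj₁ ex₄) (sym (cong proj₁ ex₂))
         | trans (cong proj₁ ey₄) (sym (cong proj₁ ey₁)) | trans (cong proj₁ ey₃) (sym (cong proj₁ ey₂))
    ... | refl | refl | refl | refl | refl = separating p₁≢q₁ p₃≢q₃ p₄≢q₄ k
      (B.⊕-cancelˡ (f₁ B.⊕ f₂) (begin
        (f₁ B.⊕ f₂) B.⊕ (B.S p₃ q₃ (τ p₁ k) B.⊕ B.lam p₂ ω)
          ≡⟨ B.CM.solve 4 (λ f g a b → (f ⊞ g) ⊞ (a ⊞ b) ⊜ ((g ⊞ a) ⊞ f) ⊞ b) refl f₁ f₂ _ _ ⟩
        ((f₂ B.⊕ B.S p₃ q₃ (τ p₁ k)) B.⊕ f₁) B.⊕ B.lam p₂ ω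
          ≡⟨ cong (λ t → (t B.⊕ f₁) B.⊕ B.lam p₂ ω) (sym low₃) ⟩
        (e₁ B.⊕ f₁) B.⊕ B.lam p₂ ω
          ≡⟨ cong (B._⊕ B.lam p₂ ω) (Top-sum {s₁} {κ} p₁ p₂ (cong proj₂ ex₁) (cong proj₂ ey₁)) ⟩
        (B.S p₁ p₂ (proj₁ κ) B.⊕ B.lam p₁ ω) B.⊕ B.lam p₂ ω
          ≡⟨ B.CM.solve 4 (λ a b l m → ((a ⊞ b) ⊞ l) ⊞ m ⊜ ((b ⊞ a) ⊞ m) ⊞ l) refl _ _ _ _ ⟩
        (B.S p₂ p₁ (proj₁ κ) B.⊕ B.lam p₂ ω) B.⊕ B.lam p₁ ω
          ≡⟨ cong (B._⊕ B.lam p₁ ω) (sym (Top-sum {s₂} {κ} p₂ p₁ (cong proj₂ ex₂) (cong proj₂ ey₂))) ⟩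
        (e₂ B.⊕ f₂) B.⊕ B.lam p₁ ω
          ≡⟨ cong (λ t → (t B.⊕ f₂) B.⊕ B.lam p₁ ω) low₄ ⟩
        ((f₁ B.⊕ B.S p₄ q₄ (τ p₂ k)) B.⊕ f₂) B.⊕ B.lam p₁ ω
          ≡⟨ B.CM.solve 4 (λ f g a b → ((f ⊞ a) ⊞ g) ⊞ b ⊜ (f ⊞ g) ⊞ (a ⊞ b)) refl f₁ f₂ _ _ ⟩
        (f₁ B.⊕ f₂) B.⊕ (B.S p₄ q₄ (τ p₂ k) B.⊕ B.lam p₁ ω) ∎))
      where
      open ≡-Reasoning
      open B.CM using (_⊜_) renaming (_⊕_ to _⊞_)
      low₃ : e₁ ≡ f₂ B.⊕ B.S p₃ q₃ (τ p₁ k)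
      low₃ = B.edge-sum p₃ q₃ t₃ (τ p₁ k) (cong (proj₁ ∘ proj₂) ex₃) (cong (proj₁ ∘ proj₂) ey₃)
      low₄ : e₂ ≡ f₁ B.⊕ B.S p₄ q₄ (τ p₂ k)
      low₄ = B.edge-sum p₄ q₄ t₄ (τ p₂ k) (cong (proj₁ ∘ proj₂) ex₄) (cong (proj₁ ∘ proj₂) ey₄)

    no-alternation : ∀ {h₁ h₂ h₃ h₄ x₁ x₂ y₁ y₂} → col h₁ ≡ col h₂ → col h₃ ≡ col h₄ →
      Edge h₁ x₁ y₁ → Edge h₂ x₂ y₂ → Edge h₃ x₁ y₂ → Edge h₄ x₂ y₁ → x₁ ≡ x₂ ⊎ y₁ ≡ y₂
    no-alternation {inj₁ (s₁ , κ)} {inj₁ (s₂ , _)} {inj₁ (s₃ , κ')} {inj₁ (s₄ , _)} refl refl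
      (p₁ , q₁ , p₁≢q₁ , refl , refl) (p₂ , q₂ , p₂≢q₂ , refl , refl)
      (p₃ , q₃ , p₃≢q₃ , ex₃ , ey₃) (p₄ , q₄ , p₄≢q₄ , ex₄ , ey₄)
      with cong proj₁ ex₃ | cong proj₁ ey₃ | cong proj₁ ex₄ | cong proj₁ ey₄
    ... | refl | refl | refl | refl
      -- For top edges the digits are the positions, so `same-side` makes the digits agree on one
      -- side and the blocks on B × V finish.
      with shift-inj p₁ (cong proj₂ ex₃) | flip-inj (cong proj₂ ey₃)
         | shift-inj p₂ (cong proj₂ ex₄) | flip-inj (cong proj₂ ey₄)
         | same-side p₁ p₂ q₁ q₂ p₁≢q₁ p₃≢q₃ p₄≢q₄ p₂≢q₂
    ... | x₃ | y₃ | x₄ | y₄ | inj₁ refl with R.crossing-X p₁≢q₁ p₂≢q₂ (sym x₃) (sym y₄) (sym x₄) (sym y₃)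
    ... | refl = inj₁ refl
    no-alternation {inj₁ (s₁ , κ)} {inj₁ (s₂ , _)} {inj₁ (s₃ , κ')} {inj₁ (s₄ , _)} refl refl
      (p₁ , q₁ , p₁≢q₁ , refl , refl) (p₂ , q₂ , p₂≢q₂ , refl , refl)
      (p₃ , q₃ , p₃≢q₃ , ex₃ , ey₃) (p₄ , q₄ , p₄≢q₄ , ex₄ , ey₄)
      | refl | refl | refl | refl | x₃ | y₃ | x₄ | y₄ | inj₂ refl
      with R.crossing-Y p₁≢q₁ p₂≢q₂ (sym x₃) (sym y₄) (sym x₄) (sym y₃)
    ... | refl = inj₂ refl
    no-alternation {inj₁ _} {inj₁ _} {inj₂ _} {inj₂ _} refl c' e₁ e₂ e₃ e₄ =
      ⊥-elim (top-low-clash e₁ e₂ e₃ e₄ (inj₂-injective c'))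
    no-alternation {inj₂ _} {inj₂ _} {inj₁ _} {inj₁ _} c refl e₁ e₂ e₃ e₄ =
      ⊥-elim (top-low-clash e₃ e₄ e₁ e₂ (inj₂-injective c))
    no-alternation {inj₂ (d , _)} {inj₂ _} {inj₂ _} {inj₂ _} c c'
      (p₁ , q₁ , p₁≢q₁ , refl , refl) (p₂ , q₂ , p₂≢q₂ , refl , refl)
      (p₃ , q₃ , p₃≢q₃ , ex₃ , ey₃) (p₄ , q₄ , p₄≢q₄ , ex₄ , ey₄)
      -- A low edge joins equal digits, so four low edges forming a cycle lie in one copy.
      with cong proj₁ ex₃ | cong proj₁ ey₃ | cong proj₁ ey₄
    ... | refl | refl | refl with Low.no-alternation d (inj₂-injective c) (inj₂-injective c')
        (p₁ , q₁ , p₁≢q₁ , refl , refl) (p₂ , q₂ , p₂≢q₂ , refl , refl)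
        (p₃ , q₃ , p₃≢q₃ , cong proj₂ ex₃ , cong proj₂ ey₃) (p₄ , q₄ , p₄≢q₄ , cong proj₂ ex₄ , cong proj₂ ey₄)
    ... | inj₁ e = inj₁ (cong (d ,_) e)
    ... | inj₂ e = inj₂ (cong (d ,_) e)

  system : System V' H' C'
  system = record
    { xv = xv
    ; yv = yv
    ; col = col
    ; Leave = Leave
    ; find = find
    ; Edge⇒¬Leave = λ {h} → Edge⇒¬Leave {h}
    ; xv-inj = xv-inj
    ; yv-inj = yv-inj
    ; X-disjoint = X-disjoint
    ; Y-disjoint = Y-disjoint
    ; XX-unique = XX-unique
    ; YY-unique = YY-unique
    ; edge-unique = edge-unique
    ; no-alternation = no-alternation
    }

  module Codes {L K : Set} (rest : V → L) (differences : LeaveDifferences Sys LV rest)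
    (code : H → V → V → K) (encodes : Encodes Sys code) where

    private
      module V = Blocks LV

    -- Top colours: w and z share their digit, so `opposite-edges` applies and w - z, known from
    -- `rest`, gives the V-part of the colour; its B-part and the digit are recorded. Low colours:
    -- the B-part is recorded and the previous level supplies the rest. The B-difference of w and z
    -- is unrestricted, which is why the B-part has to be stored.
    code' : H' → V' → V' → (Fin 3 × B × L) ⊎ (B × K)
    code' (inj₁ (_ , κ , _)) (d , _ , w) (_ , _ , z) = inj₁ (d , κ , rest (w V.⊕ V.⊖ z))
    code' (inj₂ (_ , h , _ , κ)) (_ , _ , w) (_ , _ , z) = inj₂ (κ , code h w z)

    encodes' : Encodes system code'
    encodes' {h₁ = inj₁ (s₁ , κB , κ)} {inj₁ (s₂ , _)} {inj₁ (s₁' , κB' , κ')} {inj₁ (s₂' , _)}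
      (p₁ , q₁ , p₁≢q₁ , refl , refl) (p₂ , q₂ , p₂≢q₂ , refl , refl) refl (refl , l)
      (p₁' , q₁' , _ , ex₁ , refl) (p₂' , q₂' , _ , refl , ey₂) refl (refl , l') c
      with cong proj₁ ex₁ | cong proj₁ ey₂ | cong proj₁ (inj₁-injective c) | cong (proj₁ ∘ proj₂) (inj₁-injective c)
    ... | refl | refl | refl | refl
      with V.opposite-edges (λ e → p₁≢q₁ (sym e)) p₂≢q₂
             (V.X-Y p₁ q₁ _ κ) (V.X-Y p₂ q₂ _ κ)
             (V.edge-sum p₁ q₁ _ κ' (cong (proj₂ ∘ proj₂) ex₁) refl)
             (V.edge-sum p₂ q₂ _ κ' refl (cong (proj₂ ∘ proj₂) ey₂))
             (differences l l' (cong (proj₂ ∘ proj₂) (inj₁-injective c)))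
    ... | refl with R.X-base p₁ _ (shift-inj p₁ (cong proj₂ ex₁)) | R.Y-base q₂ _ (flip-inj (cong proj₂ ey₂))
    ... | refl | refl = refl , refl
    encodes' {h₁ = inj₂ (d , h₁ , s₁ , κ)} {inj₂ (_ , h₂ , s₂ , _)} {inj₂ (_ , h₁' , s₁' , κ')} {inj₂ (_ , h₂' , s₂' , _)}
      (p₁ , q₁ , p₁≢q₁ , refl , refl) (p₂ , q₂ , p₂≢q₂ , refl , refl) c (refl , l)
      (p₁' , q₁' , p₁'≢q₁' , ex₁ , refl) (p₂' , q₂' , p₂'≢q₂' , refl , ey₂) c' (refl , l') k
      with cong proj₁ ex₁ | cong proj₁ (inj₂-injective c) | cong proj₁ (inj₂-injective c') | cong proj₁ (inj₂-injective k)
    ... | refl | refl | refl | refl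
      with encodes (p₁ , q₁ , p₁≢q₁ , refl , refl) (p₂ , q₂ , p₂≢q₂ , refl , refl) (cong proj₂ (inj₂-injective c)) l
             (p₁' , q₁' , p₁'≢q₁' , cong (proj₂ ∘ proj₂) ex₁ , refl)
             (p₂' , q₂' , p₂'≢q₂' , refl , cong (proj₂ ∘ proj₂) ey₂)
             (cong proj₂ (inj₂-injective c')) l' (cong proj₂ (inj₂-injective k))
    ... | w≡w' , z≡z'
      with S.edge-unique {h₁} {h₁'} (p₁ , q₁ , p₁≢q₁ , refl , refl)
             (p₁' , q₁' , p₁'≢q₁' , cong (proj₂ ∘ proj₂) ex₁ , sym z≡z')
         | S.edge-unique {h₂} {h₂'} (p₂ , q₂ , p₂≢q₂ , refl , refl)
             (p₂' , q₂' , p₂'≢q₂' , sym w≡w' , cong (proj₂ ∘ proj₂) ey₂)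
    ... | refl | refl
      with S.xv-inj h₁ {p₁'} {p₁} (cong (proj₂ ∘ proj₂) ex₁) | S.yv-inj h₁ {q₁} {q₁'} z≡z'
         | S.xv-inj h₂ {p₂} {p₂'} w≡w' | S.yv-inj h₂ {q₂'} {q₂} (cong (proj₂ ∘ proj₂) ey₂)
    ... | refl | refl | refl | refl
      with B.X-base p₁ (τ d κ) (cong (proj₁ ∘ proj₂) ex₁) | B.Y-base q₂ (τ d κ) (cong (proj₁ ∘ proj₂) ey₂)
    ... | refl | refl = refl , refl

-- Iterating the construction

-- A regrouping: here the digit and F₉ act together as F₂₇, whereas inside `Extend` the factor F₉
-- acts on its own as part of `B`.
module Letter {V : Set} (LV : Lin V) where
  private
    nested : Lin (F₂₇ × F₇³ × V)
    nested = lin₂₇ ×ᴸ lin₇³ ×ᴸ LV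
    module N = Lin nested
    to : F₂₇ × F₇³ × V → Fin 3 × B × V
    to ((d , g) , e , v) = d , (g , e) , v
    from : Fin 3 × B × V → F₂₇ × F₇³ × V
    from (d , (g , e) , v) = (d , g) , e , v

  lin : Lin (Fin 3 × B × V)
  lin = record
    { group = record
      { _⊕_ = λ a b → to (from a N.⊕ from b)
      ; ε = to N.ε
      ; ⊖_ = λ a → to (N.⊖ from a)
      ; ⊕-assoc = λ a b c → cong to (N.⊕-assoc (from a) (from b) (from c))
      ; ⊕-comm = λ a b → cong to (N.⊕-comm (from a) (from b))
      ; ⊕-identityˡ = λ a → cong to (N.⊕-identityˡ (from a))
      ; ⊕-inverseˡ = λ a → cong to (N.⊕-inverseˡ (from a))
      }
    ; lam = λ p a → to (N.lam p (from a))
    ; sol = λ p q a → to (N.sol p q (from a))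
    ; S-sol = λ p≢q a → cong to (N.S-sol p≢q (from a))
    ; S-inj = λ p≢q e → cong to (N.S-inj p≢q (cong from e))
    ; D-inj = λ p≢q e → cong to (N.D-inj p≢q (cong from e))
    ; T-inj = λ p≢q p≢r e → cong to (N.T-inj p≢q p≢r (cong from e))
    }

record Level (V H C L K : Set) : Set₁ where
  field
    system : System V H C
    lin : Lin V
    rest : V → L
    differences : LeaveDifferences system lin rest
    code : H → V → V → K
    encodes : Encodes system code

extend : ∀ {V H C L K} → Level V H C L K → Level (Fin 3 × B × V)
  (((B × V) × (B × V)) ⊎ (Fin 3 × H × B × B)) ((B × V) ⊎ (B × C)) (B × L) ((Fin 3 × B × L) ⊎ (B × K))
extend Λ = record
  { system = E.system
  ; lin = Letter.lin Λ.lin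
  ; rest = λ (_ , b , v) → b , Λ.rest v
  ; differences = λ { {d , (g , _) , _} {_ , (f , _) , _} {d' , (g' , _) , _} {_ , (f' , _) , _} (refl , l) (refl , l') e →
      cong₂ _,_ (trans (F₂₇-digit d g f) (sym (F₂₇-digit d' g' f')))
        (cong₂ _,_ (cong proj₁ e) (Λ.differences l l' (cong proj₂ e))) }
  ; code = Co.code'
  ; encodes = Co.encodes'
  }
  where
  module Λ = Level Λ
  module E = Extend Λ.system Λ.lin linB τ τ⁻¹ τ-τ⁻¹ τ-inj ω separating
  module Co = E.Codes Λ.rest Λ.differences Λ.code Λ.encodes

V H C L K : ℕ → Set
V zero = ⊤
V (suc t) = Fin 3 × B × V t
H zero = ⊥
H (suc t) = ((B × V t) × (B × V t)) ⊎ (Fin 3 × H t × B × B)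
C zero = ⊥
C (suc t) = (B × V t) ⊎ (B × C t)
L zero = ⊤
L (suc t) = B × L t
K zero = ⊥
K (suc t) = (Fin 3 × B × L t) ⊎ (B × K t)

level : ∀ t → Level (V t) (H t) (C t) (L t) (K t)
level zero = record
  { system = record
    { xv = λ () ; yv = λ () ; col = λ ()
    ; Leave = λ _ _ → ⊤
    ; find = λ _ _ → inj₂ tt
    ; Edge⇒¬Leave = λ { {()} }
    ; xv-inj = λ ()
    ; yv-inj = λ ()
    ; X-disjoint = λ { {()} }
    ; Y-disjoint = λ { {()} }
    ; XX-unique = λ { {()} }
    ; YY-unique = λ { {()} }
    ; edge-unique = λ { {()} }
    ; no-alternation = λ { {()} }
    }
  ; lin = record
    { group = record
      { _⊕_ = λ _ _ → tt ; ε = tt ; ⊖_ = λ _ → tt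
      ; ⊕-assoc = λ _ _ _ → refl ; ⊕-comm = λ _ _ → refl
      ; ⊕-identityˡ = λ _ → refl ; ⊕-inverseˡ = λ _ → refl }
    ; lam = λ _ _ → tt ; sol = λ _ _ _ → tt
    ; S-sol = λ _ _ → refl ; S-inj = λ _ _ → refl ; D-inj = λ _ _ → refl ; T-inj = λ _ _ _ → refl
    }
  ; rest = λ _ → tt
  ; differences = λ _ _ _ → refl
  ; code = λ ()
  ; encodes = λ { {h₁ = ()} }
  }
level (suc t) = extend (level t)

open import Data.Nat using (_+_; _*_; _^_; _∸_)
open import Data.Nat.DivMod using (_/_; _%_; m≡m%n+[m/n]*n; m%n<n; m/n*n≤m)
open import Data.Nat.Tactic.RingSolver using (solve-∀)

-- Counting by codes

record Selection {m} (f : Fin m → Bool) (N : ℕ) : Set where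
  field
    select : Fin N → Fin m
    selected : ∀ i → f (select i) ≡ true
    select-inj : ∀ {i j} → select i ≡ select j → i ≡ j
    select-onto : ∀ j → f j ≡ true → ∃ λ i → select i ≡ j

selection : ∀ {m} (f : Fin m → Bool) → Selection f (count f)
selection {zero} f = record { select = λ () ; selected = λ () ; select-inj = λ { {()} } ; select-onto = λ () }
selection {suc m} f with f zero in eq | selection (λ i → f (suc i))
... | true | r = record
  { select = select'
  ; selected = λ { zero → eq ; (suc i) → selected i }
  ; select-inj = λ { {zero} {zero} e → refl ; {suc i} {suc j} e → cong suc (select-inj (Fin.suc-injective e)) }
  ; select-onto = λ { zero _ → zero , refl ; (suc j) t → suc (proj₁ (select-onto j t)) , cong suc (proj₂ (select-onto j t)) }
  }
  where
  open Selection r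
  select' : Fin (suc (count (λ i → f (suc i)))) → Fin (suc m)
  select' zero = zero
  select' (suc i) = suc (select i)
... | false | r = record
  { select = λ i → suc (select i)
  ; selected = selected
  ; select-inj = λ e → select-inj (Fin.suc-injective e)
  ; select-onto = λ { zero t → contradiction (trans (sym eq) t) λ () ; (suc j) t → proj₁ (select-onto j t) , cong suc (proj₂ (select-onto j t)) }
  }
  where open Selection r

record PairSelection {m k} (f : Fin m → Fin k → Bool) : Set where
  field
    select : Fin (sumF λ i → count (f i)) → Fin m × Fin k
    selected : ∀ i → f (proj₁ (select i)) (proj₂ (select i)) ≡ true
    select-inj : ∀ {i j} → select i ≡ select j → i ≡ j

pair-selection : ∀ {m k} (f : Fin m → Fin k → Bool) → PairSelection f
pair-selection {zero} f = record { select = λ () ; selected = λ () ; select-inj = λ { {()} } }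
pair-selection {suc m} {k} f = record
  { select = λ i → pick (splitAt a i)
  ; selected = λ i → picked (splitAt a i)
  ; select-inj = λ {i} {j} e → trans (sym (Fin.join-splitAt a _ i)) (trans (cong (Fin.join a _) (pick-inj (splitAt a i) (splitAt a j) e)) (Fin.join-splitAt a _ j))
  }
  where
  a = count (f zero)
  module Head = Selection (selection (f zero))
  module Tail = PairSelection (pair-selection (λ i → f (suc i)))

  pick : Fin a ⊎ Fin _ → Fin (suc m) × Fin k
  pick (inj₁ i) = zero , Head.select i
  pick (inj₂ i) = map₁ suc (Tail.select i)

  picked : ∀ i → f (proj₁ (pick i)) (proj₂ (pick i)) ≡ true
  picked (inj₁ i) = Head.selected i
  picked (inj₂ i) = Tail.selected i

  pick-inj : ∀ i j → pick i ≡ pick j → i ≡ j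
  pick-inj (inj₁ i) (inj₁ j) e = cong inj₁ (Head.select-inj (cong proj₂ e))
  pick-inj (inj₂ i) (inj₂ j) e = cong inj₂ (Tail.select-inj (cong₂ _,_ (Fin.suc-injective (cong proj₁ e)) (cong proj₂ e)))

-- A relation rather than a function, because codes refer to hexagons of which only existence is
-- known. An element may have several codes, but no code belongs to two elements, and this bounds
-- the count.
record Coded {I : Set} (P : I → Set) (N : ℕ) : Set₁ where
  field
    Code : Set
    HasCode : I → Code → Set
    hasCode : ∀ i → P i → ∃ λ c → HasCode i c
    code-determines : ∀ {i j c} → HasCode i c → HasCode j c → i ≡ j
    enumerate : Code ↔ Fin N

coded-bound : ∀ {I : Set} {P : I → Set} {N M} → Coded P N → (s : Fin M → I) →
  (∀ {i j} → s i ≡ s j → i ≡ j) → (∀ i → P (s i)) → M ≤ N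
coded-bound {N = N} {M} X s s-inj Ps = Fin.injective⇒≤ {f = g} λ {i} {j} e → s-inj
  (code-determines (proj₂ (hasCode (s i) (Ps i)))
    (subst (HasCode (s j)) (sym (trans (sym (strictlyInverseʳ _)) (trans (cong from e) (strictlyInverseʳ _)))) (proj₂ (hasCode (s j) (Ps j)))))
  where
  open Coded X
  open Inverse enumerate
  g : Fin M → Fin N
  g i = to (proj₁ (hasCode (s i) (Ps i)))

count-bound : ∀ {m N} {f : Fin m → Bool} → Coded (λ i → f i ≡ true) N → count f ≤ N
count-bound {f = f} X = coded-bound X select select-inj selected
  where open Selection (selection f)

pair-count-bound : ∀ {m k N} {f : Fin m → Fin k → Bool} →
  Coded {Fin m × Fin k} (λ (i , j) → f i j ≡ true) N → sumF (λ i → count (f i)) ≤ N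
pair-count-bound {f = f} X = coded-bound X select select-inj selected
  where open PairSelection (pair-selection f)

-- Restriction to an initial segment of the vertices and colours

↔-injective : ∀ {A B : Set} (e : A ↔ B) → ∀ {x y} → Inverse.to e x ≡ Inverse.to e y → x ≡ y
↔-injective e {x} {y} p = trans (sym (strictlyInverseʳ x)) (trans (cong from p) (strictlyInverseʳ y))
  where open Inverse e

module Truncate {V H C : Set} (Sys : System V H C) {M N Q : ℕ} (eV : V ↔ Fin M) (eH : H ↔ Fin N) (eC : C ↔ Fin Q)
  {n k : ℕ} (n≤M : n ≤ M) (default : Fin k) where
  open System Sys
  open Cherries Sys
  module eV = Inverse eV
  module eH = Inverse eH
  module eC = Inverse eC

  index : V → ℕ
  index v = toℕ (eV.to v)

  colour : H → ℕ
  colour h = toℕ (eC.to (col h))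

  abstract
    vertex : Fin n → V
    vertex x = eV.from (inject≤ x n≤M)

    index-vertex : ∀ x → index (vertex x) ≡ toℕ x
    index-vertex x = trans (cong toℕ (eV.strictlyInverseˡ _)) (toℕ-inject≤ x n≤M)

  index-inj : ∀ {u v} → index u ≡ index v → u ≡ v
  index-inj e = ↔-injective eV (toℕ-injective e)

  vertex-inj : ∀ {x y} → vertex x ≡ vertex y → x ≡ y
  vertex-inj {x} {y} e = toℕ-injective (trans (sym (index-vertex x)) (trans (cong index e) (index-vertex y)))

  index-vertex< : ∀ x → index (vertex x) < n
  index-vertex< x = subst (_< n) (sym (index-vertex x)) (toℕ<n x)

  abstract
    restrict : ∀ v → index v < n → Fin n
    restrict v i<n = fromℕ< i<n

    vertex-restrict : ∀ v i<n → vertex (restrict v i<n) ≡ v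
    vertex-restrict v i<n = index-inj (trans (index-vertex _) (toℕ-fromℕ< i<n))

  restrict-inj : ∀ {u v i<n j<n} → restrict u i<n ≡ restrict v j<n → u ≡ v
  restrict-inj {u} {v} {i<n} {j<n} e = trans (sym (vertex-restrict u i<n)) (trans (cong vertex e) (vertex-restrict v j<n))

  colour-inj : ∀ {h h'} → colour h ≡ colour h' → col h ≡ col h'
  colour-inj e = ↔-injective eC (toℕ-injective e)

  Kept : H → Set
  Kept h = (∀ p → index (xv h p) < n) × (∀ q → index (yv h q) < n) × colour h < k

  kept? : ∀ h → Dec (Kept h)
  kept? h = all? (λ p → index (xv h p) <? n) ×-dec (all? (λ q → index (yv h q) <? n) ×-dec (colour h <? k))

  Covered : V → V → Set
  Covered u v = Σ H λ h → Edge h u v × Kept h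

  abstract
    -- An edge lies in at most one hexagon, so testing the one returned by `find` decides the
    -- matter.
    covered? : ∀ u v → Dec (Covered u v)
    covered? u v with find u v
    ... | inj₂ l = no λ (h , e , _) → Edge⇒¬Leave e l
    ... | inj₁ (h , e) with kept? h
    ... | yes κ = yes (h , e , κ)
    ... | no ¬κ = no λ (h' , e' , κ') → ¬κ (subst Kept (edge-unique e' e) κ')

    F : BipGraph n
    F x y = ⌊ covered? (vertex x) (vertex y) ⌋

    colouring : Fin n → Fin n → Fin k
    colouring x y with covered? (vertex x) (vertex y)
    ... | yes (h , _ , _ , _ , c<k) = fromℕ< c<k
    -- Pairs outside `F` get an arbitrary colour; all the properties look only at colours of edges
    -- of `F`.
    ... | no _ = default

  HasColour : Fin n → Fin n → ℕ → Set
  HasColour x y c = F x y ≡ true × toℕ (colouring x y) ≡ c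

  abstract
    hasColour : ∀ {h x y} → Edge h (vertex x) (vertex y) → Kept h → HasColour x y (colour h)
    hasColour {h} {x} {y} e κ with covered? (vertex x) (vertex y)
    ... | yes (h' , e' , _ , _ , c<k) = refl , trans (toℕ-fromℕ< c<k) (cong colour (edge-unique e' e))
    ... | no ¬c = contradiction (h , e , κ) ¬c

    F-hexagon : ∀ {x y} → F x y ≡ true → Σ H λ h → Edge h (vertex x) (vertex y) × Kept h × toℕ (colouring x y) ≡ colour h
    F-hexagon {x} {y} _ with covered? (vertex x) (vertex y)
    ... | yes (h , e , κ@(_ , _ , c<k)) = h , e , κ , toℕ-fromℕ< c<k
    F-hexagon {x} {y} () | no _

    uncovered : ∀ {x y} → F x y ≡ false → ¬ Covered (vertex x) (vertex y)
    uncovered {x} {y} _ with covered? (vertex x) (vertex y)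
    uncovered {x} {y} () | yes _
    ... | no ¬c = ¬c

  same-colour : ∀ {x y x' y' h h'} → colouring x y ≡ colouring x' y' → toℕ (colouring x y) ≡ colour h →
    toℕ (colouring x' y') ≡ colour h' → col h ≡ col h'
  same-colour e c c' = colour-inj (trans (sym c) (trans (cong toℕ e) c'))

  -- The hexagon x₀ y₀ x₁ y₁ x₂ y₂ of Defs omits the pairs (xⱼ₊₂ , yⱼ), whereas here (x_p , y_p) is omitted.
  opposite : Fin 3 → Fin 3
  opposite j = next3 (next3 j)

  opposite≢ : ∀ j → j ≢ opposite j × next3 j ≢ opposite j
  opposite≢ 0F = (λ ()) , (λ ())
  opposite≢ 1F = (λ ()) , (λ ())
  opposite≢ 2F = (λ ()) , (λ ())

  opposite-onto : ∀ p q → p ≢ q → ∃ λ j → (j ≡ p ⊎ next3 j ≡ p) × opposite j ≡ q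
  opposite-onto 0F 0F p≢q = contradiction refl p≢q
  opposite-onto 0F 1F _ = 2F , inj₂ refl , refl
  opposite-onto 0F 2F _ = 0F , inj₁ refl , refl
  opposite-onto 1F 0F _ = 1F , inj₁ refl , refl
  opposite-onto 1F 1F p≢q = contradiction refl p≢q
  opposite-onto 1F 2F _ = 0F , inj₂ refl , refl
  opposite-onto 2F 0F _ = 1F , inj₂ refl , refl
  opposite-onto 2F 1F _ = 2F , inj₁ refl , refl
  opposite-onto 2F 2F p≢q = contradiction refl p≢q

  next3-opposite : ∀ j → next3 (opposite j) ≡ j
  next3-opposite 0F = refl
  next3-opposite 1F = refl
  next3-opposite 2F = refl

  opposite-inj : ∀ {i j} → opposite i ≡ opposite j → i ≡ j
  opposite-inj {i} {j} e = trans (sym (next3-opposite i)) (trans (cong next3 e) (next3-opposite j))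

  hex : ∀ h → Kept h → Hex n
  hex h (X<n , Y<n , _) = record
    { xs = λ p → restrict (xv h p) (X<n p)
    ; ys = λ j → restrict (yv h (opposite j)) (Y<n (opposite j))
    ; xs-inj = λ {i} {j} e → xv-inj h {i} {j} (restrict-inj e)
    ; ys-inj = λ e → opposite-inj (yv-inj h (restrict-inj e))
    }

  hexEdge⇒Edge : ∀ {h κ x y} → HexEdge (hex h κ) x y → Edge h (vertex x) (vertex y)
  hexEdge⇒Edge {h} (j , inj₁ (refl , refl)) =
    j , opposite j , proj₁ (opposite≢ j) , sym (vertex-restrict _ _) , sym (vertex-restrict _ _)
  hexEdge⇒Edge {h} (j , inj₂ (refl , refl)) =
    next3 j , opposite j , proj₂ (opposite≢ j) , sym (vertex-restrict _ _) , sym (vertex-restrict _ _)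

  Edge⇒hexEdge : ∀ {h x y} κ → Edge h (vertex x) (vertex y) → HexEdge (hex h κ) x y
  Edge⇒hexEdge κ (p , q , p≢q , ex , ey) with opposite-onto p q p≢q
  ... | j , inj₁ refl , refl = j , inj₁ (vertex-inj (trans (vertex-restrict _ _) ex) , vertex-inj (trans (vertex-restrict _ _) ey))
  ... | j , inj₂ refl , refl = j , inj₂ (vertex-inj (trans (vertex-restrict _ _) ex) , vertex-inj (trans (vertex-restrict _ _) ey))

  classes : ∀ c → ClassIsC6Union F colouring c
  classes c = count inClass , cyc , disjoint , λ x y → (λ (f , e) → complete f e) , (λ (i , e) → sound i e)
    where
    inClass? : ∀ i → Dec (Kept (eH.from i) × colour (eH.from i) ≡ toℕ c)
    inClass? i = kept? (eH.from i) ×-dec (colour (eH.from i) ℕ.≟ toℕ c)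

    inClass : Fin N → Bool
    inClass i = ⌊ inClass? i ⌋

    open Selection (selection inClass)

    true⇒ : ∀ {A : Set} (A? : Dec A) → ⌊ A? ⌋ ≡ true → A
    true⇒ (yes a) _ = a

    ⇒true : ∀ {A : Set} (A? : Dec A) → A → ⌊ A? ⌋ ≡ true
    ⇒true (yes _) _ = refl
    ⇒true (no ¬a) a = contradiction a ¬a

    hexagon : Fin (count inClass) → H
    hexagon i = eH.from (select i)

    property : ∀ i → Kept (hexagon i) × colour (hexagon i) ≡ toℕ c
    property i = true⇒ (inClass? (select i)) (selected i)

    cyc : Fin (count inClass) → Hex n
    cyc i = hex (hexagon i) (proj₁ (property i))

    hexagon-inj : ∀ {i j} → hexagon i ≡ hexagon j → i ≡ j
    hexagon-inj {i} {j} e = select-inj (trans (sym (eH.strictlyInverseˡ _)) (trans (cong eH.to e) (eH.strictlyInverseˡ _)))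

    same : ∀ i j → col (hexagon i) ≡ col (hexagon j)
    same i j = colour-inj (trans (proj₂ (property i)) (sym (proj₂ (property j))))

    disjoint : ∀ i i' → i ≢ i' → Disjoint (cyc i) (cyc i')
    disjoint i i' i≢i' j l =
        (λ e → i≢i' (hexagon-inj (X-disjoint (same i i') (restrict-inj e))))
      , (λ e → i≢i' (hexagon-inj (Y-disjoint (same i i') (restrict-inj e))))

    complete : ∀ {x y} → F x y ≡ true → colouring x y ≡ c → ∃ λ i → HexEdge (cyc i) x y
    complete {x} {y} f e = proj₁ i , Edge⇒hexEdge (proj₁ (property (proj₁ i))) (subst (λ h' → Edge h' (vertex x) (vertex y))
        (trans (sym (eH.strictlyInverseʳ h)) (cong eH.from (sym (proj₂ i)))) (proj₁ (proj₂ found)))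
      where
      found = F-hexagon {x} {y} f
      h = proj₁ found
      i : ∃ λ i → select i ≡ eH.to h
      i = select-onto (eH.to h) (⇒true (inClass? (eH.to h))
        (subst (λ h' → Kept h' × colour h' ≡ toℕ c) (sym (eH.strictlyInverseʳ h))
          (proj₁ (proj₂ (proj₂ found)) , trans (sym (proj₂ (proj₂ (proj₂ found)))) (cong toℕ e))))

    sound : ∀ {x y} i → HexEdge (cyc i) x y → F x y ≡ true × colouring x y ≡ c
    sound {x} {y} i e = proj₁ coloured , toℕ-injective (trans (proj₂ coloured) (proj₂ (property i)))
      where
      coloured : HasColour x y (colour (hexagon i))
      coloured = hasColour {hexagon i} {x} {y} (hexEdge⇒Edge {κ = proj₁ (property i)} e) (proj₁ (property i))

  private
    ind-≡ : ∀ {c d : Fin k} → c ≡ d → ind ⌊ c ≟ d ⌋ ≡ 1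
    ind-≡ {c} {d} e with c ≟ d
    ... | yes _ = refl
    ... | no c≢d = contradiction e c≢d

    ind-≢ : ∀ {c d : Fin k} → c ≢ d → ind ⌊ c ≟ d ⌋ ≡ 0
    ind-≢ {c} {d} c≢d with c ≟ d
    ... | yes e = contradiction e c≢d
    ... | no _ = refl

    odd : ∀ {i j l m i' j' l' m'} → i ≡ i' → j ≡ j' → l ≡ l' → m ≡ m' →
      Odd (i' ℕ.+ j' ℕ.+ l' ℕ.+ m') → Odd (i ℕ.+ j ℕ.+ l ℕ.+ m)
    odd refl refl refl refl o = o

    -- If every colour occurred an even number of times, the four colours would fall into two equal
    -- pairs, in one of the three ways excluded by the hypotheses.
    odd-colour : ∀ (a b c d : Fin k) → ¬ (a ≡ b × c ≡ d) → ¬ (a ≡ c × b ≡ d) → ¬ (a ≡ d × b ≡ c) →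
      ∃ λ e → Odd (ind ⌊ a ≟ e ⌋ ℕ.+ ind ⌊ b ≟ e ⌋ ℕ.+ ind ⌊ c ≟ e ⌋ ℕ.+ ind ⌊ d ≟ e ⌋)
    odd-colour a b c d ab ac ad with a ≟ b | a ≟ c | a ≟ d
    ... | yes refl | yes refl | _ = a , odd (ind-≡ {a} refl) (ind-≡ {a} refl) (ind-≡ {a} refl) (ind-≢ (λ e → ab (refl , sym e))) refl
    ... | yes refl | no a≢c | yes refl = a , odd (ind-≡ {a} refl) (ind-≡ {a} refl) (ind-≢ (a≢c ∘ sym)) (ind-≡ {a} refl) refl
    ... | yes refl | no a≢c | no a≢d = c , odd (ind-≢ a≢c) (ind-≢ a≢c) (ind-≡ {c} refl) (ind-≢ (λ e → ab (refl , sym e))) refl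
    ... | no a≢b | yes refl | yes refl = b , odd (ind-≢ a≢b) (ind-≡ {b} refl) (ind-≢ a≢b) (ind-≢ a≢b) refl
    ... | no a≢b | yes refl | no a≢d = b , odd (ind-≢ a≢b) (ind-≡ {b} refl) (ind-≢ a≢b) (ind-≢ (λ e → ac (refl , sym e))) refl
    ... | no a≢b | no a≢c | yes refl = b , odd (ind-≢ a≢b) (ind-≡ {b} refl) (ind-≢ (λ e → ad (refl , sym e))) (ind-≢ a≢b) refl
    ... | no a≢b | no a≢c | no a≢d = a , odd (ind-≡ {a} refl) (ind-≢ (a≢b ∘ sym)) (ind-≢ (a≢c ∘ sym)) (ind-≢ (a≢d ∘ sym)) refl

  C4-odd : C4Odd F colouring
  C4-odd x₁ x₂ y₁ y₂ x₁≢x₂ y₁≢y₂ f₁₁ f₁₂ f₂₁ f₂₂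
    with F-hexagon {x₁} {y₁} f₁₁ | F-hexagon {x₁} {y₂} f₁₂ | F-hexagon {x₂} {y₁} f₂₁ | F-hexagon {x₂} {y₂} f₂₂
  ... | h₁₁ , e₁₁@(p₁₁ , q₁₁ , n₁₁ , ex₁₁ , ey₁₁) , _ , c₁₁ | h₁₂ , e₁₂@(p₁₂ , q₁₂ , n₁₂ , ex₁₂ , ey₁₂) , _ , c₁₂
      | h₂₁ , e₂₁@(p₂₁ , q₂₁ , n₂₁ , ex₂₁ , ey₂₁) , _ , c₂₁ | h₂₂ , e₂₂@(p₂₂ , q₂₂ , n₂₂ , ex₂₂ , ey₂₂) , _ , c₂₂ =
    -- In the first two pairings equally coloured edges meet in a vertex, hence lie on one hexagon;
    -- the third pairs opposite edges.
    odd-colour _ _ _ _ Y-cherries X-cherries alternation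
    where
    u≢ : vertex x₁ ≢ vertex x₂
    u≢ e = x₁≢x₂ (vertex-inj e)
    v≢ : vertex y₁ ≢ vertex y₂
    v≢ e = y₁≢y₂ (vertex-inj e)

    Y-cherries : ¬ (colouring x₁ y₁ ≡ colouring x₁ y₂ × colouring x₂ y₁ ≡ colouring x₂ y₂)
    Y-cherries (e , e')
      with X-disjoint (same-colour {x₁} {y₁} {x₁} {y₂} e c₁₁ c₁₂) (trans ex₁₁ (sym ex₁₂))
         | X-disjoint (same-colour {x₂} {y₁} {x₂} {y₂} e' c₂₁ c₂₂) (trans ex₂₁ (sym ex₂₂))
    ... | refl | refl = [ u≢ , v≢ ]′ (Y-cherry e₁₁ e₁₂ e₂₁ e₂₂)

    X-cherries : ¬ (colouring x₁ y₁ ≡ colouring x₂ y₁ × colouring x₁ y₂ ≡ colouring x₂ y₂)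
    X-cherries (e , e')
      with Y-disjoint (same-colour {x₁} {y₁} {x₂} {y₁} e c₁₁ c₂₁) (trans ey₁₁ (sym ey₂₁))
         | Y-disjoint (same-colour {x₁} {y₂} {x₂} {y₂} e' c₁₂ c₂₂) (trans ey₁₂ (sym ey₂₂))
    ... | refl | refl = [ u≢ , v≢ ]′ (X-cherry e₁₁ e₂₁ e₁₂ e₂₂)

    alternation : ¬ (colouring x₁ y₁ ≡ colouring x₂ y₂ × colouring x₁ y₂ ≡ colouring x₂ y₁)
    alternation (e , e') = [ u≢ , v≢ ]′ (no-alternation (same-colour {x₁} {y₁} {x₂} {y₂} e c₁₁ c₂₂)
      (same-colour {x₁} {y₂} {x₂} {y₁} e' c₁₂ c₂₁) e₁₁ e₂₂ e₁₂ e₂₁)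

infixr 4 _⊎-enum_
infixr 5 _×-enum_
_×-enum_ : ∀ {A B : Set} {a b} → A ↔ Fin a → B ↔ Fin b → (A × B) ↔ Fin (a * b)
e ×-enum f = ↔-trans (e ×-↔ f) (↔-sym *↔×)

_⊎-enum_ : ∀ {A B : Set} {a b} → A ↔ Fin a → B ↔ Fin b → (A ⊎ B) ↔ Fin (a + b)
e ⊎-enum f = ↔-trans (e ⊎-↔ f) (↔-sym +↔⊎)

-- The ℤ/m-coordinate is the leading one in the enumeration, so an initial segment of length at
-- least σ g contains the first σ layers completely.
combine-late : ∀ {m g σ} (i : Fin m) (j : Fin g) → σ * g ≤ toℕ (combine i j) → σ ≤ toℕ i
combine-late {m} {g} {σ} i j le = ℕ.≤-pred (ℕ.*-cancelʳ-< g σ (suc (toℕ i)) (begin-strict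
  σ * g                ≤⟨ le ⟩
  toℕ (combine i j)    ≡⟨ toℕ-combine i j ⟩
  g * toℕ i + toℕ j    <⟨ ℕ.+-monoʳ-< (g * toℕ i) (toℕ<n j) ⟩
  g * toℕ i + g        ≡⟨ ℕ.+-comm (g * toℕ i) g ⟩
  g + g * toℕ i        ≡⟨ cong (g +_) (ℕ.*-comm g (toℕ i)) ⟩
  suc (toℕ i) * g      ∎))
  where open ℕ.≤-Reasoning

probe-enum : Probe ↔ Fin 7
probe-enum = ↔-refl ⊎-enum ↔-refl ⊎-enum ↔-sym 1↔⊤

-- Counting uncovered edges and the pairs in (4)

module Bounds {V H C L K : Set} (Λ : Level V H C L K) {m : ℕ} (LA : Lin (Fin m)) (spread : Spread LA)
  {g h c l e : ℕ} (eV : V ↔ Fin g) (eH : H ↔ Fin h) (eC : C ↔ Fin c) (eL : L ↔ Fin l) (eK : K ↔ Fin e)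
  {n k σ ρ : ℕ} (n≤M : n ≤ m * g) (m≡σ+ρ : m ≡ σ + ρ) (σg≤n : σ * g ≤ n) (σc≤k : σ * c ≤ k) (default : Fin k)
  where
  private
    module Λ = Level Λ
    module S = System Λ.system
    module V = Blocks Λ.lin
  open Blocks LA using (X; Y; XX-determines; YY-determines; XY-determines; X-base; Y-base; X-Y; edge-sum; ⊕-cancelˡ)
  open Spread spread
  open System (Λ.system ⊗ LA)
  open Truncate (Λ.system ⊗ LA) (↔-refl ×-enum eV) (eH ×-enum ↔-refl ×-enum ↔-refl) (↔-refl ×-enum eC) n≤M default public

  private
    Hexagon : Set
    Hexagon = H × Fin m × Fin m

    Late : Fin m → Fin ρ → Set
    Late a r = toℕ a ≡ σ + toℕ r

    late : ∀ a → σ ≤ toℕ a → ∃ (Late a)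
    late a σ≤a = fromℕ< lt , trans (sym (ℕ.m+[n∸m]≡n σ≤a)) (cong (σ +_) (sym (toℕ-fromℕ< lt)))
      where
      lt : toℕ a ∸ σ < ρ
      lt = ℕ.+-cancelˡ-< σ (toℕ a ∸ σ) ρ (subst₂ _<_ (sym (ℕ.m+[n∸m]≡n σ≤a)) m≡σ+ρ (toℕ<n a))

    late-inj : ∀ {a b r} → Late a r → Late b r → a ≡ b
    late-inj u v = toℕ-injective (trans u (sym v))

    Fails : Probe → Hexagon → Set
    Fails (inj₁ j) h = ¬ index (xv h j) < n
    Fails (inj₂ (inj₁ j)) h = ¬ index (yv h j) < n
    Fails (inj₂ (inj₂ _)) h = ¬ colour h < k

    -- The late value helps to identify the hexagon. The failure itself is kept as well: in the
    -- degree bounds it shows that the vertex outside the segment is not the given one.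
    Lost : Probe → Fin ρ → Hexagon → Set
    Lost π r hx@(_ , s , κ) = Fails π hx × Late (probe LA π s κ) r

    fails⇒late : ∀ π hx → Fails π hx → ∃ λ r → Lost π r hx
    fails⇒late (inj₁ j) (h , s , κ) f with late (X j s κ) (combine-late (X j s κ) _ (ℕ.≤-trans σg≤n (ℕ.≮⇒≥ f)))
    ... | r , lr = r , f , lr
    fails⇒late (inj₂ (inj₁ j)) (h , s , κ) f with late (Y j s κ) (combine-late (Y j s κ) _ (ℕ.≤-trans σg≤n (ℕ.≮⇒≥ f)))
    ... | r , lr = r , f , lr
    fails⇒late (inj₂ (inj₂ _)) (h , s , κ) f with late κ (combine-late κ _ (ℕ.≤-trans σc≤k (ℕ.≮⇒≥ f)))
    ... | r , lr = r , f , lr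

    lost : ∀ hx → ¬ Kept hx → ∃ λ π → ∃ λ r → Lost π r hx
    lost hx ¬κ with all? (λ p → index (xv hx p) <? n)
    ... | no ¬X with ¬∀⟶∃¬ 3 _ (λ p → index (xv hx p) <? n) ¬X
    ... | j , f = inj₁ j , fails⇒late (inj₁ j) hx f
    lost hx ¬κ | yes X<n with all? (λ q → index (yv hx q) <? n)
    ... | no ¬Y with ¬∀⟶∃¬ 3 _ (λ q → index (yv hx q) <? n) ¬Y
    ... | j , f = inj₂ (inj₁ j) , fails⇒late (inj₂ (inj₁ j)) hx f
    lost hx ¬κ | yes X<n | yes Y<n with colour hx <? k
    ... | no f = inj₂ (inj₂ tt) , fails⇒late (inj₂ (inj₂ tt)) hx f
    ... | yes c<k = contradiction (X<n , Y<n , c<k) ¬κ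

    lost-edge : ∀ {x y} → F x y ≡ false → ∀ {h} → Edge h (vertex x) (vertex y) → ∃ λ π → ∃ λ r → Lost π r h
    lost-edge {x} {y} f {h} edge = lost h (λ κ → uncovered {x} {y} f (h , edge , κ))

    -- The vertex outside the segment may be the one opposite to the given vertex on the hexagon.
    -- These two are not joined, so the positions agree and `S p p` has to be injective too.
    diagonal-determines : ∀ {p s s' κ κ'} → X p s κ ≡ X p s' κ' → Y p s κ ≡ Y p s' κ' → s ≡ s' × κ ≡ κ'
    diagonal-determines {p} {s} {s'} {κ} {κ'} e f
      with diagonal p (⊕-cancelˡ (Y p s κ) (trans (sym (X-Y p p s κ)) (trans e (edge-sum p p s' κ' refl (sym f)))))
    ... | refl = X-base p κ e , refl

  -- On a lost hexagon, the V-coordinates of x and y fix the hexagon below and both positions; then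
  -- x and the late value of the probe fix the block over ℤ/m. The remaining edges are uncovered
  -- already in `Λ`, and there `rest` locates the other end.
  degX-coded : ∀ x → Coded (λ y → not (F x y) ≡ true) (l * m + g * (7 * ρ))
  degX-coded x = record
    { Code = (L × Fin m) ⊎ (V × Probe × Fin ρ)
    ; HasCode = HasCode
    ; hasCode = hasCode
    ; code-determines = λ {_} {_} {c} → determined c
    ; enumerate = (eL ×-enum ↔-refl) ⊎-enum (eV ×-enum (probe-enum ×-enum ↔-refl))
    }
    where
    u = proj₂ (vertex x)

    HasCode : Fin n → (L × Fin m) ⊎ (V × Probe × Fin ρ) → Set
    HasCode y (inj₁ (r , b)) = S.Leave u (proj₂ (vertex y)) × Λ.rest (u V.⊕ V.⊖ proj₂ (vertex y)) ≡ r × proj₁ (vertex y) ≡ b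
    HasCode y (inj₂ (v , π , r)) = proj₂ (vertex y) ≡ v × Σ Hexagon λ h → Edge h (vertex x) (vertex y) × Lost π r h

    hasCode : ∀ y → not (F x y) ≡ true → ∃ (HasCode y)
    hasCode y f with find (vertex x) (vertex y)
    ... | inj₂ leave = inj₁ (_ , _) , leave , refl , refl
    ... | inj₁ (h , edge) = let π , r , lost = lost-edge {x} {y} (not-injective f) edge in
      inj₂ (_ , π , r) , refl , h , edge , lost

    base-determined : ∀ π {p s s' κ κ'} → (∀ {j} → π ≡ inj₁ j → p ≢ j) → X p s κ ≡ X p s' κ' →
      probe LA π s κ ≡ probe LA π s' κ' → s ≡ s' × κ ≡ κ'
    base-determined (inj₁ j) p≢j e f = XX-determines (p≢j refl) e f
    base-determined (inj₂ (inj₂ _)) {p} {κ = κ} _ e refl = X-base p κ e , refl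
    base-determined (inj₂ (inj₁ j)) {p} _ e f with p ≟ j
    ... | no p≢j = XY-determines p≢j e f
    ... | yes refl = diagonal-determines e f

    determined : ∀ c {y y'} → HasCode y c → HasCode y' c → y ≡ y'
    determined (inj₁ _) {y} {y'} (leave , refl , refl) (leave' , r≡ , b≡) =
      vertex-inj (cong₂ _,_ (sym b≡) (V.⊖-inj (V.⊕-cancelˡ u (Λ.differences leave leave' (sym r≡)))))
    determined (inj₂ (_ , π , r)) {y} {y'} (refl , (h , s , κ) , edge@(p , q , p≢q , ex , ey) , fail , lr)
      (v≡ , (h' , s' , κ') , edge'@(p' , q' , p'≢q' , ex' , ey') , fail' , lr')
      with S.edge-unique {h} {h'} (p , q , p≢q , cong proj₂ ex , cong proj₂ ey) (p' , q' , p'≢q' , cong proj₂ ex' , trans (cong proj₂ ey') v≡)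
    ... | refl with S.xv-inj h {p'} {p} (trans (cong proj₂ ex') (sym (cong proj₂ ex)))
                  | S.yv-inj h {q'} {q} (trans (cong proj₂ ey') (trans v≡ (sym (cong proj₂ ey))))
    ... | refl | refl with base-determined π {p} {s} {s'} {κ} {κ'}
          -- The vertex x lies inside the segment, so it is not the vertex that fails.
          (λ { {j} refl refl → fail (subst (_< n) (sym (cong index ex)) (index-vertex< x)) })
          (trans (cong proj₁ ex) (sym (cong proj₁ ex'))) (late-inj lr lr')
    ... | refl , refl = vertex-inj (trans (sym ey) ey')

  degY-coded : ∀ y → Coded (λ x → not (F x y) ≡ true) (l * m + g * (7 * ρ))
  degY-coded y = record
    { Code = (L × Fin m) ⊎ (V × Probe × Fin ρ)
    ; HasCode = HasCode
    ; hasCode = hasCode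
    ; code-determines = λ {_} {_} {c} → determined c
    ; enumerate = (eL ×-enum ↔-refl) ⊎-enum (eV ×-enum (probe-enum ×-enum ↔-refl))
    }
    where
    v = proj₂ (vertex y)

    HasCode : Fin n → (L × Fin m) ⊎ (V × Probe × Fin ρ) → Set
    HasCode x (inj₁ (r , a)) = S.Leave (proj₂ (vertex x)) v × Λ.rest (proj₂ (vertex x) V.⊕ V.⊖ v) ≡ r × proj₁ (vertex x) ≡ a
    HasCode x (inj₂ (u , π , r)) = proj₂ (vertex x) ≡ u × Σ Hexagon λ h → Edge h (vertex x) (vertex y) × Lost π r h

    hasCode : ∀ x → not (F x y) ≡ true → ∃ (HasCode x)
    hasCode x f with find (vertex x) (vertex y)
    ... | inj₂ leave = inj₁ (_ , _) , leave , refl , refl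
    ... | inj₁ (h , edge) = let π , r , lost = lost-edge {x} {y} (not-injective f) edge in
      inj₂ (_ , π , r) , refl , h , edge , lost

    base-determined : ∀ π {q s s' κ κ'} → (∀ {j} → π ≡ inj₂ (inj₁ j) → q ≢ j) → Y q s κ ≡ Y q s' κ' →
      probe LA π s κ ≡ probe LA π s' κ' → s ≡ s' × κ ≡ κ'
    base-determined (inj₂ (inj₁ j)) q≢j e f = YY-determines (q≢j refl) e f
    base-determined (inj₂ (inj₂ _)) {q} {κ = κ} _ e refl = Y-base q κ e , refl
    base-determined (inj₁ j) {q} _ e f with j ≟ q
    ... | no j≢q = XY-determines j≢q f e
    ... | yes refl = diagonal-determines f e

    determined : ∀ c {x x'} → HasCode x c → HasCode x' c → x ≡ x'
    determined (inj₁ _) {x} {x'} (leave , refl , refl) (leave' , r≡ , a≡) =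
      vertex-inj (cong₂ _,_ (sym a≡) (V.⊕-cancelʳ (V.⊖ v) (Λ.differences leave leave' (sym r≡))))
    determined (inj₂ (_ , π , r)) {x} {x'} (refl , (h , s , κ) , edge@(p , q , p≢q , ex , ey) , fail , lr)
      (u≡ , (h' , s' , κ') , edge'@(p' , q' , p'≢q' , ex' , ey') , fail' , lr')
      with S.edge-unique {h} {h'} (p , q , p≢q , cong proj₂ ex , cong proj₂ ey) (p' , q' , p'≢q' , trans (cong proj₂ ex') u≡ , cong proj₂ ey')
    ... | refl with S.xv-inj h {p'} {p} (trans (cong proj₂ ex') (trans u≡ (sym (cong proj₂ ex))))
                  | S.yv-inj h {q'} {q} (trans (cong proj₂ ey') (sym (cong proj₂ ey)))
    ... | refl | refl with base-determined π {q} {s} {s'} {κ} {κ'}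
          (λ { {j} refl refl → fail (subst (_< n) (sym (cong index ey)) (index-vertex< y)) })
          (trans (cong proj₁ ey) (sym (cong proj₁ ey'))) (late-inj lr lr')
    ... | refl , refl = vertex-inj (trans (sym ex) ex')

  bad : ∀ (x y x' y' : Fin n) → Bool
  bad x y x' y' = not ⌊ x' ≟ x ⌋ ∧ not ⌊ y' ≟ y ⌋ ∧ not (F x' y') ∧ F x y' ∧ F x' y ∧ ⌊ colouring x y' ≟ colouring x' y ⌋

  private
    ∧-true : ∀ {a b} → a ∧ b ≡ true → a ≡ true × b ≡ true
    ∧-true {true} e = refl , e

    ⌊⌋-true : ∀ {A : Set} (A? : Dec A) → ⌊ A? ⌋ ≡ true → A
    ⌊⌋-true (yes a) _ = a

  BadEdges : (x y x' y' : Fin n) → Hexagon → Hexagon → Set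
  BadEdges x y x' y' h₁ h₂ = Edge h₁ (vertex x) (vertex y') × Edge h₂ (vertex x') (vertex y) × col h₁ ≡ col h₂

  bad-edges : ∀ {x y x' y'} → bad x y x' y' ≡ true → F x' y' ≡ false × Σ Hexagon λ h₁ → Σ Hexagon λ h₂ → BadEdges x y x' y' h₁ h₂
  bad-edges {x} {y} {x'} {y'} b = not-injective (proj₁ t₃) , proj₁ h₁ , proj₁ h₂ , proj₁ (proj₂ h₁) , proj₁ (proj₂ h₂)
    , same-colour {x} {y'} {x'} {y} {proj₁ h₁} {proj₁ h₂} (⌊⌋-true (colouring x y' ≟ colouring x' y) (proj₂ t₅)) (proj₂ (proj₂ (proj₂ h₁))) (proj₂ (proj₂ (proj₂ h₂)))
    where
    t₃ = ∧-true {not (F x' y')} (proj₂ (∧-true {not ⌊ y' ≟ y ⌋} (proj₂ (∧-true {not ⌊ x' ≟ x ⌋} b))))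
    t₄ = ∧-true {F x y'} (proj₂ t₃)
    t₅ = ∧-true {F x' y} (proj₂ t₄)
    h₁ = F-hexagon {x} {y'} (proj₁ t₄)
    h₂ = F-hexagon {x'} {y} (proj₁ t₅)

  -- If x'y' is uncovered in `Λ`, its code there fixes all hexagons and positions below, and the
  -- ℤ/m-colour with x and y then fixes the blocks. Otherwise x'y' lies on a lost hexagon; the extra
  -- factor 3 is the position of y' on the hexagon through x.
  bad-coded : ∀ x y → Coded {Fin n × Fin n} (λ (x' , y') → bad x y x' y' ≡ true) (e * m + g * (3 * (7 * ρ)))
  bad-coded x y = record
    { Code = (K × Fin m) ⊎ (V × Fin 3 × Probe × Fin ρ)
    ; HasCode = HasCode
    ; hasCode = λ (x' , y') → hasCode x' y'
    ; code-determines = λ {_} {_} {c} → determined c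
    ; enumerate = (eK ×-enum ↔-refl) ⊎-enum (eV ×-enum (↔-refl ×-enum (probe-enum ×-enum ↔-refl)))
    }
    where
    u = proj₂ (vertex x)
    v = proj₂ (vertex y)

    HasCode : Fin n × Fin n → (K × Fin m) ⊎ (V × Fin 3 × Probe × Fin ρ) → Set
    HasCode (x' , y') (inj₁ (r , k)) = Σ Hexagon λ h₁ → Σ Hexagon λ h₂ → BadEdges x y x' y' h₁ h₂ ×
      S.Leave (proj₂ (vertex x')) (proj₂ (vertex y')) ×
      Λ.code (proj₁ h₁) (proj₂ (vertex x')) (proj₂ (vertex y')) ≡ r × proj₂ (proj₂ h₁) ≡ k
    HasCode (x' , y') (inj₂ (w , q , π , r)) = Σ Hexagon λ h₁ → Σ Hexagon λ h₂ → Σ Hexagon λ h₃ →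
      Σ (BadEdges x y x' y' h₁ h₂) λ ((_ , q₁ , _) , _) →
      proj₂ (vertex x') ≡ w × q₁ ≡ q × Edge h₃ (vertex x') (vertex y') × Lost π r h₃

    hasCode : ∀ x' y' → bad x y x' y' ≡ true → ∃ (HasCode (x' , y'))
    hasCode x' y' b = [ covered , leaving ]′ (find (vertex x') (vertex y'))
      where
      edges = bad-edges {x} {y} {x'} {y'} b
      h₁ = proj₁ (proj₂ edges)
      h₂ = proj₁ (proj₂ (proj₂ edges))
      w = proj₂ (vertex x')
      z = proj₂ (vertex y')
      leaving : S.Leave w z → ∃ (HasCode (x' , y'))
      leaving leave = inj₁ (Λ.code (proj₁ h₁) w z , proj₂ (proj₂ h₁)) , h₁ , h₂ , proj₂ (proj₂ (proj₂ edges)) , leave , refl , refl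
      covered : Σ Hexagon (λ h → Edge h (vertex x') (vertex y')) → ∃ (HasCode (x' , y'))
      covered (h₃ , edge) = let π , r , lost = lost-edge {x'} {y'} (proj₁ edges) {h₃} edge in
        inj₂ (w , proj₁ (proj₂ (proj₁ (proj₂ (proj₂ (proj₂ edges))))) , π , r) ,
        h₁ , h₂ , h₃ , proj₂ (proj₂ (proj₂ edges)) , refl , refl , edge , lost

    project : ∀ h s κ {x y} → Edge (h , s , κ) x y → S.Edge h (proj₂ x) (proj₂ y)
    project h s κ (p , q , p≢q , ex , ey) = p , q , p≢q , cong proj₂ ex , cong proj₂ ey

    positions : ∀ {h h' u v u' v'} (d : S.Edge h u v) (d' : S.Edge h' u' v') → h ≡ h' → u ≡ u' → v ≡ v' →
      proj₁ d ≡ proj₁ d' × proj₁ (proj₂ d) ≡ proj₁ (proj₂ d')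
    positions {h} (_ , _ , _ , refl , refl) (_ , _ , _ , ex , ey) refl u≡ v≡ =
      sym (S.xv-inj h (trans ex (sym u≡))) , sym (S.yv-inj h (trans ey (sym v≡)))

    same-ends : ∀ {x₁ y₁ x₂ y₂ h₁ h₂ k s₁ s₂ s₁' s₂' p₁ q₁ p₂ q₂} →
      xv (h₁ , s₁ , k) p₁ ≡ vertex x → yv (h₁ , s₁ , k) q₁ ≡ vertex y₁ →
      xv (h₂ , s₂ , k) p₂ ≡ vertex x₁ → yv (h₂ , s₂ , k) q₂ ≡ vertex y →
      xv (h₁ , s₁' , k) p₁ ≡ vertex x → yv (h₁ , s₁' , k) q₁ ≡ vertex y₂ →
      xv (h₂ , s₂' , k) p₂ ≡ vertex x₂ → yv (h₂ , s₂' , k) q₂ ≡ vertex y → (x₁ , y₁) ≡ (x₂ , y₂)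
    same-ends {k = k} {p₁ = p₁} {q₂ = q₂} ex₁ ey₁ ex₂ ey₂ ex₁' ey₁' ex₂' ey₂'
      with X-base p₁ k (trans (cong proj₁ ex₁) (sym (cong proj₁ ex₁')))
         | Y-base q₂ k (trans (cong proj₁ ey₂) (sym (cong proj₁ ey₂')))
    ... | refl | refl = cong₂ _,_ (vertex-inj (trans (sym ex₂) ex₂')) (vertex-inj (trans (sym ey₁) ey₁'))

    determined₁ : ∀ {z z'} c → HasCode z (inj₁ c) → HasCode z' (inj₁ c) → z ≡ z'
    determined₁ {x₁ , y₁} {x₂ , y₂} _
      ((h₁ , s₁ , k) , (h₂ , s₂ , k₂) , (e₁@(p₁ , q₁ , n₁ , ex₁ , ey₁) , e₂@(p₂ , q₂ , n₂ , ex₂ , ey₂) , c₁₂) , leave , refl , refl)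
      ((h₁' , s₁' , k') , (h₂' , s₂' , k₂') , (e₁'@(p₁' , q₁' , n₁' , ex₁' , ey₁') , e₂'@(p₂' , q₂' , n₂' , ex₂' , ey₂') , c₁₂') , leave' , r≡ , k≡) =
      finish k≡ (cong proj₁ c₁₂) (cong proj₁ c₁₂') h₁≡ h₂≡
        (proj₁ (positions d₁ d₁' h₁≡ refl (proj₂ wz))) (proj₂ (positions d₁ d₁' h₁≡ refl (proj₂ wz)))
        (proj₁ (positions d₂ d₂' h₂≡ (proj₁ wz) refl)) (proj₂ (positions d₂ d₂' h₂≡ (proj₁ wz) refl))
      where
      d₁ = project h₁ s₁ k e₁
      d₂ = project h₂ s₂ k₂ e₂
      d₁' = project h₁' s₁' k' e₁'
      d₂' = project h₂' s₂' k₂' e₂'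
      wz = Λ.encodes {h₁ = h₁} {h₂} {h₁'} {h₂'} d₁ d₂ (cong proj₂ c₁₂) leave d₁' d₂' (cong proj₂ c₁₂') leave' (sym r≡)
      h₁≡ : h₁ ≡ h₁'
      h₁≡ = S.edge-unique d₁ (subst (S.Edge h₁' u) (sym (proj₂ wz)) d₁')
      h₂≡ : h₂ ≡ h₂'
      h₂≡ = S.edge-unique d₂ (subst (λ t → S.Edge h₂' t v) (sym (proj₁ wz)) d₂')
      finish : k' ≡ k → k ≡ k₂ → k' ≡ k₂' → h₁ ≡ h₁' → h₂ ≡ h₂' → p₁ ≡ p₁' → q₁ ≡ q₁' → p₂ ≡ p₂' → q₂ ≡ q₂' →
        (x₁ , y₁) ≡ (x₂ , y₂)
      finish refl refl refl refl refl refl refl refl refl =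
        same-ends {h₁ = h₁} {h₂} {k} {s₁} {s₂} {s₁'} {s₂'} {p₁} {q₁} {p₂} {q₂} ex₁ ey₁ ex₂ ey₂ ex₁' ey₁' ex₂' ey₂'

    -- The V-coordinate of x' determines h₂, the colour of h₂ together with x determines h₁, and the
    -- recorded position on h₁ gives the V-coordinate of y', hence h₃. All positions now agree, and
    -- `traced` recovers the ℤ/m-colour from the late value.
    determined₂ : ∀ {z z'} c → HasCode z (inj₂ c) → HasCode z' (inj₂ c) → z ≡ z'
    determined₂ {x₁ , y₁} {x₂ , y₂} (_ , _ , π , r)
      ((h₁ , s₁ , k) , (h₂ , s₂ , k₂) , (h₃ , s₃ , κ) ,
        (e₁@(p₁ , q₁ , n₁ , ex₁ , ey₁) , e₂@(p₂ , q₂ , n₂ , ex₂ , ey₂) , c₁₂) , refl , refl ,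
        e₃@(p₃ , q₃ , n₃ , ex₃ , ey₃) , _ , late₃)
      ((h₁' , s₁' , k') , (h₂' , s₂' , k₂') , (h₃' , s₃' , κ') ,
        (e₁'@(p₁' , q₁' , n₁' , ex₁' , ey₁') , e₂'@(p₂' , q₂' , n₂' , ex₂' , ey₂') , c₁₂') , w≡ , q≡ ,
        e₃'@(p₃' , q₃' , n₃' , ex₃' , ey₃') , _ , late₃') =
      finish (cong proj₁ c₁₂) (cong proj₁ c₁₂') h₁≡ h₂≡ h₃≡ p₁≡ (sym q≡)
        (proj₁ p₂q₂) (proj₂ p₂q₂) (proj₁ p₃q₃) (proj₂ p₃q₃)
      where
      d₂ = project h₂ s₂ k₂ e₂
      d₂' = project h₂' s₂' k₂' e₂'
      d₃ = project h₃ s₃ κ e₃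
      d₃' = project h₃' s₃' κ' e₃'
      h₂≡ : h₂ ≡ h₂'
      h₂≡ = S.edge-unique d₂ (subst (λ t → S.Edge h₂' t v) w≡ d₂')
      p₂q₂ = positions d₂ d₂' h₂≡ (sym w≡) refl
      h₁≡ : h₁ ≡ h₁'
      h₁≡ = S.X-disjoint (trans (cong proj₂ c₁₂) (trans (cong S.col h₂≡) (sym (cong proj₂ c₁₂'))))
        (trans (cong proj₂ ex₁) (sym (cong proj₂ ex₁')))
      p₁≡ : p₁ ≡ p₁'
      p₁≡ = S.xv-inj h₁ (trans (cong proj₂ ex₁) (sym (trans (cong (λ h → S.xv h p₁') h₁≡) (cong proj₂ ex₁'))))
      z≡ : proj₂ (vertex y₁) ≡ proj₂ (vertex y₂)
      z≡ = trans (sym (cong proj₂ ey₁)) (trans (cong₂ S.yv h₁≡ (sym q≡)) (cong proj₂ ey₁'))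
      h₃≡ : h₃ ≡ h₃'
      h₃≡ = S.edge-unique d₃ (subst₂ (S.Edge h₃') w≡ (sym z≡) d₃')
      p₃q₃ = positions d₃ d₃' h₃≡ (sym w≡) z≡
      finish : k ≡ k₂ → k' ≡ k₂' → h₁ ≡ h₁' → h₂ ≡ h₂' → h₃ ≡ h₃' → p₁ ≡ p₁' → q₁ ≡ q₁' → p₂ ≡ p₂' → q₂ ≡ q₂' →
        p₃ ≡ p₃' → q₃ ≡ q₃' → (x₁ , y₁) ≡ (x₂ , y₂)
      finish refl refl refl refl refl refl refl refl refl refl refl = ends (traced π n₁ n₂ n₃
          (trans (cong proj₁ ex₁) (sym (cong proj₁ ex₁'))) (trans (cong proj₁ ey₂) (sym (cong proj₁ ey₂')))
          (trans (cong proj₁ ex₃) (sym (cong proj₁ ex₂))) (trans (cong proj₁ ex₃') (sym (cong proj₁ ex₂')))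
          (trans (cong proj₁ ey₃) (sym (cong proj₁ ey₁))) (trans (cong proj₁ ey₃') (sym (cong proj₁ ey₁')))
          (late-inj late₃ late₃'))
        where
        ends : k ≡ k' → (x₁ , y₁) ≡ (x₂ , y₂)
        ends refl = same-ends {h₁ = h₁} {h₂} {k} {s₁} {s₂} {s₁'} {s₂'} {p₁} {q₁} {p₂} {q₂} ex₁ ey₁ ex₂ ey₂ ex₁' ey₁' ex₂' ey₂'

    determined : ∀ c {z z'} → HasCode z c → HasCode z' c → z ≡ z'
    determined (inj₁ c) = determined₁ c
    determined (inj₂ c) = determined₂ c

-- Sizes and the choice of parameters

abstract
  b : ℕ
  b = (3 * 3) * (7 * (7 * 7))

  B-enum : B ↔ Fin b
  B-enum = (↔-refl ×-enum ↔-refl) ×-enum (↔-refl ×-enum (↔-refl ×-enum ↔-refl))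

  1≤b : 1 ≤ b
  1≤b = from-yes (1 ≤? b)

  -- Numerically 9261 ≤ 19683. The exponent 9 is the growth of |V| measured in powers of 3, and it
  -- leads to 36 = 4 · 9.
  3b≤3⁹ : 3 * b ≤ 3 ^ 9
  3b≤3⁹ = from-yes (3 * b ≤? 3 ^ 9)

∣V∣ ∣H∣ ∣C∣ ∣L∣ ∣K∣ : ℕ → ℕ
∣V∣ zero = 1
∣V∣ (suc t) = 3 * (b * ∣V∣ t)
∣H∣ zero = 0
∣H∣ (suc t) = (b * ∣V∣ t) * (b * ∣V∣ t) + 3 * (∣H∣ t * (b * b))
∣C∣ zero = 0
∣C∣ (suc t) = b * ∣V∣ t + b * ∣C∣ t
∣L∣ zero = 1
∣L∣ (suc t) = b * ∣L∣ t
∣K∣ zero = 0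
∣K∣ (suc t) = 3 * (b * ∣L∣ t) + b * ∣K∣ t

V-enum : ∀ t → V t ↔ Fin (∣V∣ t)
V-enum zero = ↔-sym 1↔⊤
V-enum (suc t) = ↔-refl ×-enum (B-enum ×-enum V-enum t)

H-enum : ∀ t → H t ↔ Fin (∣H∣ t)
H-enum zero = ↔-sym 0↔⊥
H-enum (suc t) = ((B-enum ×-enum V-enum t) ×-enum (B-enum ×-enum V-enum t)) ⊎-enum
  (↔-refl ×-enum (H-enum t ×-enum (B-enum ×-enum B-enum)))

C-enum : ∀ t → C t ↔ Fin (∣C∣ t)
C-enum zero = ↔-sym 0↔⊥
C-enum (suc t) = (B-enum ×-enum V-enum t) ⊎-enum (B-enum ×-enum C-enum t)

L-enum : ∀ t → L t ↔ Fin (∣L∣ t)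
L-enum zero = ↔-sym 1↔⊤
L-enum (suc t) = B-enum ×-enum L-enum t

K-enum : ∀ t → K t ↔ Fin (∣K∣ t)
K-enum zero = ↔-sym 0↔⊥
K-enum (suc t) = (↔-refl ×-enum (B-enum ×-enum L-enum t)) ⊎-enum (B-enum ×-enum K-enum t)

-- Top colours use a third of the new |V| and low colours inductively at most a sixth, because all
-- three digits share them.
2∣C∣≤∣V∣ : ∀ t → 2 * ∣C∣ t ≤ ∣V∣ t
2∣C∣≤∣V∣ zero = z≤n
2∣C∣≤∣V∣ (suc t) = begin
  2 * (b * ∣V∣ t + b * ∣C∣ t)       ≡⟨ lemma b (∣V∣ t) (∣C∣ t) ⟩
  2 * (b * ∣V∣ t) + b * (2 * ∣C∣ t) ≤⟨ ℕ.+-monoʳ-≤ (2 * (b * ∣V∣ t)) (ℕ.*-monoʳ-≤ b (2∣C∣≤∣V∣ t)) ⟩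
  2 * (b * ∣V∣ t) + b * ∣V∣ t       ≡⟨ lemma' (b * ∣V∣ t) ⟩
  3 * (b * ∣V∣ t) ∎
  where
  open ℕ.≤-Reasoning
  lemma : ∀ b v c → 2 * (b * v + b * c) ≡ 2 * (b * v) + b * (2 * c)
  lemma = solve-∀
  lemma' : ∀ x → 2 * x + x ≡ 3 * x
  lemma' = solve-∀

3^t∣L∣≡∣V∣ : ∀ t → 3 ^ t * ∣L∣ t ≡ ∣V∣ t
3^t∣L∣≡∣V∣ zero = refl
3^t∣L∣≡∣V∣ (suc t) = trans (lemma (3 ^ t) b (∣L∣ t)) (cong (λ x → 3 * (b * x)) (3^t∣L∣≡∣V∣ t))
  where
  lemma : ∀ x b l → 3 * x * (b * l) ≡ 3 * (b * (x * l))
  lemma = solve-∀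

∣K∣≡3t∣L∣ : ∀ t → ∣K∣ t ≡ 3 * t * ∣L∣ t
∣K∣≡3t∣L∣ zero = refl
∣K∣≡3t∣L∣ (suc t) = trans (cong (λ x → 3 * (b * ∣L∣ t) + b * x) (∣K∣≡3t∣L∣ t)) (lemma b (∣L∣ t) t)
  where
  lemma : ∀ b l t → 3 * (b * l) + b * (3 * t * l) ≡ 3 * (1 + t) * (b * l)
  lemma = solve-∀

1≤∣L∣ : ∀ t → 1 ≤ ∣L∣ t
1≤∣L∣ zero = s≤s z≤n
1≤∣L∣ (suc t) = ℕ.*-mono-≤ 1≤b (1≤∣L∣ t)

3^t≤∣V∣ : ∀ t → 3 ^ t ≤ ∣V∣ t
3^t≤∣V∣ t = begin
  3 ^ t           ≡⟨ sym (ℕ.*-identityʳ (3 ^ t)) ⟩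
  3 ^ t * 1       ≤⟨ ℕ.*-monoʳ-≤ (3 ^ t) (1≤∣L∣ t) ⟩
  3 ^ t * ∣L∣ t   ≡⟨ 3^t∣L∣≡∣V∣ t ⟩
  ∣V∣ t ∎
  where open ℕ.≤-Reasoning

t<3^t : ∀ t → t < 3 ^ t
t<3^t zero = s≤s z≤n
t<3^t (suc t) = begin-strict
  suc t           ≤⟨ t<3^t t ⟩
  3 ^ t           <⟨ ℕ.m<m+n (3 ^ t) (ℕ.≤-trans (s≤s z≤n) (ℕ.≤-trans (t<3^t t) (ℕ.m≤m+n (3 ^ t) _))) ⟩
  3 * 3 ^ t ∎
  where open ℕ.≤-Reasoning

^-distribʳ-* : ∀ r a b → (a * b) ^ r ≡ a ^ r * b ^ r
^-distribʳ-* zero a b = refl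
^-distribʳ-* (suc r) a b = trans (cong (a * b *_) (^-distribʳ-* r a b)) (lemma a b (a ^ r) (b ^ r))
  where
  lemma : ∀ a b x y → a * b * (x * y) ≡ a * x * (b * y)
  lemma = solve-∀

∣V∣≤[3^t]^9 : ∀ t → ∣V∣ t ≤ (3 ^ t) ^ 9
∣V∣≤[3^t]^9 zero = s≤s z≤n
∣V∣≤[3^t]^9 (suc t) = begin
  3 * (b * ∣V∣ t)        ≡⟨ sym (ℕ.*-assoc 3 b (∣V∣ t)) ⟩
  3 * b * ∣V∣ t          ≤⟨ ℕ.*-mono-≤ 3b≤3⁹ (∣V∣≤[3^t]^9 t) ⟩
  3 ^ 9 * (3 ^ t) ^ 9    ≡⟨ sym (^-distribʳ-* 9 3 (3 ^ t)) ⟩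
  (3 * 3 ^ t) ^ 9 ∎
  where open ℕ.≤-Reasoning

-- With B = 3 ^ t this turns degree bounds of the form d ≤ A n / 3 ^ t into d ≤ n ^ (1 − 1/(2r)).
power-saving : ∀ r {B d A n} .{{_ : NonZero B}} → B * d ≤ A * n → A * A * 3 ≤ B → n ≤ (3 * B) ^ r →
  d ^ (r + r) * n ^ 1 ≤ n ^ (r + r)
power-saving r {B} {d} {A} {n} Bd≤An A²3≤B n≤ = ℕ.*-cancelˡ-≤ (B ^ q) {{ℕ.m^n≢0 B q}} (begin
  B ^ q * (d ^ q * n ^ 1)        ≡⟨ cong (λ x → B ^ q * (d ^ q * x)) (ℕ.*-identityʳ n) ⟩
  B ^ q * (d ^ q * n)            ≡⟨ sym (ℕ.*-assoc (B ^ q) (d ^ q) n) ⟩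
  B ^ q * d ^ q * n              ≡⟨ cong (_* n) (sym (^-distribʳ-* q B d)) ⟩
  (B * d) ^ q * n                ≤⟨ ℕ.*-monoˡ-≤ n (ℕ.^-monoˡ-≤ q Bd≤An) ⟩
  (A * n) ^ q * n                ≡⟨ cong (_* n) (^-distribʳ-* q A n) ⟩
  A ^ q * n ^ q * n              ≡⟨ lemma (A ^ q) (n ^ q) n ⟩
  A ^ q * n * n ^ q              ≤⟨ ℕ.*-monoˡ-≤ (n ^ q) A^qn≤B^q ⟩
  B ^ q * n ^ q ∎)
  where
  open ℕ.≤-Reasoning
  q = r + r
  lemma : ∀ a x n → a * x * n ≡ a * n * x
  lemma = solve-∀
  lemma' : ∀ a t b → a * a * (t * b) ≡ a * a * t * b
  lemma' = solve-∀
  A^qn≤B^q : A ^ q * n ≤ B ^ q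
  A^qn≤B^q = begin
    A ^ q * n                          ≤⟨ ℕ.*-monoʳ-≤ (A ^ q) n≤ ⟩
    A ^ q * (3 * B) ^ r                ≡⟨ cong₂ _*_ (ℕ.^-distribˡ-+-* A r r) (^-distribʳ-* r 3 B) ⟩
    A ^ r * A ^ r * (3 ^ r * B ^ r)    ≡⟨ lemma' (A ^ r) (3 ^ r) (B ^ r) ⟩
    A ^ r * A ^ r * 3 ^ r * B ^ r      ≡⟨ cong (λ x → x * 3 ^ r * B ^ r) (sym (^-distribʳ-* r A A)) ⟩
    (A * A) ^ r * 3 ^ r * B ^ r        ≡⟨ cong (_* B ^ r) (sym (^-distribʳ-* r (A * A) 3)) ⟩
    (A * A * 3) ^ r * B ^ r            ≤⟨ ℕ.*-monoˡ-≤ (B ^ r) (ℕ.^-monoˡ-≤ r A²3≤B) ⟩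
    B ^ r * B ^ r                      ≡⟨ sym (ℕ.^-distribˡ-+-* B r r) ⟩
    B ^ q ∎

-- From 2 A (t + 1) ≤ 3 A t and 9/4 ≤ 3; so the inequality 3 A² ≤ 3ᵗ, once true, persists.
A-growth : ∀ t → A (suc t) * A (suc t) ≤ 3 * (A t * A t)
A-growth t = ℕ.*-cancelˡ-≤ 4 (begin
  4 * (A (suc t) * A (suc t))               ≡⟨ lemma (A (suc t)) ⟩
  (2 * A (suc t)) * (2 * A (suc t))         ≤⟨ ℕ.*-mono-≤ 2A'≤3A 2A'≤3A ⟩
  (3 * A t) * (3 * A t)                     ≡⟨ lemma₁ (A t) ⟩
  9 * (A t * A t)                           ≤⟨ ℕ.*-monoˡ-≤ (A t * A t) (from-yes (9 ≤? 12)) ⟩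
  12 * (A t * A t)                          ≡⟨ ℕ.*-assoc 4 3 (A t * A t) ⟩
  4 * (3 * (A t * A t)) ∎)
  where
  open ℕ.≤-Reasoning
  lemma : ∀ x → 4 * (x * x) ≡ (2 * x) * (2 * x)
  lemma = solve-∀
  lemma₁ : ∀ x → (3 * x) * (3 * x) ≡ 9 * (x * x)
  lemma₁ = solve-∀
  expand : ∀ t p → 2 * (3 * (1 + t) * (1 + p) + (1 + 21 * p)) ≡ 2 * (3 * t * (1 + p) + (1 + 21 * p)) + (6 + 6 * p)
  expand = solve-∀
  expand' : ∀ x p → 2 * (x + (1 + 21 * p)) + (1 + 7 * p) ≤ 3 * (x + (1 + 21 * p))
  expand' x p = begin
    2 * (x + (1 + 21 * p)) + (1 + 7 * p)              ≤⟨ ℕ.m≤m+n _ (x + 14 * p) ⟩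
    2 * (x + (1 + 21 * p)) + (1 + 7 * p) + (x + 14 * p) ≡⟨ l x p ⟩
    3 * (x + (1 + 21 * p)) ∎
    where
    l : ∀ x p → 2 * (x + (1 + 21 * p)) + (1 + 7 * p) + (x + 14 * p) ≡ 3 * (x + (1 + 21 * p))
    l = solve-∀
  2A'≤3A : 2 * A (suc t) ≤ 3 * A t
  2A'≤3A = begin
    2 * A (suc t)              ≡⟨ expand t P ⟩
    2 * A t + (6 + 6 * P)      ≤⟨ ℕ.+-monoʳ-≤ (2 * A t) (ℕ.+-monoˡ-≤ (6 * P) 6≤P) ⟩
    2 * A t + 7 * P            ≤⟨ ℕ.+-monoʳ-≤ (2 * A t) (ℕ.n≤1+n (7 * P)) ⟩
    2 * A t + (1 + 7 * P)      ≤⟨ expand' (3 * t * (1 + P)) P ⟩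
    3 * A t ∎

A-bound : ∀ j → A (j + t₀) * A (j + t₀) * 3 ≤ 3 ^ (j + t₀)
A-bound zero = A-base
A-bound (suc j) = begin
  A (suc (j + t₀)) * A (suc (j + t₀)) * 3     ≤⟨ ℕ.*-monoˡ-≤ 3 (A-growth (j + t₀)) ⟩
  3 * (A (j + t₀) * A (j + t₀)) * 3           ≡⟨ ℕ.*-assoc 3 (A (j + t₀) * A (j + t₀)) 3 ⟩
  3 * (A (j + t₀) * A (j + t₀) * 3)           ≤⟨ ℕ.*-monoʳ-≤ 3 (A-bound j) ⟩
  3 * 3 ^ (j + t₀) ∎
  where open ℕ.≤-Reasoning

-- The lower bound gives 3ᵗ |V| ≤ |V|² ≤ n, so that the lost hexagons, a constant times |V|, are few
-- enough. The upper bound makes 3ᵗ as large as a fixed power of n.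
record Scale (n : ℕ) : Set where
  field
    j : ℕ
    lower : ∣V∣ (j + t₀) * ∣V∣ (j + t₀) ≤ n
    upper : n < ∣V∣ (suc (j + t₀)) * ∣V∣ (suc (j + t₀))

scale : ∀ n → ∣V∣ t₀ * ∣V∣ t₀ ≤ n → Scale n
-- Since n < 3ⁿ, a search of n steps cannot miss the window.
scale n base = go n 0 base (begin-strict
  n                              <⟨ t<3^t n ⟩
  3 ^ n                          ≤⟨ ℕ.^-monoʳ-≤ 3 (ℕ.m≤m+n n t₀) ⟩
  3 ^ (n + t₀)                   ≤⟨ 3^t≤∣V∣ (n + t₀) ⟩
  ∣V∣ (n + t₀)                   ≤⟨ ℕ.m≤m*n (∣V∣ (n + t₀)) (∣V∣ (n + t₀)) {{ℕ.>-nonZero (ℕ.≤-trans (s≤s z≤n) (ℕ.≤-trans (t<3^t (n + t₀)) (3^t≤∣V∣ (n + t₀))))}} ⟩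
  ∣V∣ (n + t₀) * ∣V∣ (n + t₀)    ≡⟨ cong (λ x → ∣V∣ (x + t₀) * ∣V∣ (x + t₀)) (sym (ℕ.+-identityʳ n)) ⟩
  ∣V∣ (n + 0 + t₀) * ∣V∣ (n + 0 + t₀) ∎)
  where
  open ℕ.≤-Reasoning
  go : ∀ d j → ∣V∣ (j + t₀) * ∣V∣ (j + t₀) ≤ n → n < ∣V∣ (d + j + t₀) * ∣V∣ (d + j + t₀) → Scale n
  go zero j low up = contradiction low (ℕ.<⇒≱ up)
  go (suc d) j low up with n <? ∣V∣ (suc (j + t₀)) * ∣V∣ (suc (j + t₀))
  ... | yes up' = record { j = j ; lower = low ; upper = up' }
  ... | no ¬up' = go d (suc j) (ℕ.≮⇒≥ ¬up') (subst (λ x → n < ∣V∣ (x + t₀) * ∣V∣ (x + t₀)) (sym (ℕ.+-suc d j)) up)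

double≤⇒≤half : ∀ {a n} → 2 * a ≤ n → a ≤ ⌈ n /2⌉
double≤⇒≤half {a} {n} 2a≤n = begin
  a                 ≡⟨ ℕ.n≡⌊n+n/2⌋ a ⟩
  ⌊ a + a /2⌋       ≤⟨ ℕ.⌊n/2⌋-mono (subst (_≤ n) (cong (a +_) (ℕ.+-identityʳ a)) 2a≤n) ⟩
  ⌊ n /2⌋           ≤⟨ ℕ.⌊n/2⌋≤⌈n/2⌉ n ⟩
  ⌈ n /2⌉ ∎
  where open ℕ.≤-Reasoning

-- The parameters for a given n

module Assemble (n : ℕ) (sc : Scale n) where
  open Scale sc
  open ℕ.≤-Reasoning

  t g : ℕ
  t = j + t₀
  g = ∣V∣ t

  1≤g : 1 ≤ g
  1≤g = ℕ.≤-trans (ℕ.≤-trans (s≤s z≤n) (t<3^t t)) (3^t≤∣V∣ t)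

  instance
    g-nonZero : NonZero g
    g-nonZero = ℕ.>-nonZero 1≤g

    Pg-nonZero : NonZero (P * g)
    Pg-nonZero = ℕ.m*n≢0 P g {{ℕ.>-nonZero (ℕ.≤-trans (s≤s z≤n) 6≤P)}}

    3^t-nonZero : NonZero (3 ^ t)
    3^t-nonZero = ℕ.m^n≢0 3 t

  g≤n : g ≤ n
  g≤n = ℕ.≤-trans (ℕ.m≤m*n g g) lower

  -- Both σ and m are 1 modulo P and consecutive as such, chosen with σ g ≤ n ≤ m g. So n is caught
  -- between full layers, at most P of them are incomplete, and division of n - g instead of n
  -- accounts for the summand 1.
  s m σ : ℕ
  s = (n ∸ g) / (P * g)
  m = suc (suc s * P)
  σ = suc (s * P)

  m≡σ+P : m ≡ σ + P
  m≡σ+P = cong suc (ℕ.+-comm P (s * P))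

  σg≤n : σ * g ≤ n
  σg≤n = begin
    g + s * P * g          ≡⟨ cong (g +_) (ℕ.*-assoc s P g) ⟩
    g + s * (P * g)        ≤⟨ ℕ.+-monoʳ-≤ g (m/n*n≤m (n ∸ g) (P * g)) ⟩
    g + (n ∸ g)            ≡⟨ ℕ.m+[n∸m]≡n g≤n ⟩
    n ∎

  n≤mg : n ≤ m * g
  n≤mg = begin
    n                                              ≡⟨ sym (ℕ.m+[n∸m]≡n g≤n) ⟩
    g + (n ∸ g)                                    ≡⟨ cong (g +_) (m≡m%n+[m/n]*n (n ∸ g) (P * g)) ⟩
    g + ((n ∸ g) % (P * g) + s * (P * g))          ≤⟨ ℕ.+-monoʳ-≤ g (ℕ.+-monoˡ-≤ (s * (P * g)) (ℕ.<⇒≤ (m%n<n (n ∸ g) (P * g)))) ⟩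
    g + (P * g + s * (P * g))                      ≡⟨ lemma g P s ⟩
    g + (P + s * P) * g ∎
    where
    lemma : ∀ g p s → g + (p * g + s * (p * g)) ≡ g + (p + s * p) * g
    lemma = solve-∀

  σc≤half : σ * ∣C∣ t ≤ ⌈ n /2⌉
  σc≤half = double≤⇒≤half (begin
    2 * (σ * ∣C∣ t)    ≡⟨ lemma σ (∣C∣ t) ⟩
    σ * (2 * ∣C∣ t)    ≤⟨ ℕ.*-monoʳ-≤ σ (2∣C∣≤∣V∣ t) ⟩
    σ * g              ≤⟨ σg≤n ⟩
    n ∎)
    where
    lemma : ∀ s c → 2 * (s * c) ≡ s * (2 * c)
    lemma = solve-∀

  default : Fin ⌈ n /2⌉
  default = Fin.fromℕ< (double≤⇒≤half {1} (begin
    2           ≤⟨ ℕ.≤-trans 2≤t₀ (ℕ.m≤n+m t₀ j) ⟩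
    t           ≤⟨ ℕ.<⇒≤ (t<3^t t) ⟩
    3 ^ t       ≤⟨ 3^t≤∣V∣ t ⟩
    g           ≤⟨ g≤n ⟩
    n ∎))

  module Z = Spreading (suc s)
  open Bounds (level t) Z.lin Z.spread (V-enum t) (H-enum t) (C-enum t) (L-enum t) (K-enum t)
    {n = n} {k = ⌈ n /2⌉} {σ = σ} {ρ = P}
    n≤mg m≡σ+P σg≤n σc≤half default public

  mg≤ : m * g ≤ (1 + P) * n
  mg≤ = begin
    m * g              ≡⟨ cong (_* g) m≡σ+P ⟩
    (σ + P) * g        ≡⟨ ℕ.*-distribʳ-+ g σ P ⟩
    σ * g + P * g      ≤⟨ ℕ.+-mono-≤ σg≤n (ℕ.*-monoʳ-≤ P g≤n) ⟩
    n + P * n ∎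

  3^tg≤n : 3 ^ t * g ≤ n
  3^tg≤n = ℕ.≤-trans (ℕ.*-monoˡ-≤ g (3^t≤∣V∣ t)) lower

  n≤ : n ≤ (3 * 3 ^ t) ^ 18
  n≤ = begin
    n                                  ≤⟨ ℕ.<⇒≤ upper ⟩
    ∣V∣ (suc t) * ∣V∣ (suc t)          ≤⟨ ℕ.*-mono-≤ (∣V∣≤[3^t]^9 (suc t)) (∣V∣≤[3^t]^9 (suc t)) ⟩
    (3 ^ suc t) ^ 9 * (3 ^ suc t) ^ 9  ≡⟨ sym (ℕ.^-distribˡ-+-* (3 ^ suc t) 9 9) ⟩
    (3 * 3 ^ t) ^ 18 ∎

  saving : ∀ d → 3 ^ t * d ≤ A t * n → LePow d n 1 36
  -- The exponent 18 is that of `n≤`; doubling it gives δ = 1/36.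
  saving d bound = power-saving 18 {3 ^ t} {d} {A t} {n} bound (A-bound j) n≤

  degree-saving : ∀ d → d ≤ ∣L∣ t * m + g * (7 * P) → LePow d n 1 36
  degree-saving d bound = saving d (begin
    3 ^ t * d                                           ≤⟨ ℕ.*-monoʳ-≤ (3 ^ t) bound ⟩
    3 ^ t * (∣L∣ t * m + g * (7 * P))                   ≡⟨ lemma (3 ^ t) (∣L∣ t) m g P ⟩
    m * (3 ^ t * ∣L∣ t) + 7 * P * (3 ^ t * g)           ≡⟨ cong (λ x → m * x + 7 * P * (3 ^ t * g)) (3^t∣L∣≡∣V∣ t) ⟩
    m * g + 7 * P * (3 ^ t * g)                         ≤⟨ ℕ.+-mono-≤ mg≤ (ℕ.*-monoʳ-≤ (7 * P) 3^tg≤n) ⟩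
    (1 + P) * n + 7 * P * n                             ≤⟨ ℕ.m≤m+n _ _ ⟩
    (1 + P) * n + 7 * P * n + (3 * t * (1 + P) + 13 * P) * n ≡⟨ lemma' P n t ⟩
    A t * n ∎)
    where
    lemma : ∀ x l m g p → x * (l * m + g * (7 * p)) ≡ m * (x * l) + 7 * p * (x * g)
    lemma = solve-∀
    lemma' : ∀ p n t → (1 + p) * n + 7 * p * n + (3 * t * (1 + p) + 13 * p) * n ≡ (3 * t * (1 + p) + (1 + 21 * p)) * n
    lemma' = solve-∀

  bad-saving : ∀ d → d ≤ ∣K∣ t * m + g * (3 * (7 * P)) → LePow4 d n 1 36
  bad-saving d bound = ℕ.≤-trans (saving d (begin
    3 ^ t * d                                               ≤⟨ ℕ.*-monoʳ-≤ (3 ^ t) bound ⟩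
    3 ^ t * (∣K∣ t * m + g * (3 * (7 * P)))                 ≡⟨ cong (λ x → 3 ^ t * (x * m + g * (3 * (7 * P)))) (∣K∣≡3t∣L∣ t) ⟩
    3 ^ t * (3 * t * ∣L∣ t * m + g * (3 * (7 * P)))         ≡⟨ lemma (3 ^ t) (∣L∣ t) m g P t ⟩
    3 * t * (m * (3 ^ t * ∣L∣ t)) + 21 * P * (3 ^ t * g)    ≡⟨ cong (λ x → 3 * t * (m * x) + 21 * P * (3 ^ t * g)) (3^t∣L∣≡∣V∣ t) ⟩
    3 * t * (m * g) + 21 * P * (3 ^ t * g)                  ≤⟨ ℕ.+-mono-≤ (ℕ.*-monoʳ-≤ (3 * t) mg≤) (ℕ.*-monoʳ-≤ (21 * P) 3^tg≤n) ⟩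
    3 * t * ((1 + P) * n) + 21 * P * n                      ≤⟨ ℕ.m≤m+n _ n ⟩
    3 * t * ((1 + P) * n) + 21 * P * n + n                  ≡⟨ lemma' P n t ⟩
    A t * n ∎)) (ℕ.m≤n*m (n ^ 36) (4 ^ 36) {{ℕ.m^n≢0 4 36}})
    where
    lemma : ∀ x l m g p t → x * (3 * t * l * m + g * (3 * (7 * p))) ≡ 3 * t * (m * (x * l)) + 21 * p * (x * g)
    lemma = solve-∀
    lemma' : ∀ p n t → 3 * t * ((1 + p) * n) + 21 * p * n + n ≡ (3 * t * (1 + p) + (1 + 21 * p)) * n
    lemma' = solve-∀

theorem20 : Σ ℕ λ p → Σ ℕ λ q → (0 < p) × (0 < q) ×
    (Σ ℕ λ N → ∀ n → N ≤ n →
    Σ (BipGraph n) λ F → Σ (Fin n → Fin n → Fin ⌈ n /2⌉) λ col →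
    (∀ c → ClassIsC6Union F col c) ×
    C4Odd F col ×
    (∀ x → LePow (degLX F x) n p q) ×
    (∀ y → LePow (degLY F y) n p q) ×
    (∀ x y → LePow4 (badCount F col x y) n p q))
theorem20 = 1 , 36 , s≤s z≤n , s≤s z≤n , ∣V∣ t₀ * ∣V∣ t₀ , λ n N≤n →
  let open Assemble n (scale n N≤n) in
  F , colouring , classes , C4-odd ,
  (λ x → degree-saving _ (count-bound (degX-coded x))) ,
  (λ y → degree-saving _ (count-bound (degY-coded y))) ,
  (λ x y → bad-saving _ (pair-count-bound (bad-coded x y)))
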